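{- There is an algorithm that, given a graph $G$ and a bubble partition $\mathcal{V}$ of $G$, computes a maximum cut of $G$ in time $\mathcal{O}^*\left(|V(G)|^{4\alpha(\mathcal{V})}\, 4^{w(\mathcal{V})}\right)$, where $\alpha(\mathcal V)$ is the independence number and $w(\mathcal V)$ is the width of $\mathcal V$.
   Context: Graphs are finite and simple. A cut of $G$ is a partition of $V(G)$ into $S$ and $\bar S = V(G)\setminus S$; its cut size is the number of edges with exactly one endpoint in $S$; a maximum cut is one of largest cut size. Two adjacent vertices $u,v$ of $G$ are twins if $N_G(u)\setminus\{v\} = N_G(v)\setminus\{u\}$. A bubble of $G$ is a maximal set of pairwise twin vertices (possibly a single vertex); the bubbles partition $V(G)$. A bubble partition of $G$ is a partition $\mathcal V=\{V_1,\dots,V_k\}$ of $V(G)$ such that every $V_i$ is a union of bubbles of $G$ and the graph obtained from $G$ by contracting every set $V_i$ to a single vertex (vertices $i\neq j$ being adjacent iff $G$ has an edge between $V_i$ and $V_j$) is a tree, possibly with a single vertex. Let $V_i^-$ denote the set of bubbles of $G$ contained in $V_i$. The independence number of $\mathcal V$ is $\alpha(\mathcal V)=\max_i \alpha(G[V_i])$, where $\alpha(H)$ is the maximum size of an independent set of the graph $H$. The width of $\mathcal V$ is $w(\mathcal V)=\max_i |V_i^-|$. The notation $\mathcal O^*$ omits factors polynomial in the input size. -}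

module Defs where

open import Data.Bool using (Bool; true; false; T; _xor_)
open import Data.Bool.Properties using (T?) renaming (_≟_ to _≟ᵇ_)
open import Data.Fin using (Fin; zero; suc; inject₁; fromℕ)
open import Data.Fin.Properties using (any?; all?) renaming (_≟_ to _≟ᶠ_; _<?_ to _<ᶠ?_)
open import Data.Fin.Subset
  using (Subset; inside; outside; ∣_∣; ⋃; _∈_; _⊆_; _-_)
open import Data.Fin.Subset.Properties using (anySubset?; _∈?_; _⊆?_)
open import Data.List as List
  using (List; []; _∷_; _++_; length; filter; filterᵇ; allFin; cartesianProduct)
open import Data.List.Extrema.Nat using (max)
open import Data.List.Relation.Unary.All using (All)
open import Data.Nat using (ℕ; zero; suc; _+_; _*_; _≤_)
open import Data.Product using (Σ-syntax; ∃-syntax; _×_; _,_)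
open import Data.Vec as Vec using (Vec; []; _∷_; lookup; tabulate)
open import Data.Vec.Properties using (≡-dec)
open import Function.Definitions using (Injective; Surjective)
open import Relation.Binary.Construct.Closure.ReflexiveTransitive using (Star)
open import Relation.Binary.PropositionalEquality using (_≡_; _≢_; refl; sym)
open import Relation.Nullary using (¬_; Dec; does; isYes; ¬?; _×-dec_; _→-dec_)
open import Relation.Nullary.Decidable using (map′; decidable-stable; toWitness; fromWitness)

private
  variable
    n k m : ℕ

------------------------------------------------------------------------
-- Graphs

record Graph (n : ℕ) : Set where
  field
    edge        : Fin n → Fin n → Bool
    symmetric   : ∀ {u v} → T (edge u v) → T (edge v u)
    irreflexive : ∀ {u} → ¬ T (edge u u)

  Adj : Fin n → Fin n → Set
  Adj u v = T (edge u v)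

  N : Fin n → Subset n
  N u = tabulate (edge u)

  edges : List (Fin n × Fin n)
  edges = filter (λ (u , v) → (u <ᶠ? v) ×-dec T? (edge u v))
                 (cartesianProduct (allFin n) (allFin n))

open Graph public using (Adj; N; edges)

Connected : Graph n → Set
Connected G = ∀ u v → Star (Adj G) u v

-- A cycle c 0, …, c ℓ of ℓ + 1 ≥ 3 distinct vertices.
record Cycle (G : Graph n) : Set where
  field
    ℓ        : ℕ
    2≤ℓ      : 2 ≤ ℓ
    c        : Fin (suc ℓ) → Fin n
    distinct : Injective _≡_ _≡_ c
    step     : ∀ (i : Fin ℓ) → Adj G (c (inject₁ i)) (c (suc i))
    close    : Adj G (c (fromℕ ℓ)) (c zero)

IsTree : Graph n → Set
IsTree {n} G = 1 ≤ n × Connected G × ¬ Cycle G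

-- A cut is given by one side S; S may be empty or everything.
cutSize : Graph n → Subset n → ℕ
cutSize G S = length (filterᵇ (λ (u , v) → lookup S u xor lookup S v) (edges G))

IsMaximumCut : Graph n → Subset n → Set
IsMaximumCut G S = ∀ S′ → cutSize G S′ ≤ cutSize G S

allSubsets : ∀ n → List (Subset n)
allSubsets zero    = [] ∷ []
allSubsets (suc n) = List.map (outside ∷_) (allSubsets n) ++ List.map (inside ∷_) (allSubsets n)

Independent : Graph n → Subset n → Set
Independent G S = ∀ u → u ∈ S → ∀ v → v ∈ S → ¬ Adj G u v

independent? : (G : Graph n) (S : Subset n) → Dec (Independent G S)
independent? G S =
  all? λ u → (u ∈? S) →-dec all? λ v → (v ∈? S) →-dec ¬? (T? (Graph.edge G u v))

-- α (G[W]): the independent sets of the induced subgraph G[W] are the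
-- independent sets of G contained in W.
αInduced : Graph n → Subset n → ℕ
αInduced {n} G W =
  max 0 (List.map ∣_∣ (filter (λ S → (S ⊆? W) ×-dec independent? G S) (allSubsets n)))

------------------------------------------------------------------------
-- Bubbles

Twins : Graph n → Fin n → Fin n → Set
Twins G u v = Adj G u v × N G u - v ≡ N G v - u

PairwiseTwins : Graph n → Subset n → Set
PairwiseTwins G B = ∀ u → u ∈ B → ∀ v → v ∈ B → u ≢ v → Twins G u v

IsBubble : Graph n → Subset n → Set
IsBubble G B = PairwiseTwins G B × (∀ B′ → PairwiseTwins G B′ → B ⊆ B′ → B′ ⊆ B)

twins? : (G : Graph n) (u v : Fin n) → Dec (Twins G u v)
twins? G u v = T? (Graph.edge G u v) ×-dec ≡-dec _≟ᵇ_ (N G u - v) (N G v - u)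

pairwiseTwins? : (G : Graph n) (B : Subset n) → Dec (PairwiseTwins G B)
pairwiseTwins? G B =
  all? λ u → (u ∈? B) →-dec all? λ v → (v ∈? B) →-dec (¬? (u ≟ᶠ v) →-dec twins? G u v)

allSubset? : {P : Subset n → Set} → (∀ S → Dec (P S)) → Dec (∀ S → P S)
allSubset? P? = map′ (λ ¬∃¬P S → decidable-stable (P? S) λ ¬PS → ¬∃¬P (S , ¬PS))
                     (λ ∀P (S , ¬PS) → ¬PS (∀P S))
                     (¬? (anySubset? λ S → ¬? (P? S)))

isBubble? : (G : Graph n) (B : Subset n) → Dec (IsBubble G B)
isBubble? G B = pairwiseTwins? G B
  ×-dec allSubset? λ B′ → pairwiseTwins? G B′ →-dec ((B ⊆? B′) →-dec (B′ ⊆? B))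

------------------------------------------------------------------------
-- Bubble partitions

-- A partition of the vertices into k classes is a map p to Fin k
-- (surjective, as imposed below); class p i is the set Vᵢ.
class : (Fin n → Fin k) → Fin k → Subset n
class p i = tabulate λ v → does (p v ≟ᶠ i)

ContractedAdj : Graph n → (Fin n → Fin k) → Fin k → Fin k → Set
ContractedAdj G p i j =
  i ≢ j × ∃[ u ] ∃[ v ] u ∈ class p i × v ∈ class p j × Adj G u v

contractedAdj? : (G : Graph n) (p : Fin n → Fin k) (i j : Fin k) → Dec (ContractedAdj G p i j)
contractedAdj? G p i j = ¬? (i ≟ᶠ j) ×-dec any? λ u → any? λ v →
  (u ∈? class p i) ×-dec (v ∈? class p j) ×-dec T? (Graph.edge G u v)

contract : Graph n → (Fin n → Fin k) → Graph k
contract G p = record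
  { edge        = λ i j → isYes (contractedAdj? G p i j)
  ; symmetric   = λ {i} {j} e →
      let i≢j , u , v , u∈ , v∈ , uv = toWitness {a? = contractedAdj? G p i j} e
      in  fromWitness {a? = contractedAdj? G p j i}
            ((λ j≡i → i≢j (sym j≡i)) , v , u , v∈ , u∈ , Graph.symmetric G uv)
  ; irreflexive = λ {i} e →
      let i≢i , _ = toWitness {a? = contractedAdj? G p i i} e in i≢i refl
  }

record BubblePartition (G : Graph n) (k : ℕ) : Set where
  field
    part          : Fin n → Fin k
    surjective    : Surjective _≡_ _≡_ part
    bubbleUnion   : ∀ i → ∃[ Bs ] All (IsBubble G) Bs × class part i ≡ ⋃ Bs
    contractsTree : IsTree (contract G part)

  V : Fin k → Subset n
  V = class part

  V⁻ : Fin k → List (Subset n)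
  V⁻ i = filter (λ B → isBubble? G B ×-dec (B ⊆? V i)) (allSubsets n)

  α : ℕ
  α = max 0 (List.map (λ i → αInduced G (V i)) (allFin k))

  width : ℕ
  width = max 0 (List.map (λ i → length (V⁻ i)) (allFin k))

open BubblePartition public using (V; V⁻; α; width)

------------------------------------------------------------------------
-- Model of computation

-- Algorithms are programs of a first-order functional language (finitely
-- many mutually recursive functions, call by value) whose only data are
-- binary trees, as in pure LISP or N. D. Jones's language F.  The running
-- time is the number of expression nodes evaluated.  Each of them is a
-- constant-time pointer operation on a RAM: trees are immutable and shared,
-- there is no primitive arithmetic or equality test, and environments have
-- bounded length as the program is fixed.  Conversely a RAM using words of
-- O(log T) bits for T steps is simulated with an overhead polynomial in
-- log T (memory as a balanced tree), so O* bounds with log T polynomial in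
-- the input size, such as the one below, do not depend on this choice.

infixr 5 _∙_

data Tree : Set where
  nil : Tree
  _∙_ : Tree → Tree → Tree

size : Tree → ℕ
size nil     = 1
size (a ∙ b) = suc (size a + size b)

-- Expr σ n: expressions in n variables (de Bruijn) over m functions with
-- arities σ.
data Expr (σ : Vec ℕ m) : ℕ → Set where
  var  : Fin n → Expr σ n
  nil  : Expr σ n
  _∙_  : Expr σ n → Expr σ n → Expr σ n
  -- case e e₁ e₂: e₁ if e is nil; e₂ with head (variable 0) and tail
  -- (variable 1) bound if e is a ∙ b.
  case : Expr σ n → Expr σ n → Expr σ (2 + n) → Expr σ n
  bind : Expr σ n → Expr σ (suc n) → Expr σ n
  call : (f : Fin m) → Vec (Expr σ n) (lookup σ f) → Expr σ n

record Program : Set where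
  field
    functions : ℕ
    arity     : Vec ℕ functions
    body      : (f : Fin functions) → Expr arity (lookup arity f)
    main      : Expr arity 1

module Semantics (P : Program) where
  open Program P

  private
    variable
      ρ     : Vec Tree n
      a b v : Tree
      s t u : ℕ

  infix 4 _⊢_⇓_[_] _⊢*_⇓_[_]

  -- ρ ⊢ e ⇓ v [ t ]: in environment ρ, e evaluates to v in t steps.
  mutual
    data _⊢_⇓_[_] : Vec Tree n → Expr arity n → Tree → ℕ → Set where
      var      : {x : Fin n} → ρ ⊢ var x ⇓ lookup ρ x [ 1 ]
      nil      : ρ ⊢ nil ⇓ nil [ 1 ]
      _∙_      : {e₁ e₂ : Expr arity n} →
                 ρ ⊢ e₁ ⇓ a [ s ] → ρ ⊢ e₂ ⇓ b [ t ] →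
                 ρ ⊢ e₁ ∙ e₂ ⇓ a ∙ b [ suc (s + t) ]
      case-nil : {e e₁ : Expr arity n} {e₂ : Expr arity (2 + n)} →
                 ρ ⊢ e ⇓ nil [ s ] → ρ ⊢ e₁ ⇓ v [ t ] →
                 ρ ⊢ case e e₁ e₂ ⇓ v [ suc (s + t) ]
      case-∙   : {e e₁ : Expr arity n} {e₂ : Expr arity (2 + n)} →
                 ρ ⊢ e ⇓ a ∙ b [ s ] → (a ∷ b ∷ ρ) ⊢ e₂ ⇓ v [ t ] →
                 ρ ⊢ case e e₁ e₂ ⇓ v [ suc (s + t) ]
      bind     : {e₁ : Expr arity n} {e₂ : Expr arity (suc n)} →
                 ρ ⊢ e₁ ⇓ a [ s ] → (a ∷ ρ) ⊢ e₂ ⇓ v [ t ] →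
                 ρ ⊢ bind e₁ e₂ ⇓ v [ suc (s + t) ]
      call     : {f : Fin functions} {es : Vec (Expr arity n) (lookup arity f)}
                 {vs : Vec Tree (lookup arity f)} →
                 ρ ⊢* es ⇓ vs [ s ] → vs ⊢ body f ⇓ v [ t ] →
                 ρ ⊢ call f es ⇓ v [ suc (s + t) ]

    data _⊢*_⇓_[_] : Vec Tree n → Vec (Expr arity n) k → Vec Tree k → ℕ → Set where
      []  : ρ ⊢* [] ⇓ [] [ 0 ]
      _∷_ : {e : Expr arity n} {es : Vec (Expr arity n) k} {vs : Vec Tree k} →
            ρ ⊢ e ⇓ v [ s ] → ρ ⊢* es ⇓ vs [ t ] →
            ρ ⊢* (e ∷ es) ⇓ (v ∷ vs) [ s + t ]

_⟨_⟩⇓_[_] : Program → Tree → Tree → ℕ → Set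
P ⟨ x ⟩⇓ y [ t ] = (x ∷ []) ⊢ Program.main P ⇓ y [ t ]
  where open Semantics P

------------------------------------------------------------------------
-- Encodings

encodeBool : Bool → Tree
encodeBool false = nil
encodeBool true  = nil ∙ nil

encodeList : {A : Set} → (A → Tree) → List A → Tree
encodeList enc []       = nil
encodeList enc (x ∷ xs) = enc x ∙ encodeList enc xs

encodeSubset : Subset n → Tree
encodeSubset S = encodeList encodeBool (Vec.toList S)

-- The adjacency matrix.
encodeGraph : Graph n → Tree
encodeGraph {n} G = encodeList (λ v → encodeSubset (N G v)) (allFin n)

encodePartition : {G : Graph n} → BubblePartition G k → Tree
encodePartition {k = k} 𝒱 = encodeList (λ i → encodeSubset (V 𝒱 i)) (allFin k)

encodeInput : (G : Graph n) → BubblePartition G k → Tree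
encodeInput G 𝒱 = encodeGraph G ∙ encodePartition 𝒱

{-# OPTIONS --safe #-}
module Submission where

-- In a maximum cut, exchanging vertices between two adjacent bubbles that are
-- both split by the cut changes its size linearly, hence not at all.  So some
-- maximum cut splits only pairwise nonadjacent bubbles and meets each bubble in
-- an initial segment.  Within a class Vᵢ such a cut is determined by the
-- bubbles it contains and by an independent set of last vertices in the split
-- bubbles, which leaves at most W = (n + 1)^α 2^w candidates.
--
-- The classes form a tree.  Each of them keeps a table of candidates, extended
-- to the classes already merged into it.  A leaf l is merged into its
-- neighbour j by extending every entry S of j by the entry T of l for which
-- S ∪ T has the largest cut; all other vertices may be taken to lie outside,
-- since no edge joins l to them.  This takes W² cut evaluations per leaf, and
-- W² ≤ 4 n^(4α) 4^w.
--
-- The program is written in a total language of primitive recursive terms whose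
-- variables carry sorts bounding the loops they control.  Sorts give the time
-- bound from the shape of the term, up to assertions on the sizes of
-- intermediate tables.

open import Defs
open import Data.Bool using (Bool; true; false; T; _∧_; _∨_; not; _xor_; if_then_else_)
open import Data.Bool.Properties as Boolₚ using (T?)
open import Data.Empty using (⊥; ⊥-elim)
open import Data.Fin as Fin using (Fin; zero; suc; toℕ; fromℕ; inject₁; inject≤)
open import Data.Fin.Properties as Finₚ
  using (_≟_; any?; all?; injective⇒≤; toℕ<n; toℕ-fromℕ; toℕ-inject₁; toℕ-inject≤; toℕ-injective)
  renaming (_<?_ to _<ᶠ?_)
open import Data.Fin.Subset using (Subset; _∪_; _∩_; _-_; _─_; ⋃; ⁅_⁆; ∣_∣)
  renaming (⊥ to ∅; _∈_ to _∈ˢ_)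
open import Data.Fin.Subset.Properties using (x∈p∪q⁺; x∈p∪q⁻; p⊂q⇒∣p∣<∣q∣; _⊆?_; ∣p∣≤n)
open import Data.List as List using (List; []; _∷_; _++_; length; filter; filterᵇ; allFin; cartesianProduct)
open import Data.List.Extrema.Nat using (max; xs≤max; max≤v⁺)
open import Data.List.Membership.Propositional using (_∈_; _∉_)
open import Data.List.Membership.Propositional.Properties
  using (∈-allFin; ∈-filter⁺; ∈-filter⁻; ∈-lookup; ∈-map⁺; ∈-map⁻; ∈-++⁺ˡ; ∈-++⁺ʳ)
open import Data.List.Properties using (length-map; length-tabulate; length-++; map-∘; map-id)
open import Data.List.Relation.Unary.All as All using (All; []; _∷_; universal)
open import Data.List.Relation.Unary.All.Properties using (map⁺)
open import Data.List.Relation.Unary.AllPairs using ([]; _∷_)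
open import Data.List.Relation.Unary.Any as Any using (here; there)
open import Data.List.Relation.Unary.Any.Properties using (lookup-index)
open import Data.List.Relation.Unary.Unique.Propositional using (Unique)
open import Data.List.Relation.Unary.Unique.Propositional.Properties using (allFin⁺; filter⁺)
open import Data.Maybe using (Maybe; just; nothing)
import Data.Maybe.Properties as Maybeₚ
open import Data.Nat hiding (_≟_)
open import Data.Nat.Induction using (<-wellFounded)
open import Data.Nat.Properties hiding (_≟_)
open import Data.Nat.Tactic.RingSolver using (solve-∀)
open import Data.Product using (Σ-syntax; ∃-syntax; _×_; _,_; proj₁; proj₂)
open import Data.Sum using (_⊎_; inj₁; inj₂)
open import Data.Unit using (⊤; tt)
open import Data.Vec as Vec using (Vec; []; _∷_; lookup)
open import Data.Vec.Properties
  using (lookup∘tabulate; lookup-replicate; lookup-zipWith; ≡-dec; []=⇒lookup; lookup⇒[]=; length-toList)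
open import Function using (_∘_; id; const; _⇔_; mk⇔; Equivalence)
open import Function.Definitions using (Injective)
open import Induction.WellFounded using (Acc; acc)
open import Level using (Level)
open import Relation.Binary.Definitions using (tri<; tri≈; tri>)
open import Relation.Binary.PropositionalEquality
open import Relation.Nullary using (¬_; Dec; yes; no; does; _×-dec_; _→-dec_)
open import Relation.Nullary.Decidable using (dec-true; dec-false; fromWitness)
open import Algebra.Properties.CommutativeMonoid.Sum +-0-commutativeMonoid
  using (sum; ∑-distrib-+; ∑-comm; sum-cong-≗)

-- Maximality by itself only turns exchanges between adjacent split bubbles into ties. These are
-- broken by a weight that orders bubbles by a code of their closed neighbourhoods and twins by
-- index: the reference cut is a maximum cut in which every weight-lowering exchange loses strictly.
--
-- A merge cannot keep that cut, because the entry chosen by the program may differ from it on the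
-- leaf. So each merge passes to another maximum cut that follows the choice. It need not be in
-- normal form, which matters only for filling the initial tables. The last node has no neighbour;
-- it is merged in the same way into a finished part, whose table has the current answer as its only
-- entry.
--
-- The model has neither arithmetic nor equality tests, so vertices are one-hot vectors, classes are
-- compared by intersecting them and cut values in unary. The length of a candidate list cannot be
-- read off the loop that doubles it; hence the assertions.

private
  variable
    m n k : ℕ
    X : Set

-- Primitive recursive terms and their compilation

-- `small` bounds the whole tree by `M`, while `table` bounds only the length of a list by `W`. A
-- `node` is a class paired with its table, `nodes` a list of at most `M` of them, and `state` the
-- answer so far paired with such a list.
data Sort : Set where
  any small table node nodes state : Sort

data Iterable : Sort → Set where
  small : Iterable small
  table : Iterable table
  nodes : Iterable nodes

headSort tailSort : Sort → Sort
headSort small = small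
headSort nodes = node
headSort _     = any
tailSort small = small
tailSort table = table
tailSort node  = table
tailSort nodes = nodes
tailSort state = nodes
tailSort any   = any

private
  variable
    σ τ : Sort
    Γ : Vec Sort n
    Δ : Vec Sort m

-- trust e σ asserts that the value of e has sort σ; the predicate Trusted
-- says that all assertions met during an evaluation hold.
mutual
  data Tm {n} (Γ : Vec Sort n) : Sort → Set where
    ref    : (x : Fin n) → Tm Γ (lookup Γ x)
    forget : Tm Γ σ → Tm Γ any
    trust  : Tm Γ any → (σ : Sort) → Tm Γ σ
    nil    : Tm Γ τ
    _∙_    : Tm Γ any → Tm Γ any → Tm Γ any
    case   : Tm Γ σ → Tm Γ τ → Tm (headSort σ ∷ tailSort σ ∷ Γ) τ → Tm Γ τ
    bind   : Tm Γ σ → Tm (σ ∷ Γ) τ → Tm Γ τ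
    app    : {Δ : Vec Sort m} → Tm Δ τ → Tms Γ Δ → Tm Γ τ
    rec    : ∀ {m σ τ} {Δ : Vec Sort m} → Iterable σ → Tm (σ ∷ Δ) τ →
             Tms (headSort σ ∷ tailSort σ ∷ σ ∷ Δ) Δ →
             Tm (τ ∷ headSort σ ∷ tailSort σ ∷ σ ∷ Δ) τ →
             Tm Γ σ → Tms Γ Δ → Tm Γ τ

  data Tms {n} (Γ : Vec Sort n) : ∀ {m} → Vec Sort m → Set where
    []  : Tms Γ []
    _∷_ : {Δ : Vec Sort m} → Tm Γ σ → Tms Γ Δ → Tms Γ (σ ∷ Δ)

caseTree : {ℓ : Level} {A : Set ℓ} → Tree → A → (Tree → Tree → A) → A
caseTree nil     a f = a
caseTree (x ∙ y) a f = f x y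

module _ (b : Vec Tree (suc m) → Tree) (u : Vec Tree (3 + m) → Vec Tree m)
         (s : Vec Tree (4 + m) → Tree) where
  -- The recursion follows the right spine only, so the number of iterations is the length of a
  -- list. The parameters may change on the way down (`u`), which allows parallel traversals and
  -- accumulators.
  recValue : Tree → Vec Tree m → Tree
  recValue nil     ρ = b (nil ∷ ρ)
  recValue (x ∙ y) ρ = s (recValue y (u (x ∷ y ∷ (x ∙ y) ∷ ρ)) ∷ x ∷ y ∷ (x ∙ y) ∷ ρ)

  recCost : (Vec Tree (suc m) → ℕ) → (Vec Tree (3 + m) → ℕ) → (Vec Tree (4 + m) → ℕ) →
            Tree → Vec Tree m → ℕ
  recCost cb cu cs nil     ρ = 2 + cb (nil ∷ ρ)
  recCost cb cu cs (x ∙ y) ρ =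
    -- The constants are the nodes of the compiled body: the `case` and its variable, the `bind`,
    -- the recursive call and its first argument.
    suc (1 + suc (suc (1 + cu ρ′ + recCost cb cu cs y (u ρ′)) + cs (recValue y (u ρ′) ∷ ρ′)))
    where ρ′ = x ∷ y ∷ (x ∙ y) ∷ ρ

  recTrusted : (Vec Tree (suc m) → Set) → (Vec Tree (3 + m) → Set) → (Vec Tree (4 + m) → Set) →
               Tree → Vec Tree m → Set
  recTrusted tb tu ts nil     ρ = tb (nil ∷ ρ)
  recTrusted tb tu ts (x ∙ y) ρ =
    tu ρ′ × recTrusted tb tu ts y (u ρ′) × ts (recValue y (u ρ′) ∷ ρ′)
    where ρ′ = x ∷ y ∷ (x ∙ y) ∷ ρ

mutual
  ⟦_⟧ : {Γ : Vec Sort n} → Tm Γ τ → Vec Tree n → Tree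
  ⟦ ref x ⟧ ρ = lookup ρ x
  ⟦ forget e ⟧ ρ = ⟦ e ⟧ ρ
  ⟦ trust e σ ⟧ ρ = ⟦ e ⟧ ρ
  ⟦ nil ⟧ ρ = nil
  ⟦ e ∙ f ⟧ ρ = ⟦ e ⟧ ρ ∙ ⟦ f ⟧ ρ
  ⟦ case e a f ⟧ ρ = caseTree (⟦ e ⟧ ρ) (⟦ a ⟧ ρ) (λ x y → ⟦ f ⟧ (x ∷ y ∷ ρ))
  ⟦ bind e f ⟧ ρ = ⟦ f ⟧ (⟦ e ⟧ ρ ∷ ρ)
  ⟦ app f es ⟧ ρ = ⟦ f ⟧ (⟦ es ⟧* ρ)
  ⟦ rec _ b u s e es ⟧ ρ = recValue ⟦ b ⟧ ⟦ u ⟧* ⟦ s ⟧ (⟦ e ⟧ ρ) (⟦ es ⟧* ρ)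

  ⟦_⟧* : {Γ : Vec Sort n} {Δ : Vec Sort m} → Tms Γ Δ → Vec Tree n → Vec Tree m
  ⟦ [] ⟧* ρ = []
  ⟦ e ∷ es ⟧* ρ = ⟦ e ⟧ ρ ∷ ⟦ es ⟧* ρ

mutual
  cost : {Γ : Vec Sort n} → Tm Γ τ → Vec Tree n → ℕ
  cost (ref x) ρ = 1
  cost (forget e) ρ = cost e ρ
  cost (trust e σ) ρ = cost e ρ
  cost nil ρ = 1
  cost (e ∙ f) ρ = suc (cost e ρ + cost f ρ)
  cost (case e a f) ρ =
    suc (cost e ρ + caseTree (⟦ e ⟧ ρ) (cost a ρ) (λ x y → cost f (x ∷ y ∷ ρ)))
  cost (bind e f) ρ = suc (cost e ρ + cost f (⟦ e ⟧ ρ ∷ ρ))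
  cost (app f es) ρ = suc (cost* es ρ + cost f (⟦ es ⟧* ρ))
  cost (rec _ b u s e es) ρ =
    suc ((cost e ρ + cost* es ρ)
         + recCost ⟦ b ⟧ ⟦ u ⟧* ⟦ s ⟧ (cost b) (cost* u) (cost s) (⟦ e ⟧ ρ) (⟦ es ⟧* ρ))

  cost* : {Γ : Vec Sort n} {Δ : Vec Sort m} → Tms Γ Δ → Vec Tree n → ℕ
  cost* [] ρ = 0
  cost* (e ∷ es) ρ = cost e ρ + cost* es ρ

-- Every app and every rec is compiled to a function of the program, named by
-- its position in the list of all arities.

mutual
  arities : {Γ : Vec Sort n} → Tm Γ τ → List ℕ
  arities (ref x) = []
  arities (forget e) = arities e
  arities (trust e σ) = arities e
  arities nil = []
  arities (e ∙ f) = arities e ++ arities f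
  arities (case e a f) = arities e ++ (arities a ++ arities f)
  arities (bind e f) = arities e ++ arities f
  arities (app {m = m} f es) = m ∷ (arities f ++ arities* es)
  arities (rec {m} _ b u s e es) =
    suc m ∷ (arities b ++ (arities* u ++ (arities s ++ (arities e ++ arities* es))))

  arities* : {Γ : Vec Sort n} {Δ : Vec Sort m} → Tms Γ Δ → List ℕ
  arities* [] = []
  arities* (e ∷ es) = arities e ++ arities* es

module _ {A : Set} where
  slot : {xs : List A} {a : A} → a ∈ xs → Fin (length xs)
  slot (here _)  = zero
  slot (there p) = suc (slot p)

  lookup-slot : {xs : List A} {a : A} (p : a ∈ xs) → lookup (Vec.fromList xs) (slot p) ≡ a
  lookup-slot (here refl) = refl
  lookup-slot (there p)   = lookup-slot p

  module _ {Q : A → Set} where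
    fromPositions : {xs : List A} → (∀ {a} → a ∈ xs → Q a) →
                    (i : Fin (length xs)) → Q (lookup (Vec.fromList xs) i)
    fromPositions {x ∷ xs} g zero    = g (here refl)
    fromPositions {x ∷ xs} g (suc i) = fromPositions (g ∘ there) i

    fromPositions-slot : {xs : List A} (g : ∀ {a} → a ∈ xs → Q a) {a : A} (p : a ∈ xs) →
                          subst Q (lookup-slot p) (fromPositions g (slot p)) ≡ g p
    fromPositions-slot g (here refl) = refl
    fromPositions-slot g (there p)   = fromPositions-slot (g ∘ there) p

module Compile (as : List ℕ) where
  -- A membership proof is a position in the list, so functions of equal arity keep distinct names.
  Names : List ℕ → Set
  Names bs = ∀ {a} → a ∈ bs → a ∈ as

  Code : ℕ → Set
  Code = Expr (Vec.fromList as)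

  callAt : {a : ℕ} → a ∈ as → Vec (Code n) a → Code n
  callAt p es = call (slot p) (subst (Vec _) (sym (lookup-slot p)) es)

  inl : {bs cs : List ℕ} → Names (bs ++ cs) → Names bs
  inl ι p = ι (∈-++⁺ˡ p)

  inr : (bs : List ℕ) {cs : List ℕ} → Names (bs ++ cs) → Names cs
  inr bs ι p = ι (∈-++⁺ʳ bs p)

  down : {b : ℕ} {bs : List ℕ} → Names (b ∷ bs) → Names bs
  down ι p = ι (there p)

  split : {Q : ℕ → Set} (bs : List ℕ) {cs : List ℕ} →
          (∀ {a} → a ∈ bs → Q a) → (∀ {a} → a ∈ cs → Q a) → ∀ {a} → a ∈ bs ++ cs → Q a
  split []       f g p         = g p
  split (b ∷ bs) f g (here eq) = f (here eq)
  split (b ∷ bs) f g (there p) = split bs (f ∘ there) g p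

  split-inl : {Q : ℕ → Set} {bs cs : List ℕ} {f : ∀ {a} → a ∈ bs → Q a} {g : ∀ {a} → a ∈ cs → Q a}
              {a : ℕ} (p : a ∈ bs) → split {Q} bs f g (∈-++⁺ˡ p) ≡ f p
  split-inl (here eq) = refl
  split-inl {Q} (there p) = split-inl {Q} p

  split-inr : {Q : ℕ → Set} (bs : List ℕ) {cs : List ℕ} {f : ∀ {a} → a ∈ bs → Q a}
              {g : ∀ {a} → a ∈ cs → Q a} {a : ℕ} (p : a ∈ cs) → split {Q} bs f g (∈-++⁺ʳ bs p) ≡ g p
  split-inr []       p = refl
  split-inr {Q} (b ∷ bs) p = split-inr {Q} bs p

  split-head : {Q : ℕ → Set} {b : ℕ} {bs : List ℕ} → Q b → (∀ {a} → a ∈ bs → Q a) →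
               ∀ {a} → a ∈ b ∷ bs → Q a
  split-head x g (here refl) = x
  split-head x g (there p)   = g p

  mutual
    compile : {Γ : Vec Sort n} (e : Tm Γ τ) → Names (arities e) → Code n
    compile (ref x) ι = var x
    compile (forget e) ι = compile e ι
    compile (trust e σ) ι = compile e ι
    compile nil ι = nil
    compile (e ∙ f) ι = compile e (inl ι) ∙ compile f (inr (arities e) ι)
    compile (case e a f) ι =
      case (compile e (inl ι)) (compile a (inl (inr (arities e) ι)))
           (compile f (inr (arities a) (inr (arities e) ι)))
    compile (bind e f) ι = bind (compile e (inl ι)) (compile f (inr (arities e) ι))
    compile (app f es) ι = callAt (ι (here refl)) (compile* es (inr (arities f) (down ι)))
    compile (rec i b u s e es) ι = callAt (ι (here refl)) (compile e (inl ι′) ∷ compile* es (inr (arities e) ι′))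
      where
      ι′ : Names (arities e ++ arities* es)
      ι′ p = inr (arities s) (inr (arities* u) (inr (arities b) (down ι))) p

    compile* : {Γ : Vec Sort n} {Δ : Vec Sort m} (es : Tms Γ Δ) →
               Names (arities* es) → Vec (Code n) m
    compile* [] ι = []
    compile* (e ∷ es) ι = compile e (inl ι) ∷ compile* es (inr (arities e) ι)

  mutual
    bodies : {Γ : Vec Sort n} (e : Tm Γ τ) → Names (arities e) → ∀ {a} → a ∈ arities e → Code a
    bodies (ref x) ι ()
    bodies (forget e) ι = bodies e ι
    bodies (trust e σ) ι = bodies e ι
    bodies nil ι ()
    bodies (e ∙ f) ι = split (arities e) (bodies e (inl ι)) (bodies f (inr (arities e) ι))
    bodies (case e a f) ι =
      split (arities e) (bodies e (inl ι))
        (split (arities a) (bodies a (inl (inr (arities e) ι)))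
          (bodies f (inr (arities a) (inr (arities e) ι))))
    bodies (bind e f) ι = split (arities e) (bodies e (inl ι)) (bodies f (inr (arities e) ι))
    bodies (app f es) ι =
      split-head (compile f (inl (down ι)))
        (split (arities f) (bodies f (inl (down ι))) (bodies* es (inr (arities f) (down ι))))
    bodies (rec i b u s e es) ι =
      split-head
        (case (var zero) (compile b (inl (down ι)))
          (bind (callAt (ι (here refl)) (var (suc zero) ∷ compile* u (inl (inr (arities b) (down ι)))))
                (compile s (inl (inr (arities* u) (inr (arities b) (down ι)))))))
        (split (arities b) (bodies b (inl (down ι)))
          (split (arities* u) (bodies* u (inl (inr (arities b) (down ι))))
            (split (arities s) (bodies s (inl (inr (arities* u) (inr (arities b) (down ι)))))
              (split (arities e) (bodies e (inl (inr (arities s) (inr (arities* u) (inr (arities b) (down ι))))))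
                (bodies* es (inr (arities e) (inr (arities s) (inr (arities* u) (inr (arities b) (down ι))))))))))

    bodies* : {Γ : Vec Sort n} {Δ : Vec Sort m} (es : Tms Γ Δ) → Names (arities* es) →
              ∀ {a} → a ∈ arities* es → Code a
    bodies* [] ι ()
    bodies* (e ∷ es) ι = split (arities e) (bodies e (inl ι)) (bodies* es (inr (arities e) ι))

module _ {τ₀ : Sort} (e₀ : Tm (τ₀ ∷ []) any) where
  open Compile (arities e₀)

  program : Program
  program = record
    { functions = length (arities e₀)
    ; arity     = Vec.fromList (arities e₀)
    ; body      = fromPositions (bodies e₀ id)
    ; main      = compile e₀ id
    }

  open Semantics program

  private
    B : ∀ {a} → a ∈ arities e₀ → Code a
    B = bodies e₀ id

    evalCall : {a : ℕ} (p : a ∈ arities e₀) {ρ : Vec Tree n} {es : Vec (Code n) a} {vs : Vec Tree a}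
               {v : Tree} {s t : ℕ} → ρ ⊢* es ⇓ vs [ s ] → vs ⊢ B p ⇓ v [ t ] →
               ρ ⊢ callAt p es ⇓ v [ suc (s + t) ]
    evalCall p d d′ = go (lookup-slot p) d (subst (λ b → _ ⊢ b ⇓ _ [ _ ]) (sym (fromPositions-slot B p)) d′)
      where
      go : {f : Fin (length (arities e₀))} {a : ℕ} (eq : lookup (Vec.fromList (arities e₀)) f ≡ a)
           {ρ : Vec Tree n} {es : Vec (Code n) a} {vs : Vec Tree a} {v : Tree} {s t : ℕ} →
           ρ ⊢* es ⇓ vs [ s ] → vs ⊢ subst Code eq (fromPositions B f) ⇓ v [ t ] →
           ρ ⊢ call f (subst (Vec _) (sym eq) es) ⇓ v [ suc (s + t) ]
      go refl d d′ = call d d′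

    -- The induction over a term needs that the global program holds, at the renamed positions,
    -- exactly the bodies the subterm generates. This is `refl` for the whole term and is inherited
    -- through `left` and `right`.
    Coherent : {as : List ℕ} → Names as → (∀ {a} → a ∈ as → Code a) → Set
    Coherent {as} ι b = ∀ a (p : a ∈ as) → B (ι p) ≡ b p

    module _ {bs cs : List ℕ} {ι : Names (bs ++ cs)} {f : ∀ {a} → a ∈ bs → Code a}
             {g : ∀ {a} → a ∈ cs → Code a} (h : Coherent ι (split bs f g)) where
      left : Coherent (inl ι) f
      left a p = trans (h a (∈-++⁺ˡ p)) (split-inl {Code} p)

      right : Coherent (inr bs ι) g
      right a p = trans (h a (∈-++⁺ʳ bs p)) (split-inr {Code} bs p)

    evalBody : {a : ℕ} (p : a ∈ arities e₀) {c : Code a} {vs : Vec Tree a} {v : Tree} {t : ℕ} →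
               B p ≡ c → vs ⊢ c ⇓ v [ t ] → vs ⊢ B p ⇓ v [ t ]
    evalBody p eq = subst (λ b → _ ⊢ b ⇓ _ [ _ ]) (sym eq)

    mutual
      eval : {Γ : Vec Sort n} (e : Tm Γ τ) (ι : Names (arities e)) → Coherent ι (bodies e ι) →
             (ρ : Vec Tree n) → ρ ⊢ compile e ι ⇓ ⟦ e ⟧ ρ [ cost e ρ ]
      eval (ref x) ι h ρ = var
      eval (forget e) ι h ρ = eval e ι h ρ
      eval (trust e σ) ι h ρ = eval e ι h ρ
      eval nil ι h ρ = nil
      eval (e ∙ f) ι h ρ = eval e _ (left h) ρ ∙ eval f _ (right {arities e} h) ρ
      eval (case e a f) ι h ρ
        with ⟦ e ⟧ ρ | eval e _ (left h) ρ
      ... | nil   | d = case-nil d (eval a _ (left (right {arities e} h)) ρ)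
      ... | x ∙ y | d = case-∙ d (eval f _ (right {arities a} (right {arities e} h)) (x ∷ y ∷ ρ))
      eval (bind e f) ι h ρ =
        bind (eval e _ (left h) ρ) (eval f _ (right {arities e} h) (⟦ e ⟧ ρ ∷ ρ))
      eval (app f es) ι h ρ =
        evalCall (ι (here refl)) (eval* es _ (right {arities f} (λ _ → h _ ∘ there)) ρ)
          (evalBody (ι (here refl)) (h _ (here refl)) (eval f _ (left (λ _ → h _ ∘ there)) (⟦ es ⟧* ρ)))
      eval (rec {m} i b u s e es) ι h ρ =
        evalCall (ι (here refl)) (eval e _ (left h₄) ρ ∷ eval* es _ (right {arities e} h₄) ρ)
          (evalBody (ι (here refl)) (h _ (here refl)) (loop (⟦ e ⟧ ρ) (⟦ es ⟧* ρ)))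
        where
        h₁ = λ a (p : a ∈ _) → h a (there p)
        h₂ = right {arities b} h₁
        h₃ = right {arities* u} h₂
        h₄ = right {arities s} h₃
        loop : (x : Tree) (ρ : Vec Tree m) →
               (x ∷ ρ) ⊢ bodies (rec i b u s e es) ι (here refl) ⇓ recValue ⟦ b ⟧ ⟦ u ⟧* ⟦ s ⟧ x ρ
                 [ recCost ⟦ b ⟧ ⟦ u ⟧* ⟦ s ⟧ (cost b) (cost* u) (cost s) x ρ ]
        loop nil     ρ = case-nil var (eval b _ (left h₁) _)
        loop (x ∙ y) ρ =
          case-∙ var (bind (evalCall (ι (here refl)) (var ∷ eval* u _ (left h₂) _)
                                     (evalBody (ι (here refl)) (h _ (here refl)) (loop y _)))
                           (eval s _ (left h₃) _))

      eval* : {Γ : Vec Sort n} {Δ : Vec Sort m} (es : Tms Γ Δ) (ι : Names (arities* es)) →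
              Coherent ι (bodies* es ι) → (ρ : Vec Tree n) → ρ ⊢* compile* es ι ⇓ ⟦ es ⟧* ρ [ cost* es ρ ]
      eval* [] ι h ρ = []
      eval* (e ∷ es) ι h ρ = eval e _ (left h) ρ ∷ eval* es _ (right {arities e} h) ρ

  program-correct : (x : Tree) → program ⟨ x ⟩⇓ ⟦ e₀ ⟧ (x ∷ []) [ cost e₀ (x ∷ []) ]
  program-correct x = eval e₀ id (λ _ p → refl) (x ∷ [])

-- Cost bounds from sorts

spine : Tree → ℕ
spine nil     = 0
spine (x ∙ y) = suc (spine y)

spine≤size : (x : Tree) → spine x ≤ size x
spine≤size nil     = z≤n
spine≤size (x ∙ y) = s≤s (≤-trans (spine≤size y) (m≤n+m (size y) (size x)))

module Trust (M W : ℕ) where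
  _⊨_ : Tree → Sort → Set
  AllNodes : Tree → Set

  t       ⊨ any   = ⊤
  t       ⊨ small = size t ≤ M
  t       ⊨ table = spine t ≤ W
  nil     ⊨ node  = ⊤
  (a ∙ b) ⊨ node  = spine b ≤ W
  t       ⊨ nodes = spine t ≤ M × AllNodes t
  nil     ⊨ state = ⊤
  (a ∙ b) ⊨ state = spine b ≤ M × AllNodes b

  AllNodes nil     = ⊤
  AllNodes (a ∙ b) = (a ⊨ node) × AllNodes b

  infix 4 _⊨*_
  data _⊨*_ : Vec Tree n → Vec Sort n → Set where
    []  : [] ⊨* []
    _∷_ : {x : Tree} {ρ : Vec Tree n} {Γ : Vec Sort n} → x ⊨ σ → ρ ⊨* Γ → (x ∷ ρ) ⊨* (σ ∷ Γ)

  mutual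
    Trusted : {Γ : Vec Sort n} → Tm Γ τ → Vec Tree n → Set
    Trusted (ref x) ρ = ⊤
    Trusted (forget e) ρ = Trusted e ρ
    Trusted (trust e σ) ρ = Trusted e ρ × (⟦ e ⟧ ρ ⊨ σ)
    Trusted nil ρ = ⊤
    Trusted (e ∙ f) ρ = Trusted e ρ × Trusted f ρ
    Trusted (case e a f) ρ =
      Trusted e ρ × caseTree (⟦ e ⟧ ρ) (Trusted a ρ) (λ x y → Trusted f (x ∷ y ∷ ρ))
    Trusted (bind e f) ρ = Trusted e ρ × Trusted f (⟦ e ⟧ ρ ∷ ρ)
    Trusted (app f es) ρ = Trusted* es ρ × Trusted f (⟦ es ⟧* ρ)
    Trusted (rec _ b u s e es) ρ =
      Trusted e ρ × Trusted* es ρ ×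
      recTrusted ⟦ b ⟧ ⟦ u ⟧* ⟦ s ⟧ (Trusted b) (Trusted* u) (Trusted s) (⟦ e ⟧ ρ) (⟦ es ⟧* ρ)

    Trusted* : {Γ : Vec Sort n} {Δ : Vec Sort m} → Tms Γ Δ → Vec Tree n → Set
    Trusted* [] ρ = ⊤
    Trusted* (e ∷ es) ρ = Trusted e ρ × Trusted* es ρ

len : Iterable σ → ℕ → ℕ → ℕ
len table M W = W
len _     M W = M

mutual
  bound : {Γ : Vec Sort n} → Tm Γ τ → ℕ → ℕ → ℕ
  bound (ref x) M W = 1
  bound (forget e) M W = bound e M W
  bound (trust e σ) M W = bound e M W
  bound nil M W = 1
  bound (e ∙ f) M W = 1 + (bound e M W + bound f M W)
  bound (case e a f) M W = 1 + (bound e M W + (bound a M W + bound f M W))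
  bound (bind e f) M W = 1 + (bound e M W + bound f M W)
  bound (app f es) M W = 1 + (bound* es M W + bound f M W)
  bound (rec i b u s e es) M W =
    1 + ((bound e M W + bound* es M W) +
         ((2 + bound b M W) + len i M W * (5 + (bound* u M W + bound s M W))))

  bound* : {Γ : Vec Sort n} {Δ : Vec Sort m} → Tms Γ Δ → ℕ → ℕ → ℕ
  bound* [] M W = 0
  bound* (e ∷ es) M W = bound e M W + bound* es M W

mutual
  trustFree : {Γ : Vec Sort n} → Tm Γ τ → Bool
  trustFree (ref x) = true
  trustFree (forget e) = trustFree e
  trustFree (trust e σ) = false
  trustFree nil = true
  trustFree (e ∙ f) = trustFree e ∧ trustFree f
  trustFree (case e a f) = trustFree e ∧ (trustFree a ∧ trustFree f)
  trustFree (bind e f) = trustFree e ∧ trustFree f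
  trustFree (app f es) = trustFree* es ∧ trustFree f
  trustFree (rec _ b u s e es) = trustFree b ∧ (trustFree* u ∧ (trustFree s ∧ (trustFree e ∧ trustFree* es)))

  trustFree* : {Γ : Vec Sort n} {Δ : Vec Sort m} → Tms Γ Δ → Bool
  trustFree* [] = true
  trustFree* (e ∷ es) = trustFree e ∧ trustFree* es

split∧ : ∀ a {b} → T (a ∧ b) → T a × T b
split∧ true t = tt , t

module Soundness (M W : ℕ) (1≤M : 1 ≤ M) where
  open Trust M W

  mutual
    trustFree-trusted : {Γ : Vec Sort n} (e : Tm Γ τ) → T (trustFree e) → (ρ : Vec Tree n) → Trusted e ρ
    trustFree-trusted (ref x) p ρ = tt
    trustFree-trusted (forget e) p ρ = trustFree-trusted e p ρ
    trustFree-trusted nil p ρ = tt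
    trustFree-trusted (e ∙ f) p ρ with split∧ (trustFree e) p
    ... | q , r = trustFree-trusted e q ρ , trustFree-trusted f r ρ
    trustFree-trusted (case e a f) p ρ with split∧ (trustFree e) p
    ... | q , r with split∧ (trustFree a) r | ⟦ e ⟧ ρ
    ... | s , t | nil   = trustFree-trusted e q ρ , trustFree-trusted a s ρ
    ... | s , t | x ∙ y = trustFree-trusted e q ρ , trustFree-trusted f t (x ∷ y ∷ ρ)
    trustFree-trusted (bind e f) p ρ with split∧ (trustFree e) p
    ... | q , r = trustFree-trusted e q ρ , trustFree-trusted f r _
    trustFree-trusted (app f es) p ρ with split∧ (trustFree* es) p
    ... | q , r = trustFree-trusted* es q ρ , trustFree-trusted f r _
    trustFree-trusted (rec {m} i b u s e es) p ρ with split∧ (trustFree b) p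
    ... | pb , p₁ with split∧ (trustFree* u) p₁
    ... | pu , p₂ with split∧ (trustFree s) p₂
    ... | ps , p₃ with split∧ (trustFree e) p₃
    ... | pe , pes = trustFree-trusted e pe ρ , trustFree-trusted* es pes ρ , loop (⟦ e ⟧ ρ) (⟦ es ⟧* ρ)
      where
      loop : ∀ x (ρ : Vec Tree m) → recTrusted ⟦ b ⟧ ⟦ u ⟧* ⟦ s ⟧ (Trusted b) (Trusted* u) (Trusted s) x ρ
      loop nil     ρ = trustFree-trusted b pb _
      loop (x ∙ y) ρ = trustFree-trusted* u pu _ , loop y _ , trustFree-trusted s ps _

    trustFree-trusted* : {Γ : Vec Sort n} {Δ : Vec Sort m} (es : Tms Γ Δ) → T (trustFree* es) →
                    (ρ : Vec Tree n) → Trusted* es ρ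
    trustFree-trusted* [] p ρ = tt
    trustFree-trusted* (e ∷ es) p ρ with split∧ (trustFree e) p
    ... | q , r = trustFree-trusted e q ρ , trustFree-trusted* es r ρ

  private
    -- This is what makes `nil` a legitimate default of every sort, for instance as the head or tail
    -- of an empty list.
    nil-⊨ : ∀ τ → nil ⊨ τ
    nil-⊨ any   = tt
    nil-⊨ small = 1≤M
    nil-⊨ table = z≤n
    nil-⊨ node  = tt
    nil-⊨ nodes = z≤n , tt
    nil-⊨ state = tt

    head-⊨ : ∀ σ {x y} → (x ∙ y) ⊨ σ → x ⊨ headSort σ
    head-⊨ any   h = tt
    head-⊨ small h = ≤-trans (≤-trans (m≤m+n _ _) (n≤1+n _)) h
    head-⊨ table h = tt
    head-⊨ node  h = tt
    head-⊨ nodes (_ , h , _) = h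
    head-⊨ state h = tt

    tail-⊨ : ∀ σ {x y} → (x ∙ y) ⊨ σ → y ⊨ tailSort σ
    tail-⊨ any   h = tt
    tail-⊨ small {x} h = ≤-trans (≤-trans (m≤n+m _ (size x)) (n≤1+n _)) h
    tail-⊨ table h = <⇒≤ h
    tail-⊨ node  h = h
    tail-⊨ nodes (h , _ , h′) = <⇒≤ h , h′
    tail-⊨ state h = h

    tail-⊨-iter : (i : Iterable σ) {x y : Tree} → (x ∙ y) ⊨ σ → y ⊨ σ
    tail-⊨-iter small {x} = tail-⊨ small {x}
    tail-⊨-iter table {x} = tail-⊨ table {x}
    tail-⊨-iter nodes {x} = tail-⊨ nodes {x}

    spine≤len : (i : Iterable σ) (x : Tree) → x ⊨ σ → spine x ≤ len i M W
    spine≤len small x h = ≤-trans (spine≤size x) h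
    spine≤len table x h = h
    spine≤len nodes x h = proj₁ h

    lookup-⊨ : {ρ : Vec Tree n} {Γ : Vec Sort n} → ρ ⊨* Γ → (x : Fin n) → lookup ρ x ⊨ lookup Γ x
    lookup-⊨ (h ∷ hs) zero    = h
    lookup-⊨ (h ∷ hs) (suc x) = lookup-⊨ hs x

    loop-arith : ∀ b N u s {cu cr cs} → cu ≤ u → cr ≤ (2 + b) + N * (5 + (u + s)) → cs ≤ s →
                 suc (1 + suc (suc (1 + cu + cr) + cs)) ≤ (2 + b) + suc N * (5 + (u + s))
    loop-arith b N u s {cu} {cr} {cs} hu hr hs = begin
      5 + cu + cr + cs ≤⟨ +-mono-≤ (+-mono-≤ (+-monoʳ-≤ 5 hu) hr) hs ⟩
      5 + u + ((2 + b) + N * (5 + (u + s))) + s ≡⟨ lemma b N u s ⟩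
      (2 + b) + suc N * (5 + (u + s)) ∎
      where
      open ≤-Reasoning
      lemma : ∀ b N u s → 5 + u + ((2 + b) + N * (5 + (u + s))) + s ≡ (2 + b) + suc N * (5 + (u + s))
      lemma = solve-∀

  mutual
    -- Sorts and costs are proved together because the length of a loop is bounded by the sort of a
    -- value computed before it. Where the shape of a term loses this information, `Trusted`
    -- supplies it.
    sound : {Γ : Vec Sort n} (e : Tm Γ τ) {ρ : Vec Tree n} → Trusted e ρ → ρ ⊨* Γ →
            (⟦ e ⟧ ρ ⊨ τ) × cost e ρ ≤ bound e M W
    sound (ref x) t h = lookup-⊨ h x , ≤-refl
    sound (forget e) t h = tt , proj₂ (sound e t h)
    sound (trust e σ) (t , t′) h = t′ , proj₂ (sound e t h)
    sound nil t h = nil-⊨ _ , ≤-refl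
    sound (e ∙ f) (t , t′) h = tt , s≤s (+-mono-≤ (proj₂ (sound e t h)) (proj₂ (sound f t′ h)))
    sound (case {σ = σ} e a f) {ρ} (t , t′) h with ⟦ e ⟧ ρ | sound e t h
    ... | nil   | _ , he = let va , ha = sound a t′ h in
      va , s≤s (+-mono-≤ he (≤-trans ha (m≤m+n _ _)))
    ... | x ∙ y | ve , he = let vf , hf = sound f t′ (head-⊨ σ {y = y} ve ∷ tail-⊨ σ {x = x} ve ∷ h) in
      vf , s≤s (+-mono-≤ he (≤-trans hf (m≤n+m _ (bound a M W))))
    sound (bind e f) (t , t′) h =
      let ve , he = sound e t h
          vf , hf = sound f t′ (ve ∷ h)
      in vf , s≤s (+-mono-≤ he hf)
    sound (app f es) (t , t′) h =
      let ve , he = sound* es t h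
          vf , hf = sound f t′ ve
      in vf , s≤s (+-mono-≤ he hf)
    sound (rec {m} {σ} {τ} {Δ} i b u s e es) {ρ} (t , t′ , t″) h =
      let ve , he = sound e t h
          vs , hs = sound* es t′ h
          vl , hl = loop (⟦ e ⟧ ρ) (⟦ es ⟧* ρ) t″ ve vs
      in vl , s≤s (+-mono-≤ (+-mono-≤ he hs)
                (≤-trans hl (+-monoʳ-≤ _ (*-monoˡ-≤ _ (spine≤len i (⟦ e ⟧ ρ) ve)))))
      where
      loop : ∀ x (ρ : Vec Tree m) →
             recTrusted ⟦ b ⟧ ⟦ u ⟧* ⟦ s ⟧ (Trusted b) (Trusted* u) (Trusted s) x ρ → x ⊨ σ → ρ ⊨* Δ →
             (recValue ⟦ b ⟧ ⟦ u ⟧* ⟦ s ⟧ x ρ ⊨ τ) ×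
             recCost ⟦ b ⟧ ⟦ u ⟧* ⟦ s ⟧ (cost b) (cost* u) (cost s) x ρ ≤
               (2 + bound b M W) + spine x * (5 + (bound* u M W + bound s M W))
      loop nil ρ t hx hρ = let vb , hb = sound b t (hx ∷ hρ) in
        vb , ≤-trans (+-monoʳ-≤ 2 hb) (m≤m+n _ _)
      loop (x ∙ y) ρ (t , t′ , t″) hx hρ =
        let hρ′ = head-⊨ σ {y = y} hx ∷ tail-⊨ σ {x = x} hx ∷ hx ∷ hρ
            vu , hu = sound* u t hρ′
            vl , hl = loop y _ t′ (tail-⊨-iter i {x} hx) vu
            vs , hs = sound s t″ (vl ∷ hρ′)
        in vs , loop-arith (bound b M W) (spine y) _ _ hu hl hs

    sound* : {Γ : Vec Sort n} {Δ : Vec Sort m} (es : Tms Γ Δ) {ρ : Vec Tree n} → Trusted* es ρ → ρ ⊨* Γ →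
             (⟦ es ⟧* ρ ⊨* Δ) × cost* es ρ ≤ bound* es M W
    sound* [] t h = [] , z≤n
    sound* (e ∷ es) (t , t′) h =
      let ve , he = sound e t h
          vs , hs = sound* es t′ h
      in ve ∷ vs , +-mono-≤ he hs

-- Loops over tables are nested at most b deep in e if fits e b.
mutual
  fits : {Γ : Vec Sort n} → Tm Γ τ → ℕ → Bool
  fits (ref x) b = true
  fits (forget e) b = fits e b
  fits (trust e σ) b = fits e b
  fits nil b = true
  fits (e ∙ f) b = fits e b ∧ fits f b
  fits (case e a f) b = fits e b ∧ (fits a b ∧ fits f b)
  fits (bind e f) b = fits e b ∧ fits f b
  fits (app f es) b = fits* es b ∧ fits f b
  fits (rec table b u s e es) zero = false
  fits (rec table b u s e es) (suc k) =
    fits e (suc k) ∧ (fits* es (suc k) ∧ (fits b (suc k) ∧ (fits* u k ∧ fits s k)))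
  fits (rec small b u s e es) k = fits e k ∧ (fits* es k ∧ (fits b k ∧ (fits* u k ∧ fits s k)))
  fits (rec nodes b u s e es) k = fits e k ∧ (fits* es k ∧ (fits b k ∧ (fits* u k ∧ fits s k)))

  fits* : {Γ : Vec Sort n} {Δ : Vec Sort m} → Tms Γ Δ → ℕ → Bool
  fits* [] b = true
  fits* (e ∷ es) b = fits e b ∧ fits* es b

-- Bounds polynomial in `M` and of fixed degree in `W`

Poly : ℕ → (ℕ → ℕ → ℕ) → Set
Poly b f = Σ[ K ∈ ℕ ] Σ[ d ∈ ℕ ] (∀ M W → 1 ≤ M → 1 ≤ W → f M W ≤ K * (M ^ d * W ^ b))

1≤^ : ∀ M d → 1 ≤ M → 1 ≤ M ^ d
1≤^ M d 1≤M = subst (_≤ M ^ d) (^-zeroˡ d) (^-monoˡ-≤ d 1≤M)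

^-monoʳ : ∀ M {d e} → 1 ≤ M → d ≤ e → M ^ d ≤ M ^ e
^-monoʳ (suc M) _ h = ^-monoʳ-≤ (suc M) h

poly-const : ∀ b c → Poly b (λ _ _ → c)
poly-const b c = c , 0 , λ M W 1≤M 1≤W →
  subst (_≤ c * (M ^ 0 * W ^ b)) (*-identityʳ c)
    (*-monoʳ-≤ c (*-mono-≤ {1} {1} ≤-refl (1≤^ W b 1≤W)))

poly-+ : ∀ {b f g} → Poly b f → Poly b g → Poly b (λ M W → f M W + g M W)
poly-+ {b} {f} {g} (K , d , hf) (L , e , hg) = K + L , d + e , λ M W 1≤M 1≤W →
  let open ≤-Reasoning in begin
    f M W + g M W ≤⟨ +-mono-≤ (hf M W 1≤M 1≤W) (hg M W 1≤M 1≤W) ⟩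
    K * (M ^ d * W ^ b) + L * (M ^ e * W ^ b)
      ≤⟨ +-mono-≤ (*-monoʳ-≤ K (*-monoˡ-≤ (W ^ b) (^-monoʳ M 1≤M (m≤m+n d e))))
                  (*-monoʳ-≤ L (*-monoˡ-≤ (W ^ b) (^-monoʳ M 1≤M (m≤n+m e d)))) ⟩
    K * (M ^ (d + e) * W ^ b) + L * (M ^ (d + e) * W ^ b) ≡⟨ *-distribʳ-+ _ K L ⟨
    (K + L) * (M ^ (d + e) * W ^ b) ∎

poly-M : ∀ {b f} → Poly b f → Poly b (λ M W → M * f M W)
poly-M {b} (K , d , h) = K , suc d , λ M W 1≤M 1≤W →
  ≤-trans (*-monoʳ-≤ M (h M W 1≤M 1≤W)) (≤-reflexive (lemma M K (M ^ d) (W ^ b)))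
  where
  lemma : ∀ M K x y → M * (K * (x * y)) ≡ K * (M * x * y)
  lemma = solve-∀

-- The only rule that raises the exponent of `W`; powers of `M` are absorbed by the existential `d`.
poly-W : ∀ {b f} → Poly b f → Poly (suc b) (λ M W → W * f M W)
poly-W {b} (K , d , h) = K , d , λ M W 1≤M 1≤W →
  ≤-trans (*-monoʳ-≤ W (h M W 1≤M 1≤W)) (≤-reflexive (lemma W K (M ^ d) (W ^ b)))
  where
  lemma : ∀ W K x y → W * (K * (x * y)) ≡ K * (x * (W * y))
  lemma = solve-∀

poly-1+ : ∀ {b f} → Poly b f → Poly b (λ M W → 1 + f M W)
poly-1+ {b} = poly-+ {b} (poly-const b 1)

mutual
  bound-poly : {Γ : Vec Sort n} (e : Tm Γ τ) (b : ℕ) → T (fits e b) → Poly b (bound e)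
  bound-poly (ref x) b h = poly-const b 1
  bound-poly (forget e) b h = bound-poly e b h
  bound-poly (trust e σ) b h = bound-poly e b h
  bound-poly nil b h = poly-const b 1
  bound-poly (e ∙ f) b h with split∧ (fits e b) h
  ... | p , q = poly-1+ {b} (poly-+ {b} (bound-poly e b p) (bound-poly f b q))
  bound-poly (case e a f) b h with split∧ (fits e b) h
  ... | p , q with split∧ (fits a b) q
  ... | r , s = poly-1+ {b} (poly-+ {b} (bound-poly e b p) (poly-+ {b} (bound-poly a b r) (bound-poly f b s)))
  bound-poly (bind e f) b h with split∧ (fits e b) h
  ... | p , q = poly-1+ {b} (poly-+ {b} (bound-poly e b p) (bound-poly f b q))
  bound-poly (app f es) b h with split∧ (fits* es b) h
  ... | p , q = poly-1+ {b} (poly-+ {b} (bound-poly* es b p) (bound-poly f b q))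
  bound-poly (rec table B u s e es) (suc b) h with split∧ (fits e (suc b)) h
  ... | p , h₁ with split∧ (fits* es (suc b)) h₁
  ... | q , h₂ with split∧ (fits B (suc b)) h₂
  ... | r , h₃ with split∧ (fits* u b) h₃
  ... | x , y =
    poly-1+ {suc b} (poly-+ {suc b} (poly-+ {suc b} (bound-poly e (suc b) p) (bound-poly* es (suc b) q))
      (poly-+ {suc b} (poly-+ {suc b} (poly-const (suc b) 2) (bound-poly B (suc b) r))
        (poly-W {b} (poly-+ {b} (poly-const b 5) (poly-+ {b} (bound-poly* u b x) (bound-poly s b y))))))
  bound-poly (rec small B u s e es) b h = rec-poly b (fits e b) h (bound-poly e b) (bound-poly* es b)
    (bound-poly B b) (bound-poly* u b) (bound-poly s b)
  bound-poly (rec nodes B u s e es) b h = rec-poly b (fits e b) h (bound-poly e b) (bound-poly* es b)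
    (bound-poly B b) (bound-poly* u b) (bound-poly s b)

  bound-poly* : {Γ : Vec Sort n} {Δ : Vec Sort m} (es : Tms Γ Δ) (b : ℕ) → T (fits* es b) → Poly b (bound* es)
  bound-poly* [] b h = poly-const b 0
  bound-poly* (e ∷ es) b h with split∧ (fits e b) h
  ... | p , q = poly-+ {b} (bound-poly e b p) (bound-poly* es b q)

  rec-poly : ∀ b (p : Bool) {q r x y : Bool} → T (p ∧ (q ∧ (r ∧ (x ∧ y)))) →
             {e es B u s : ℕ → ℕ → ℕ} → (T p → Poly b e) → (T q → Poly b es) → (T r → Poly b B) →
             (T x → Poly b u) → (T y → Poly b s) →
             Poly b (λ M W → 1 + ((e M W + es M W) + ((2 + B M W) + M * (5 + (u M W + s M W)))))
  rec-poly b true {true} {true} {true} {true} h e es B u s =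
    poly-1+ {b} (poly-+ {b} (poly-+ {b} (e tt) (es tt)) (poly-+ {b} (poly-+ {b} (poly-const b 2) (B tt))
      (poly-M {b} (poly-+ {b} (poly-const b 5) (poly-+ {b} (u tt) (s tt))))))

-- The algorithm

pattern v0 = zero
pattern v1 = suc v0
pattern v2 = suc v1
pattern v3 = suc v2
pattern v4 = suc v3
pattern v5 = suc v4
pattern v6 = suc v5

-- The default `nil` reads as false, zero and the empty list. `padT` relies on this when its list
-- runs out, and the unary counters when they reach zero.
fst : {Γ : Vec Sort n} → Tm Γ σ → Tm Γ (headSort σ)
fst e = case e nil (ref v0)

snd : {Γ : Vec Sort n} → Tm Γ σ → Tm Γ (tailSort σ)
snd e = case e nil (ref v1)

one : {Γ : Vec Sort n} → Tm Γ any
one = nil ∙ nil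

-- Passing the branches as arguments spares shifting their variables under a `case`. The price is
-- that both are evaluated, which `bound` charges for anyway; assertions must then hold in the
-- branch not taken as well.
ite : {Γ : Vec Sort n} → Tm Γ any → Tm Γ τ → Tm Γ τ → Tm Γ τ
ite {τ = τ} c e f = app {Δ = any ∷ τ ∷ τ ∷ []} (case (ref v0) (ref v2) (ref v3)) (c ∷ e ∷ f ∷ [])

notT : {Γ : Vec Sort n} → Tm Γ any → Tm Γ any
notT e = ite e nil one

andT orT xorT : {Γ : Vec Sort n} → Tm Γ any → Tm Γ any → Tm Γ any
andT e f = ite e f nil
orT e f = ite e one f
xorT e f = ite e (notT f) f

-- Vectors indexed by vertices are traversed along a clock of length n.
Clocked : Set
Clocked = Tm (small ∷ any ∷ any ∷ []) any

zipLoop : Tm (any ∷ small ∷ small ∷ small ∷ any ∷ any ∷ []) any → Tm (small ∷ any ∷ any ∷ []) any → Clocked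
zipLoop s b = rec small b (snd (ref v3) ∷ snd (ref v4) ∷ []) s (ref v0) (ref v1 ∷ ref v2 ∷ [])

unionT interT meetsT equalT : Clocked
unionT = zipLoop (orT (fst (ref v4)) (fst (ref v5)) ∙ ref v0) nil
interT = zipLoop (andT (fst (ref v4)) (fst (ref v5)) ∙ ref v0) nil
meetsT = zipLoop (ite (andT (fst (ref v4)) (fst (ref v5))) one (ref v0)) nil
equalT = zipLoop (ite (xorT (fst (ref v4)) (fst (ref v5))) nil (ref v0)) one

zerosT : Tm (small ∷ []) any
zerosT = rec small nil [] (nil ∙ ref v0) (ref v0) []

padT : Tm (small ∷ any ∷ []) any
padT = rec small nil (snd (ref v3) ∷ []) (fst (ref v4) ∙ ref v0) (ref v0) (ref v1 ∷ [])

-- The second argument is a marker, `j` zeros followed by a one when row `j` is reached. Padded to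
-- the length of the clock it becomes the singleton of the current vertex.
verticesT : Tm (small ∷ any ∷ small ∷ []) any
verticesT =
  rec small nil ((nil ∙ ref v3) ∷ ref v4 ∷ [])
    (bind (app padT (ref v5 ∷ ref v4 ∷ []))
      ((ref v0 ∙ app unionT (ref v6 ∷ ref v0 ∷ forget (ref v2) ∷ [])) ∙ ref v1))
    (ref v0) (ref v1 ∷ ref v2 ∷ [])

classT : Tm (small ∷ any ∷ small ∷ []) any
classT =
  rec small nil (ref v3 ∷ ref v4 ∷ [])
    (app equalT (ref v5 ∷ forget (snd (ref v1)) ∷ ref v4 ∷ []) ∙ ref v0)
    (ref v0) (ref v1 ∷ ref v2 ∷ [])

upToT : Tm (small ∷ any ∷ []) any
upToT = rec small nil (snd (ref v3) ∷ []) (orT (fst (ref v4)) (fst (ref v0)) ∙ ref v0) (ref v0) (ref v1 ∷ [])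

initialT : Tm (small ∷ small ∷ []) any
initialT = app interT (ref v0 ∷ app classT (ref v0 ∷ forget (snd (ref v1)) ∷ ref v0 ∷ []) ∷
                       app upToT (ref v0 ∷ forget (fst (ref v1)) ∷ []) ∷ [])

leastT : Tm (small ∷ small ∷ []) any
leastT = app equalT (ref v0 ∷ app initialT (ref v0 ∷ ref v1 ∷ []) ∷ forget (fst (ref v1)) ∷ [])

-- With `g` adding or removing one unit, the same traversal adds a count to a unary counter or
-- subtracts it.
tallyT : Tm (any ∷ []) any → Tm (small ∷ any ∷ any ∷ any ∷ []) any
tallyT g =
  rec small (ref v3) (snd (ref v3) ∷ snd (ref v4) ∷ ref v5 ∷ [])
    (ite (andT (fst (ref v4)) (notT (fst (ref v5)))) (app g (ref v0 ∷ [])) (ref v0))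
    (ref v0) (ref v1 ∷ ref v2 ∷ ref v3 ∷ [])

cutT : Tm (any ∷ []) any → Tm (small ∷ any ∷ any ∷ small ∷ []) any
cutT g =
  rec small (ref v2) (ref v3 ∷ ref v4 ∷ ref v5 ∷ [])
    (ite (app meetsT (ref v6 ∷ forget (fst (ref v1)) ∷ ref v4 ∷ []))
         (app (tallyT g) (ref v6 ∷ forget (snd (ref v1)) ∷ ref v4 ∷ ref v0 ∷ []))
         (ref v0))
    (ref v0) (ref v1 ∷ ref v2 ∷ ref v3 ∷ [])

-- One cut value is counted up and the other counted down from it, so what remains is nonempty
-- exactly when the first is strictly larger.
betterT : Tm (small ∷ any ∷ any ∷ []) any
betterT =
  app (cutT (snd (ref v0)))
    (ref v0 ∷ ref v2 ∷ app (cutT (nil ∙ ref v0)) (ref v0 ∷ ref v1 ∷ nil ∷ ref v0 ∷ []) ∷ ref v0 ∷ [])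

linkedT : Tm (small ∷ any ∷ any ∷ small ∷ []) any
linkedT =
  rec small nil (ref v3 ∷ ref v4 ∷ ref v5 ∷ [])
    (ite (andT (app meetsT (ref v6 ∷ forget (fst (ref v1)) ∷ ref v4 ∷ []))
               (app meetsT (ref v6 ∷ forget (snd (ref v1)) ∷ ref v5 ∷ [])))
         one (ref v0))
    (ref v0) (ref v1 ∷ ref v2 ∷ ref v3 ∷ [])

expandT : Tm (table ∷ small ∷ any ∷ any ∷ []) any
expandT =
  rec table nil (ref v3 ∷ ref v4 ∷ ref v5 ∷ [])
    (ite (app meetsT (ref v4 ∷ ref v5 ∷ ref v1 ∷ []))
         (ref v1 ∙ ref v0)
         (ref v1 ∙ (app unionT (ref v4 ∷ ref v1 ∷ ref v6 ∷ []) ∙ ref v0)))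
    (ref v0) (ref v1 ∷ ref v2 ∷ ref v3 ∷ [])

-- Variable 3 is the list of candidates.
splitTerm fullTerm : Tm (small ∷ small ∷ small ∷ any ∷ any ∷ small ∷ []) any
splitTerm =
  ite (app meetsT (ref v5 ∷ forget (fst (ref v0)) ∷ ref v4 ∷ []))
      (app expandT (trust (ref v3) table ∷ ref v5 ∷ forget (snd (ref v0)) ∷
                    app initialT (ref v5 ∷ ref v0 ∷ []) ∷ []))
      (ref v3)
fullTerm =
  ite (andT (app meetsT (ref v5 ∷ forget (fst (ref v0)) ∷ ref v4 ∷ [])) (app leastT (ref v5 ∷ ref v0 ∷ [])))
      (app expandT (trust (ref v3) table ∷ ref v5 ∷ nil ∷
                    app classT (ref v5 ∷ forget (snd (ref v0)) ∷ ref v5 ∷ []) ∷ []))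
      (ref v3)

-- The list of candidates is a parameter rewritten in every iteration. It can only have sort `any`,
-- since the number of rewritings alone would allow exponential growth.
splitsT fullsT : Tm (small ∷ any ∷ any ∷ small ∷ []) any
splitsT = rec small (ref v1) (splitTerm ∷ ref v4 ∷ ref v5 ∷ []) (ref v0) (ref v0) (ref v1 ∷ ref v2 ∷ ref v3 ∷ [])
fullsT  = rec small (ref v1) (fullTerm ∷ ref v4 ∷ ref v5 ∷ []) (ref v0) (ref v0) (ref v1 ∷ ref v2 ∷ ref v3 ∷ [])

candidatesT : Tm (small ∷ any ∷ []) any
candidatesT =
  app fullsT (ref v0 ∷ app splitsT (ref v0 ∷ (app zerosT (ref v0 ∷ []) ∙ nil) ∷ ref v1 ∷ ref v0 ∷ []) ∷
              ref v1 ∷ ref v0 ∷ [])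

tablesT : Tm (small ∷ small ∷ []) any
tablesT =
  rec small nil (ref v3 ∷ [])
    ((forget (ref v1) ∙ app candidatesT (ref v4 ∷ forget (ref v1) ∷ [])) ∙ ref v0)
    (ref v0) (ref v1 ∷ [])

bestT : Tm (table ∷ small ∷ any ∷ []) any
bestT =
  rec table (ref v2) (ref v3 ∷ ref v4 ∷ [])
    (bind (app unionT (ref v4 ∷ ref v5 ∷ ref v1 ∷ []))
      (ite (app betterT (ref v5 ∷ ref v0 ∷ ref v1 ∷ [])) (ref v0) (ref v1)))
    (ref v0) (ref v1 ∷ ref v2 ∷ [])

mergeT : Tm (table ∷ small ∷ table ∷ []) any
mergeT =
  rec table nil (ref v3 ∷ ref v4 ∷ [])
    (app bestT (ref v5 ∷ ref v4 ∷ ref v1 ∷ []) ∙ ref v0)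
    (ref v0) (ref v1 ∷ ref v2 ∷ [])

degreeT : Tm (nodes ∷ small ∷ any ∷ []) any
degreeT =
  rec nodes nil (ref v3 ∷ ref v4 ∷ [])
    (ite (andT (notT (app meetsT (ref v4 ∷ ref v5 ∷ fst (ref v1) ∷ [])))
               (app linkedT (ref v4 ∷ ref v5 ∷ fst (ref v1) ∷ ref v4 ∷ [])))
         (nil ∙ ref v0) (ref v0))
    (ref v0) (ref v1 ∷ ref v2 ∷ [])

-- A unary degree has an empty tail exactly when it is at most one, so an isolated node counts as a
-- leaf too.
leafT : Tm (nodes ∷ nodes ∷ small ∷ []) node
leafT =
  rec nodes nil (ref v3 ∷ ref v4 ∷ [])
    (ite (snd (app degreeT (ref v4 ∷ ref v5 ∷ fst (ref v1) ∷ []))) (ref v0) (ref v1))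
    (ref v0) (ref v1 ∷ ref v2 ∷ [])

-- Classes are nonempty and pairwise disjoint, so meeting the leaf means being the leaf: the first
-- test deletes it from the list.
joinT : Tm (nodes ∷ small ∷ node ∷ []) any
joinT =
  rec nodes nil (ref v3 ∷ ref v4 ∷ [])
    (ite (app meetsT (ref v4 ∷ fst (ref v5) ∷ fst (ref v1) ∷ []))
         (ref v0)
         (ite (app linkedT (ref v4 ∷ fst (ref v5) ∷ fst (ref v1) ∷ ref v4 ∷ []))
              (fst (ref v1) ∙ app mergeT (snd (ref v1) ∷ ref v4 ∷ snd (ref v5) ∷ []))
              (forget (ref v1))
          ∙ ref v0))
    (ref v0) (ref v1 ∷ ref v2 ∷ [])

roundT : Tm (state ∷ small ∷ []) any
roundT =
  bind (app leafT (snd (ref v0) ∷ snd (ref v0) ∷ ref v1 ∷ []))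
    (ite (app degreeT (snd (ref v1) ∷ ref v2 ∷ fst (ref v0) ∷ []))
         (fst (ref v1))
         (app bestT (snd (ref v0) ∷ ref v2 ∷ fst (ref v1) ∷ []))
     ∙ app joinT (snd (ref v1) ∷ ref v2 ∷ ref v0 ∷ []))

-- The list of classes acts as a clock: one round, hence one deleted node, for each class.
roundsT : Tm (small ∷ any ∷ small ∷ []) any
roundsT =
  rec small (ref v1) (ref v3 ∷ ref v4 ∷ []) (app roundT (trust (ref v0) state ∷ ref v5 ∷ []))
    (ref v0) (ref v1 ∷ ref v2 ∷ [])

solveT : Tm (small ∷ small ∷ []) any
solveT =
  fst (app roundsT (snd (ref v1) ∷
                    (app zerosT (ref v0 ∷ []) ∙ app tablesT (snd (ref v1) ∷ ref v0 ∷ [])) ∷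
                    ref v0 ∷ []))

mainT : Tm (small ∷ []) any
mainT = bind (trust (app verticesT (fst (ref v0) ∷ (one ∙ nil) ∷ fst (ref v0) ∷ [])) small) solveT

-- What the terms compute

bit : Bool → Tree
bit = encodeBool

set : Subset n → Tree
set = encodeSubset

meets same : Vec Bool n → Vec Bool n → Bool
meets []       []       = false
meets (x ∷ xs) (y ∷ ys) = (x ∧ y) ∨ meets xs ys
same []       []       = true
same (x ∷ xs) (y ∷ ys) = not (x xor y) ∧ same xs ys

tally : Vec Bool n → Vec Bool n → ℕ
tally []       []       = 0
tally (x ∷ xs) (y ∷ ys) = (if x ∧ not y then 1 else 0) + tally xs ys

-- Filling leftwards from each set entry turns the singleton of `u` into the set of vertices up to
-- `u`, without any comparison of indices.
upTo : Vec Bool n → Vec Bool n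
headᵇ : Vec Bool n → Bool
headᵇ []       = false
headᵇ (x ∷ xs) = x
upTo []       = []
upTo (x ∷ xs) = (x ∨ headᵇ (upTo xs)) ∷ upTo xs

unary : ℕ → Tree
unary zero    = nil
unary (suc k) = nil ∙ unary k

nonzero : ℕ → Bool
nonzero zero    = false
nonzero (suc k) = true

union-value : ∀ c → spine c ≡ n → (x y : Subset n) → ⟦ unionT ⟧ (c ∷ set x ∷ set y ∷ []) ≡ set (x ∪ y)
union-value nil     h []          []          = refl
union-value (a ∙ c) h (true  ∷ x) (y ∷ ys)    = cong (bit true ∙_) (union-value c (suc-injective h) x ys)
union-value (a ∙ c) h (false ∷ x) (y ∷ ys)    = cong (bit y ∙_) (union-value c (suc-injective h) x ys)

inter-value : ∀ c → spine c ≡ n → (x y : Subset n) → ⟦ interT ⟧ (c ∷ set x ∷ set y ∷ []) ≡ set (x ∩ y)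
inter-value nil     h []          []          = refl
inter-value (a ∙ c) h (true  ∷ x) (y ∷ ys)    = cong (bit y ∙_) (inter-value c (suc-injective h) x ys)
inter-value (a ∙ c) h (false ∷ x) (y ∷ ys)    = cong (bit false ∙_) (inter-value c (suc-injective h) x ys)

meets-value : ∀ c → spine c ≡ n → (x y : Subset n) → ⟦ meetsT ⟧ (c ∷ set x ∷ set y ∷ []) ≡ bit (meets x y)
meets-value nil     h []          []          = refl
meets-value (a ∙ c) h (true  ∷ x) (true ∷ y)  = refl
meets-value (a ∙ c) h (true  ∷ x) (false ∷ y) = meets-value c (suc-injective h) x y
meets-value (a ∙ c) h (false ∷ x) (y ∷ ys)    = meets-value c (suc-injective h) x ys

-- `fullTerm` passes `nil` as the obstacle, which switches off the test inside `expandT` so that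
-- every candidate is doubled.
meets-nil : ∀ c x → ⟦ meetsT ⟧ (c ∷ nil ∷ x ∷ []) ≡ nil
meets-nil nil     x = refl
meets-nil (a ∙ c) x = meets-nil c _

equal-value : ∀ c → spine c ≡ n → (x y : Subset n) → ⟦ equalT ⟧ (c ∷ set x ∷ set y ∷ []) ≡ bit (same x y)
equal-value nil     h []          []          = refl
equal-value (a ∙ c) h (true  ∷ x) (true ∷ y)  = equal-value c (suc-injective h) x y
equal-value (a ∙ c) h (true  ∷ x) (false ∷ y) = refl
equal-value (a ∙ c) h (false ∷ x) (true ∷ y)  = refl
equal-value (a ∙ c) h (false ∷ x) (false ∷ y) = equal-value c (suc-injective h) x y

zeros-value : ∀ c → spine c ≡ n → ⟦ zerosT ⟧ (c ∷ []) ≡ set {n} ∅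
zeros-value {zero}  nil     h = refl
zeros-value {suc n} (a ∙ c) h = cong (nil ∙_) (zeros-value c (suc-injective h))

upTo-value : ∀ c → spine c ≡ n → (x : Subset n) → ⟦ upToT ⟧ (c ∷ set x ∷ []) ≡ set (upTo x)
upTo-value nil     h []          = refl
upTo-value (a ∙ c) h (true  ∷ x) = cong (bit true ∙_) (upTo-value c (suc-injective h) x)
upTo-value (a ∙ c) h (false ∷ x)
  rewrite upTo-value c (suc-injective h) x with upTo x
... | []     = refl
... | y ∷ ys = refl

pad-empty : ∀ c → spine c ≡ n → ⟦ padT ⟧ (c ∷ nil ∷ []) ≡ set {n} ∅
pad-empty {zero}  nil     h = refl
pad-empty {suc n} (a ∙ c) h = cong (nil ∙_) (pad-empty c (suc-injective h))

marker : ℕ → Tree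
marker zero    = bit true ∙ nil
marker (suc j) = bit false ∙ marker j

pad-value : ∀ c → spine c ≡ n → (u : Fin n) → ⟦ padT ⟧ (c ∷ marker (toℕ u) ∷ []) ≡ set ⁅ u ⁆
pad-value (a ∙ c) h zero    = cong (bit true ∙_) (pad-empty c (suc-injective h))
pad-value (a ∙ c) h (suc u) = cong (bit false ∙_) (pad-value c (suc-injective h) u)

module _ (g : Tm (any ∷ []) any) where
  tallyStep : ℕ → Tree → Tree
  tallyStep zero    r = r
  tallyStep (suc k) r = ⟦ g ⟧ (tallyStep k r ∷ [])

  tallyStep-+ : ∀ i j r → tallyStep (i + j) r ≡ tallyStep i (tallyStep j r)
  tallyStep-+ zero    j r = refl
  tallyStep-+ (suc i) j r = cong (λ r → ⟦ g ⟧ (r ∷ [])) (tallyStep-+ i j r)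

  tally-value : ∀ c → spine c ≡ n → (x y : Subset n) (r : Tree) →
                ⟦ tallyT g ⟧ (c ∷ set x ∷ set y ∷ r ∷ []) ≡ tallyStep (tally x y) r
  tally-value nil     h []          []           r = refl
  tally-value (a ∙ c) h (false ∷ x) (y ∷ ys)     r = tally-value c (suc-injective h) x ys r
  tally-value (a ∙ c) h (true ∷ x)  (true ∷ ys)  r = tally-value c (suc-injective h) x ys r
  tally-value (a ∙ c) h (true ∷ x)  (false ∷ ys) r =
    cong (λ r → ⟦ g ⟧ (r ∷ [])) (tally-value c (suc-injective h) x ys r)

tallyStep-add : ∀ k j → tallyStep (nil ∙ ref v0) k (unary j) ≡ unary (k + j)
tallyStep-add zero    j = refl
tallyStep-add (suc k) j = cong (nil ∙_) (tallyStep-add k j)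

-- The tail of zero is zero, which is why removing units amounts to truncated subtraction.
tallyStep-sub : ∀ k j → tallyStep (snd (ref v0)) k (unary j) ≡ unary (j ∸ k)
tallyStep-sub zero    j = refl
tallyStep-sub (suc k) j = begin
  tl (tallyStep (snd (ref v0)) k (unary j)) ≡⟨ cong tl (tallyStep-sub k j) ⟩
  tl (unary (j ∸ k))                        ≡⟨ lemma (j ∸ k) ⟩
  unary (pred (j ∸ k))                      ≡⟨ cong unary (pred[m∸n]≡m∸[1+n] j k) ⟩
  unary (j ∸ suc k)                         ∎
  where
  open ≡-Reasoning
  tl : Tree → Tree
  tl t = caseTree t nil (λ _ y → y)
  lemma : ∀ i → tl (unary i) ≡ unary (pred i)
  lemma zero    = refl
  lemma (suc i) = refl

spine-list : (f : X → Tree) (xs : List X) → spine (encodeList f xs) ≡ length xs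
spine-list f []       = refl
spine-list f (x ∷ xs) = cong suc (spine-list f xs)

spine-allFin : (f : Fin n → Tree) → spine (encodeList f (allFin n)) ≡ n
spine-allFin {n} f = trans (spine-list f (allFin n)) (length-tabulate {n = n} id)

module Specification {n : ℕ} (G : Graph n) where

  -- The closed neighbourhood: u and v are equal or twins iff C u ≡ C v.
  C : Fin n → Subset n
  C u = ⁅ u ⁆ ∪ N G u

  vertex : Fin n → Tree
  vertex u = set ⁅ u ⁆ ∙ set (C u)

  vertices : Tree
  vertices = encodeList vertex (allFin n)

  private
    clock : spine vertices ≡ n
    clock = spine-allFin vertex

  setOf : (Fin n → Bool) → Subset n
  setOf = Vec.tabulate

  class-of : Fin n → Subset n
  class-of u = setOf (λ v → same (C v) (C u))

  initial : Fin n → Subset n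
  initial u = class-of u ∩ upTo ⁅ u ⁆

  least : Fin n → Bool
  least u = same (initial u) ⁅ u ⁆

  -- Closed neighbourhoods serve as well as open ones here, since `u` itself is not outside `S`.
  -- Each cut edge is counted once, at its end inside `S`.
  cutOver : List (Fin n) → Subset n → ℕ
  cutOver []       S = 0
  cutOver (u ∷ us) S = (if meets ⁅ u ⁆ S then tally (C u) S else 0) + cutOver us S

  cut : Subset n → ℕ
  cut = cutOver (allFin n)

  linkedOver : List (Fin n) → Subset n → Subset n → Bool
  linkedOver []       A B = false
  linkedOver (u ∷ us) A B = (meets ⁅ u ⁆ A ∧ meets (C u) B) ∨ linkedOver us A B

  linked : Subset n → Subset n → Bool
  linked = linkedOver (allFin n)

  expand : (Subset n → Bool) → Subset n → List (Subset n) → List (Subset n)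
  expand c D []      = []
  expand c D (S ∷ L) = if c S then S ∷ expand c D L else S ∷ (S ∪ D) ∷ expand c D L

  -- A split step makes `u` the last vertex of a split bubble. Candidates are unions of initial
  -- segments at this stage, and twins have the same neighbours, so the test keeps the last vertices
  -- pairwise nonadjacent; twins being adjacent, it also keeps a bubble from being used twice. A
  -- full step acts once per bubble, at its least vertex.
  splitStep fullStep : Subset n → Fin n → List (Subset n) → List (Subset n)
  splitStep A u L = if meets ⁅ u ⁆ A then expand (meets (C u)) (initial u) L else L
  fullStep A u L = if meets ⁅ u ⁆ A ∧ least u then expand (const false) (class-of u) L else L

  steps : (Fin n → List (Subset n) → List (Subset n)) → List (Fin n) → List (Subset n) → List (Subset n)
  steps f []       L = L
  steps f (u ∷ us) L = steps f us (f u L)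

  candidates : Subset n → List (Subset n)
  candidates A = steps (fullStep A) (allFin n) (steps (splitStep A) (allFin n) (∅ ∷ []))

  -- The search starts from `S` itself, so the result always has the form `S` or `S ∪ T` and agrees
  -- with `S` away from the sets in the table.
  best : List (Subset n) → Subset n → Subset n
  best []      S = S
  best (T ∷ L) S =
    if nonzero (cut (S ∪ T) ∸ cut (best L S)) then S ∪ T else best L S

  merge : List (Subset n) → List (Subset n) → List (Subset n)
  merge L L′ = List.map (best L′) L

  sets : List (Subset n) → Tree
  sets = encodeList set

  class-loop : ∀ {m} (h : Fin m → Fin n) (u : Fin n) →
               ⟦ classT ⟧ (encodeList vertex (List.tabulate h) ∷ set (C u) ∷ vertices ∷ [])
               ≡ set (Vec.tabulate (λ i → same (C (h i)) (C u)))
  class-loop {zero}  h u = refl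
  class-loop {suc m} h u =
    cong₂ _∙_ (equal-value vertices clock (C (h zero)) (C u)) (class-loop (h ∘ suc) u)

  class-value : ∀ u → ⟦ classT ⟧ (vertices ∷ set (C u) ∷ vertices ∷ []) ≡ set (class-of u)
  class-value = class-loop id

  initial-value : ∀ u → ⟦ initialT ⟧ (vertices ∷ vertex u ∷ []) ≡ set (initial u)
  initial-value u =
    trans (cong₂ (λ x y → ⟦ interT ⟧ (vertices ∷ x ∷ y ∷ [])) (class-value u) (upTo-value vertices clock ⁅ u ⁆))
          (inter-value vertices clock (class-of u) (upTo ⁅ u ⁆))

  least-value : ∀ u → ⟦ leastT ⟧ (vertices ∷ vertex u ∷ []) ≡ bit (least u)
  least-value u =
    trans (cong (λ x → ⟦ equalT ⟧ (vertices ∷ x ∷ set ⁅ u ⁆ ∷ [])) (initial-value u))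
          (equal-value vertices clock (initial u) ⁅ u ⁆)

  cut-value : ∀ (g : Tm (any ∷ []) any) us S r →
    ⟦ cutT g ⟧ (encodeList vertex us ∷ set S ∷ r ∷ vertices ∷ []) ≡ tallyStep g (cutOver us S) r
  cut-value g [] S r = refl
  cut-value g (u ∷ us) S r rewrite meets-value vertices clock ⁅ u ⁆ S with meets ⁅ u ⁆ S
  ... | false = cut-value g us S r
  ... | true  = trans (tally-value g vertices clock (C u) S _)
                  (trans (cong (tallyStep g (tally (C u) S)) (cut-value g us S r))
                         (sym (tallyStep-+ g (tally (C u) S) (cutOver us S) r)))

  better-value : ∀ S S′ → ⟦ betterT ⟧ (vertices ∷ set S ∷ set S′ ∷ []) ≡ unary (cut S ∸ cut S′)
  better-value S S′ = begin
    ⟦ cutT (snd (ref v0)) ⟧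
      (vertices ∷ set S′ ∷ ⟦ cutT (nil ∙ ref v0) ⟧ (vertices ∷ set S ∷ nil ∷ vertices ∷ []) ∷ vertices ∷ [])
      ≡⟨ cong (λ r → ⟦ cutT (snd (ref v0)) ⟧ (vertices ∷ set S′ ∷ r ∷ vertices ∷ [])) first ⟩
    ⟦ cutT (snd (ref v0)) ⟧ (vertices ∷ set S′ ∷ unary (cut S) ∷ vertices ∷ [])
      ≡⟨ cut-value (snd (ref v0)) (allFin n) S′ _ ⟩
    tallyStep (snd (ref v0)) (cut S′) (unary (cut S))
      ≡⟨ tallyStep-sub (cut S′) (cut S) ⟩
    unary (cut S ∸ cut S′) ∎
    where
    open ≡-Reasoning
    first : ⟦ cutT (nil ∙ ref v0) ⟧ (vertices ∷ set S ∷ nil ∷ vertices ∷ []) ≡ unary (cut S)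
    first = trans (cut-value (nil ∙ ref v0) (allFin n) S nil)
              (trans (tallyStep-add (cut S) 0) (cong unary (+-identityʳ (cut S))))

  linked-loop : ∀ us A B → ⟦ linkedT ⟧ (encodeList vertex us ∷ set A ∷ set B ∷ vertices ∷ []) ≡ bit (linkedOver us A B)
  linked-loop [] A B = refl
  linked-loop (u ∷ us) A B rewrite meets-value vertices clock ⁅ u ⁆ A | meets-value vertices clock (C u) B
    with meets ⁅ u ⁆ A
  ... | false = linked-loop us A B
  ... | true with meets (C u) B
  ...   | false = linked-loop us A B
  ...   | true  = refl

  linked-value : ∀ A B → ⟦ linkedT ⟧ (vertices ∷ set A ∷ set B ∷ vertices ∷ []) ≡ bit (linked A B)
  linked-value = linked-loop (allFin n)

  expand-value : ∀ c x D L → (∀ S → ⟦ meetsT ⟧ (vertices ∷ x ∷ set S ∷ []) ≡ bit (c S)) →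
                 ⟦ expandT ⟧ (sets L ∷ vertices ∷ x ∷ set D ∷ []) ≡ sets (expand c D L)
  expand-value c x D []      h = refl
  expand-value c x D (S ∷ L) h
    rewrite h S | union-value vertices clock S D | expand-value c x D L h with c S
  ... | false = refl
  ... | true  = refl

  expand-split : ∀ u L → ⟦ expandT ⟧ (sets L ∷ vertices ∷ set (C u) ∷ ⟦ initialT ⟧ (vertices ∷ vertex u ∷ []) ∷ [])
                         ≡ sets (expand (meets (C u)) (initial u) L)
  expand-split u L =
    trans (cong (λ x → ⟦ expandT ⟧ (sets L ∷ vertices ∷ set (C u) ∷ x ∷ [])) (initial-value u))
          (expand-value (meets (C u)) (set (C u)) (initial u) L (meets-value vertices clock (C u)))

  expand-full : ∀ u L → ⟦ expandT ⟧ (sets L ∷ vertices ∷ nil ∷ ⟦ classT ⟧ (vertices ∷ set (C u) ∷ vertices ∷ []) ∷ [])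
                         ≡ sets (expand (const false) (class-of u) L)
  expand-full u L =
    trans (cong (λ x → ⟦ expandT ⟧ (sets L ∷ vertices ∷ nil ∷ x ∷ [])) (class-value u))
          (expand-value (const false) nil (class-of u) L (λ S → meets-nil vertices (set S)))

  splitTerm-value : ∀ u t t′ L A →
    ⟦ splitTerm ⟧ (vertex u ∷ t ∷ t′ ∷ sets L ∷ set A ∷ vertices ∷ []) ≡ sets (splitStep A u L)
  splitTerm-value u t t′ L A rewrite meets-value vertices clock ⁅ u ⁆ A with meets ⁅ u ⁆ A
  ... | false = refl
  ... | true  = expand-split u L

  fullTerm-value : ∀ u t t′ L A →
    ⟦ fullTerm ⟧ (vertex u ∷ t ∷ t′ ∷ sets L ∷ set A ∷ vertices ∷ []) ≡ sets (fullStep A u L)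
  fullTerm-value u t t′ L A rewrite meets-value vertices clock ⁅ u ⁆ A | least-value u with meets ⁅ u ⁆ A
  ... | false = refl
  ... | true with least u
  ...   | false = refl
  ...   | true  = expand-full u L

  splits-value : ∀ us L A →
    ⟦ splitsT ⟧ (encodeList vertex us ∷ sets L ∷ set A ∷ vertices ∷ []) ≡ sets (steps (splitStep A) us L)
  splits-value []       L A = refl
  splits-value (u ∷ us) L A =
    trans (cong (λ x → ⟦ splitsT ⟧ (encodeList vertex us ∷ x ∷ set A ∷ vertices ∷ []))
            (splitTerm-value u (encodeList vertex us) (encodeList vertex (u ∷ us)) L A))
          (splits-value us _ A)

  fulls-value : ∀ us L A →
    ⟦ fullsT ⟧ (encodeList vertex us ∷ sets L ∷ set A ∷ vertices ∷ []) ≡ sets (steps (fullStep A) us L)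
  fulls-value []       L A = refl
  fulls-value (u ∷ us) L A =
    trans (cong (λ x → ⟦ fullsT ⟧ (encodeList vertex us ∷ x ∷ set A ∷ vertices ∷ []))
            (fullTerm-value u (encodeList vertex us) (encodeList vertex (u ∷ us)) L A))
          (fulls-value us _ A)

  candidates-value : ∀ A → ⟦ candidatesT ⟧ (vertices ∷ set A ∷ []) ≡ sets (candidates A)
  candidates-value A =
    trans (cong (λ x → ⟦ fullsT ⟧ (vertices ∷ x ∷ set A ∷ vertices ∷ []))
            (trans (cong (λ x → ⟦ splitsT ⟧ (vertices ∷ (x ∙ nil) ∷ set A ∷ vertices ∷ [])) (zeros-value vertices clock))
                   (splits-value (allFin n) (∅ ∷ []) A)))
          (fulls-value (allFin n) _ A)

  best-value : ∀ L S → ⟦ bestT ⟧ (sets L ∷ vertices ∷ set S ∷ []) ≡ set (best L S)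
  best-value []      S = refl
  best-value (T ∷ L) S
    rewrite best-value L S | union-value vertices clock S T | better-value (S ∪ T) (best L S)
    with cut (S ∪ T) ∸ cut (best L S)
  ... | zero  = refl
  ... | suc _ = refl

  merge-value : ∀ L L′ → ⟦ mergeT ⟧ (sets L ∷ vertices ∷ sets L′ ∷ []) ≡ sets (merge L L′)
  merge-value []      L′ = refl
  merge-value (S ∷ L) L′ = cong₂ _∙_ (best-value L′ S) (merge-value L L′)

  module _ {k : ℕ} (V : Fin k → Subset n) where

    Node : Set
    Node = Fin k × List (Subset n)

    node-tree : Node → Tree
    node-tree (i , L) = set (V i) ∙ sets L

    neighbour : Fin k → Fin k → Bool
    neighbour i j = not (meets (V i) (V j)) ∧ linked (V i) (V j)

    degree : Fin k → List Node → ℕ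
    degree i []       = 0
    degree i (x ∷ xs) = (if neighbour i (proj₁ x) then 1 else 0) + degree i xs

    leaf : List Node → List Node → Maybe Node
    leaf all []       = nothing
    leaf all (x ∷ xs) = if nonzero (pred (degree (proj₁ x) all)) then leaf all xs else just x

    joined : Node → Node → Node
    joined (i , L) (j , L′) = if linked (V i) (V j) then (j , merge L′ L) else (j , L′)

    join : Node → List Node → List Node
    join x []       = []
    join x (y ∷ ys) = if meets (V (proj₁ x)) (V (proj₁ y)) then join x ys else joined x y ∷ join x ys

    collect : Node → List Node → Subset n → Subset n
    collect (i , L) ys S = if nonzero (degree i ys) then S else best L S

    nodeTrees : List Node → Tree
    nodeTrees = encodeList node-tree

    degree-value : ∀ i xs → ⟦ degreeT ⟧ (nodeTrees xs ∷ vertices ∷ set (V i) ∷ []) ≡ unary (degree i xs)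
    degree-value i []       = refl
    degree-value i (x ∷ xs)
      rewrite meets-value vertices clock (V i) (V (proj₁ x)) | linked-value (V i) (V (proj₁ x)) | degree-value i xs
      with meets (V i) (V (proj₁ x))
    ... | true = refl
    ... | false with linked (V i) (V (proj₁ x))
    ...   | false = refl
    ...   | true  = refl

    maybe-tree : Maybe Node → Tree
    maybe-tree nothing  = nil
    maybe-tree (just x) = node-tree x

    leaf-value : ∀ all xs → ⟦ leafT ⟧ (nodeTrees xs ∷ nodeTrees all ∷ vertices ∷ []) ≡ maybe-tree (leaf all xs)
    leaf-value all []       = refl
    leaf-value all (x ∷ xs)
      rewrite degree-value (proj₁ x) all | leaf-value all xs
      with degree (proj₁ x) all
    ... | 0 = refl
    ... | 1 = refl
    ... | suc (suc _) = refl

    join-value : ∀ x ys → ⟦ joinT ⟧ (nodeTrees ys ∷ vertices ∷ node-tree x ∷ []) ≡ nodeTrees (join x ys)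
    join-value x []       = refl
    join-value x (y ∷ ys)
      rewrite meets-value vertices clock (V (proj₁ x)) (V (proj₁ y)) | linked-value (V (proj₁ x)) (V (proj₁ y))
            | join-value x ys | merge-value (proj₂ y) (proj₂ x)
      with meets (V (proj₁ x)) (V (proj₁ y))
    ... | true = refl
    ... | false with linked (V (proj₁ x)) (V (proj₁ y))
    ...   | false = refl
    ...   | true  = refl

    round-value : ∀ S xs x → leaf xs xs ≡ just x →
      ⟦ roundT ⟧ ((set S ∙ nodeTrees xs) ∷ vertices ∷ []) ≡ set (collect x xs S) ∙ nodeTrees (join x xs)
    round-value S xs x@(i , L) eq
      rewrite leaf-value xs xs | eq | degree-value i xs | best-value L S | join-value x xs with degree i xs
    ... | zero  = refl
    ... | suc _ = refl

    tables-value : ∀ is →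
      ⟦ tablesT ⟧ (encodeList (λ i → set (V i)) is ∷ vertices ∷ [])
      ≡ nodeTrees (List.map (λ i → i , candidates (V i)) is)
    tables-value []       = refl
    tables-value (i ∷ is) = cong₂ _∙_ (cong (set (V i) ∙_) (candidates-value (V i))) (tables-value is)

  private
    row : Fin n → Tree
    row v = set (N G v)

    rows : Tree
    rows = encodeGraph G

  -- The loop sees a suffix of the vertices, enumerated by `h`; the hypothesis keeps the marker in
  -- step with its first vertex.
  vertices-loop : ∀ {m} (h : Fin m → Fin n) j → (∀ i → toℕ (h i) ≡ j + toℕ i) →
    ⟦ verticesT ⟧ (encodeList row (List.tabulate h) ∷ marker j ∷ rows ∷ [])
    ≡ encodeList vertex (List.tabulate h)
  vertices-loop {zero}  h j eq = refl
  vertices-loop {suc m} h j eq =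
    cong₂ _∙_ (begin
      p ∙ ⟦ unionT ⟧ (rows ∷ p ∷ row (h zero) ∷ [])
        ≡⟨ cong (λ p → p ∙ ⟦ unionT ⟧ (rows ∷ p ∷ row (h zero) ∷ [])) pad ⟩
      set ⁅ h zero ⁆ ∙ ⟦ unionT ⟧ (rows ∷ set ⁅ h zero ⁆ ∷ row (h zero) ∷ [])
        ≡⟨ cong (set ⁅ h zero ⁆ ∙_) (union-value rows (spine-allFin row) ⁅ h zero ⁆ (N G (h zero))) ⟩
      vertex (h zero) ∎)
      (vertices-loop (h ∘ suc) (suc j) (λ i → trans (eq (suc i)) (+-suc j (toℕ i))))
    where
    open ≡-Reasoning
    p = ⟦ padT ⟧ (rows ∷ marker j ∷ [])
    pad : p ≡ set ⁅ h zero ⁆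
    pad = trans (cong (λ j → ⟦ padT ⟧ (rows ∷ marker j ∷ [])) (sym (trans (eq zero) (+-identityʳ j))))
                (pad-value rows (spine-allFin row) (h zero))

  vertices-value : ⟦ verticesT ⟧ (encodeGraph G ∷ ((nil ∙ nil) ∙ nil) ∷ encodeGraph G ∷ []) ≡ vertices
  vertices-value = vertices-loop id 0 (λ i → refl)

-- Cuts as sums

T⇒true : ∀ {b} → T b → b ≡ true
T⇒true {true} _ = refl

true⇒T : ∀ {b} → b ≡ true → T b
true⇒T refl = tt

∧-true : ∀ {a b} → a ∧ b ≡ true → a ≡ true × b ≡ true
∧-true {true} h = refl , h

∧-intro : ∀ {a b} → a ≡ true → b ≡ true → a ∧ b ≡ true
∧-intro refl h = h

∨-true : ∀ a {b} → a ∨ b ≡ true → (a ≡ false → b ≡ true)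
∨-true false h _ = h
∨-true true  h ()

⇔→≡ : ∀ {a b} → (a ≡ true → b ≡ true) → (b ≡ true → a ≡ true) → a ≡ b
⇔→≡ {true}  f g = sym (f refl)
⇔→≡ {false} {true}  f g = g refl
⇔→≡ {false} {false} f g = refl

true≢false : ∀ {b} → b ≡ true → b ≡ false → ⊥
true≢false refl ()

lookup-∅ : (v : Fin n) → lookup (∅ {n}) v ≡ false
lookup-∅ v = lookup-replicate v false

lookup-∪ : (S S′ : Subset n) (v : Fin n) → lookup (S ∪ S′) v ≡ lookup S v ∨ lookup S′ v
lookup-∪ S S′ v = lookup-zipWith _∨_ v S S′

lookup-∩ : (S S′ : Subset n) (v : Fin n) → lookup (S ∩ S′) v ≡ lookup S v ∧ lookup S′ v
lookup-∩ S S′ v = lookup-zipWith _∧_ v S S′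

lookup-⁅⁆ : (u v : Fin n) → lookup ⁅ u ⁆ v ≡ does (u ≟ v)
lookup-⁅⁆ zero    zero    = refl
lookup-⁅⁆ zero    (suc v) = lookup-∅ v
lookup-⁅⁆ (suc u) zero    = refl
lookup-⁅⁆ (suc u) (suc v) = lookup-⁅⁆ u v

subset-ext : {S S′ : Subset n} → (∀ v → lookup S v ≡ lookup S′ v) → S ≡ S′
subset-ext {S = []}    {[]}     h = refl
subset-ext {S = x ∷ S} {y ∷ S′} h = cong₂ _∷_ (h zero) (subset-ext (h ∘ suc))

meets-∅ : (S : Subset n) → meets ∅ S ≡ false
meets-∅ []      = refl
meets-∅ (x ∷ S) = meets-∅ S

meets-⁅⁆ : (u : Fin n) (S : Subset n) → meets ⁅ u ⁆ S ≡ lookup S u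
meets-⁅⁆ zero    (true  ∷ S) = refl
meets-⁅⁆ zero    (false ∷ S) = meets-∅ S
meets-⁅⁆ (suc u) (x ∷ S)     = meets-⁅⁆ u S

meets-elim : (S S′ : Subset n) → meets S S′ ≡ true → ∃[ v ] lookup S v ≡ true × lookup S′ v ≡ true
meets-elim []          []          ()
meets-elim (true  ∷ S) (true  ∷ S′) h = zero , refl , refl
meets-elim (true  ∷ S) (false ∷ S′) h = let v , p , q = meets-elim S S′ h in suc v , p , q
meets-elim (false ∷ S) (_     ∷ S′) h = let v , p , q = meets-elim S S′ h in suc v , p , q

meets-intro : (S S′ : Subset n) (v : Fin n) → lookup S v ≡ true → lookup S′ v ≡ true → meets S S′ ≡ true
meets-intro (_ ∷ S) (_ ∷ S′) zero    refl refl = refl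
meets-intro (x ∷ S) (y ∷ S′) (suc v) p    q    rewrite meets-intro S S′ v p q = Boolₚ.∨-zeroʳ (x ∧ y)

same-refl : (S : Subset n) → same S S ≡ true
same-refl []          = refl
same-refl (true  ∷ S) = same-refl S
same-refl (false ∷ S) = same-refl S

same-elim : (S S′ : Subset n) → same S S′ ≡ true → S ≡ S′
same-elim []          []           h = refl
same-elim (true  ∷ S) (true  ∷ S′) h = cong (true ∷_) (same-elim S S′ h)
same-elim (false ∷ S) (false ∷ S′) h = cong (false ∷_) (same-elim S S′ h)

upTo-∅ : ∀ n → upTo (∅ {n}) ≡ ∅
upTo-∅ zero = refl
upTo-∅ (suc n) rewrite upTo-∅ n = cong (_∷ ∅) (head n)
  where
  head : ∀ n → headᵇ (∅ {n}) ≡ false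
  head zero    = refl
  head (suc n) = refl

headᵇ-upTo : (u : Fin n) → headᵇ (upTo ⁅ u ⁆) ≡ true
headᵇ-upTo zero    = refl
headᵇ-upTo (suc u) = headᵇ-upTo u

lookup-upTo : (u v : Fin n) → lookup (upTo ⁅ u ⁆) v ≡ true ⇔ v Fin.≤ u
lookup-upTo zero    zero    = mk⇔ (λ _ → z≤n) (λ _ → refl)
lookup-upTo {suc n} zero (suc v) rewrite upTo-∅ n = mk⇔ (λ h → ⊥-elim (true≢false h (lookup-∅ v))) λ ()
lookup-upTo (suc u) zero    = mk⇔ (λ _ → z≤n) (λ _ → headᵇ-upTo u)
lookup-upTo (suc u) (suc v) = let record { to = to ; from = from } = lookup-upTo u v in
  mk⇔ (λ h → s≤s (to h)) (λ { (s≤s h) → from h })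

χ : Bool → ℕ
χ b = if b then 1 else 0

sum-zero : (f : Fin n → ℕ) → (∀ v → f v ≡ 0) → sum f ≡ 0
sum-zero {zero}  f h = refl
sum-zero {suc n} f h rewrite h zero = sum-zero (f ∘ suc) (h ∘ suc)

sum-point : (v : Fin n) (f : Fin n → ℕ) → sum (λ w → if does (w ≟ v) then f w else 0) ≡ f v
sum-point zero    f =
  trans (cong (f zero +_) (sum-zero (λ w → if does (suc w ≟ zero) then f (suc w) else 0) λ _ → refl))
        (+-identityʳ (f zero))
sum-point (suc v) f = sum-point v (f ∘ suc)

private
  sumOver : List X → (X → ℕ) → ℕ
  sumOver []       f = 0
  sumOver (x ∷ xs) f = f x + sumOver xs f

  sumOver-++ : (xs ys : List X) (f : X → ℕ) → sumOver (xs ++ ys) f ≡ sumOver xs f + sumOver ys f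
  sumOver-++ []       ys f = refl
  sumOver-++ (x ∷ xs) ys f = trans (cong (f x +_) (sumOver-++ xs ys f)) (sym (+-assoc (f x) _ _))

  sumOver-map : {B : Set} (g : X → B) (xs : List X) (f : B → ℕ) → sumOver (List.map g xs) f ≡ sumOver xs (f ∘ g)
  sumOver-map g []       f = refl
  sumOver-map g (x ∷ xs) f = cong (f (g x) +_) (sumOver-map g xs f)

  sumOver-product : {B : Set} (xs : List X) (ys : List B) (f : X × B → ℕ) →
                    sumOver (cartesianProduct xs ys) f ≡ sumOver xs (λ x → sumOver ys (λ y → f (x , y)))
  sumOver-product []       ys f = refl
  sumOver-product (x ∷ xs) ys f =
    trans (sumOver-++ (List.map (x ,_) ys) _ f)
      (cong₂ _+_ (sumOver-map (x ,_) ys f) (sumOver-product xs ys f))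

  sumOver-tabulate : (h : Fin n → X) (f : X → ℕ) → sumOver (List.tabulate h) f ≡ sum (f ∘ h)
  sumOver-tabulate {zero}  h f = refl
  sumOver-tabulate {suc n} h f = cong (f (h zero) +_) (sumOver-tabulate (h ∘ suc) f)

  length-filters : {P : X → Set} (P? : ∀ x → Dec (P x)) (p : X → Bool) (xs : List X) →
                   length (filterᵇ p (filter P? xs)) ≡ sumOver xs (λ x → χ (does (P? x) ∧ p x))
  length-filters P? p [] = refl
  length-filters P? p (x ∷ xs) with does (P? x)
  ... | false = length-filters P? p xs
  ... | true with p x
  ...   | false = length-filters P? p xs
  ...   | true  = cong suc (length-filters P? p xs)

tally-sum : (S S′ : Subset n) → tally S S′ ≡ sum (λ v → χ (lookup S v ∧ not (lookup S′ v)))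
tally-sum []      []       = refl
tally-sum (x ∷ S) (y ∷ S′) = cong (χ (x ∧ not y) +_) (tally-sum S S′)

module Cuts {n : ℕ} (G : Graph n) where
  open Specification G

  c : Fin n → Fin n → Bool
  c u v = lookup (C u) v

  c-def : ∀ u v → c u v ≡ does (u ≟ v) ∨ Graph.edge G u v
  c-def u v = trans (lookup-∪ ⁅ u ⁆ (N G u) v)
                (cong₂ _∨_ (lookup-⁅⁆ u v) (lookup∘tabulate (Graph.edge G u) v))

  c-refl : ∀ u → c u u ≡ true
  c-refl u rewrite c-def u u | dec-true (u ≟ u) refl = refl

  c-edge : ∀ {u v} → u ≢ v → c u v ≡ Graph.edge G u v
  c-edge {u} {v} h rewrite c-def u v | dec-false (u ≟ v) h = refl

  edge-sym : ∀ u v → Graph.edge G u v ≡ Graph.edge G v u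
  edge-sym u v = ⇔→≡ (λ h → T⇒true (Graph.symmetric G (true⇒T h))) (λ h → T⇒true (Graph.symmetric G (true⇒T h)))

  c-sym : ∀ u v → c u v ≡ c v u
  c-sym u v with u ≟ v
  ... | yes refl = refl
  ... | no u≢v = trans (c-edge u≢v) (trans (edge-sym u v) (sym (c-edge (u≢v ∘ sym))))

  cutTerm : (Fin n → Bool) → Fin n → Fin n → ℕ
  cutTerm x u v = χ (x u ∧ (c u v ∧ not (x v)))

  F : (Fin n → Bool) → ℕ
  F x = sum λ u → sum λ v → cutTerm x u v

  F-cong : ∀ {x y} → (∀ v → x v ≡ y v) → F x ≡ F y
  F-cong h = sum-cong-≗ λ u → sum-cong-≗ λ v → cong₂ (λ a b → χ (a ∧ (c u v ∧ not b))) (h u) (h v)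

  cut≡F : ∀ S → cut S ≡ F (lookup S)
  cut≡F S = trans (go id) (sum-cong-≗ term)
    where
    go : (h : Fin m → Fin n) → cutOver (List.tabulate h) S
         ≡ sum (λ i → if meets ⁅ h i ⁆ S then tally (C (h i)) S else 0)
    go {zero}  h = refl
    go {suc m} h = cong ((if meets ⁅ h zero ⁆ S then tally (C (h zero)) S else 0) +_) (go (h ∘ suc))
    term : ∀ u → (if meets ⁅ u ⁆ S then tally (C u) S else 0) ≡ sum (cutTerm (lookup S) u)
    term u rewrite meets-⁅⁆ u S with lookup S u
    ... | true  = tally-sum (C u) S
    ... | false = sym (sum-zero {n} (λ v → 0) (λ v → refl))

  -- `cutSize` counts pairs `u < v` with one end in `S`, whereas `F` counts ordered pairs leading
  -- out of `S`. Splitting the `xor` by which end lies inside and transposing one half of the double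
  -- sum converts one into the other.
  cutSize≡F : ∀ S → cutSize G S ≡ F (lookup S)
  cutSize≡F S = begin
    cutSize G S ≡⟨ length-filters Q? p (cartesianProduct (allFin n) (allFin n)) ⟩
    sumOver (cartesianProduct (allFin n) (allFin n)) f ≡⟨ sumOver-product (allFin n) (allFin n) f ⟩
    sumOver (allFin n) (λ u → sumOver (allFin n) (λ v → f (u , v)))
      ≡⟨ sumOver-tabulate id (λ u → sumOver (allFin n) (λ v → f (u , v))) ⟩
    sum (λ u → sumOver (allFin n) (λ v → f (u , v)))
      ≡⟨ sum-cong-≗ (λ u → sumOver-tabulate id (λ v → f (u , v))) ⟩
    sum (λ u → sum (λ v → f (u , v)))
      ≡⟨ sum-cong-≗ (λ u → trans (sum-cong-≗ (λ v → split-f u v)) (∑-distrib-+ (a u) (b u))) ⟩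
    sum (λ u → sum (a u) + sum (b u)) ≡⟨ ∑-distrib-+ (λ u → sum (a u)) (λ u → sum (b u)) ⟩
    sum (λ u → sum (a u)) + sum (λ u → sum (b u))
      ≡⟨ cong (sum (λ u → sum (a u)) +_) (∑-comm b) ⟩
    sum (λ u → sum (a u)) + sum (λ v → sum (λ u → b u v))
      ≡⟨ ∑-distrib-+ (λ u → sum (a u)) (λ v → sum (λ u → b u v)) ⟨
    sum (λ u → sum (a u) + sum (λ v → b v u))
      ≡⟨ sum-cong-≗ (λ u → trans (sym (∑-distrib-+ (a u) (λ v → b v u))) (sum-cong-≗ (join-f u))) ⟩
    F (lookup S) ∎
    where
    open ≡-Reasoning
    Q? : (e : Fin n × Fin n) → Dec _
    Q? (u , v) = (u <ᶠ? v) ×-dec T? (Graph.edge G u v)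
    p : Fin n × Fin n → Bool
    p (u , v) = lookup S u xor lookup S v
    f : Fin n × Fin n → ℕ
    f e = χ (does (Q? e) ∧ p e)
    a b : Fin n → Fin n → ℕ
    a u v = χ (does (u <ᶠ? v) ∧ Graph.edge G u v ∧ (lookup S u ∧ not (lookup S v)))
    b u v = χ (does (u <ᶠ? v) ∧ Graph.edge G u v ∧ (not (lookup S u) ∧ lookup S v))
    split-f : ∀ u v → f (u , v) ≡ a u v + b u v
    split-f u v with does (u <ᶠ? v) | Graph.edge G u v | lookup S u | lookup S v
    ... | false | _     | _     | _     = refl
    ... | true  | false | _     | _     = refl
    ... | true  | true  | false | false = refl
    ... | true  | true  | false | true  = refl
    ... | true  | true  | true  | false = refl
    ... | true  | true  | true  | true  = refl
    join-f : ∀ u v → a u v + b v u ≡ cutTerm (lookup S) u v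
    join-f u v with Finₚ.<-cmp u v
    ... | tri< u<v u≢v v≮u
      rewrite dec-true (u <ᶠ? v) u<v | dec-false (v <ᶠ? u) v≮u | c-edge u≢v
      with Graph.edge G u v | lookup S u | lookup S v
    ... | false | false | _     = refl
    ... | false | true  | _     = refl
    ... | true  | false | _     = refl
    ... | true  | true  | false = refl
    ... | true  | true  | true  = refl
    join-f u v | tri> u≮v u≢v v<u
      rewrite dec-true (v <ᶠ? u) v<u | dec-false (u <ᶠ? v) u≮v | c-edge u≢v | edge-sym u v
      with Graph.edge G v u | lookup S u | lookup S v
    ... | false | false | _     = refl
    ... | false | true  | _     = refl
    ... | true  | false | false = refl
    ... | true  | false | true  = refl
    ... | true  | true  | false = refl
    ... | true  | true  | true  = refl
    join-f u v | tri≈ u≮v refl v≮u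
      rewrite dec-false (u <ᶠ? u) u≮v | c-refl u with lookup S u
    ... | false = refl
    ... | true  = refl

-- A normal form of maximum cuts

sum-if : (b : Bool) (f : Fin n → ℕ) → sum (λ w → if b then f w else 0) ≡ (if b then sum f else 0)
sum-if true  f = refl
sum-if {n} false f = sum-zero {n} (λ _ → 0) (λ _ → refl)

∑∑ : (Fin n → Fin n → ℕ) → ℕ
∑∑ f = sum (λ u → sum (f u))

∑∑-+ : (f g : Fin n → Fin n → ℕ) → ∑∑ (λ u w → f u w + g u w) ≡ ∑∑ f + ∑∑ g
∑∑-+ f g = trans (sum-cong-≗ (λ u → ∑-distrib-+ (f u) (g u))) (∑-distrib-+ (λ u → sum (f u)) (λ u → sum (g u)))

-- The binary numeral of a set. Being injective, it orders the bubbles linearly by their closed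
-- neighbourhoods.
code : Vec Bool n → ℕ
code []       = 0
code (x ∷ xs) = χ x + 2 * code xs

code-injective : (xs ys : Vec Bool n) → code xs ≡ code ys → xs ≡ ys
code-injective []           []           h = refl
code-injective (true  ∷ xs) (true  ∷ ys) h =
  cong (true ∷_) (code-injective xs ys (*-cancelˡ-≡ (code xs) (code ys) 2 (suc-injective h)))
code-injective (false ∷ xs) (false ∷ ys) h =
  cong (false ∷_) (code-injective xs ys (*-cancelˡ-≡ (code xs) (code ys) 2 h))
code-injective (true  ∷ xs) (false ∷ ys) h = ⊥-elim (even≢odd (code ys) (code xs) (sym h))
code-injective (false ∷ xs) (true  ∷ ys) h = ⊥-elim (even≢odd (code xs) (code ys) h)

maximum : (f : Vec Bool n → ℕ) → ∃[ S ] (∀ S′ → f S′ ≤ f S)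
maximum {zero}  f = [] , λ { [] → ≤-refl }
maximum {suc n} f with maximum (f ∘ (true ∷_)) | maximum (f ∘ (false ∷_))
... | S , hS | R , hR with ≤-total (f (true ∷ S)) (f (false ∷ R))
... | inj₁ h = false ∷ R , λ { (true ∷ S′) → ≤-trans (hS S′) h ; (false ∷ S′) → hR S′ }
... | inj₂ h = true ∷ S , λ { (true ∷ S′) → hS S′ ; (false ∷ S′) → ≤-trans (hR S′) h }

infixl 6 _⊕_ _⊖_

_⊕_ _⊖_ : (Fin n → Bool) → Fin n → Fin n → Bool
(x ⊕ v) w = does (w ≟ v) ∨ x w
(x ⊖ v) w = not (does (w ≟ v)) ∧ x w

⊕-⊖ : (x : Fin n → Bool) (v : Fin n) → x v ≡ true → ∀ w → x w ≡ (x ⊖ v ⊕ v) w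
⊕-⊖ x v h w with w ≟ v
... | yes refl = h
... | no  _    = refl

⊖-self : (x : Fin n → Bool) (v : Fin n) → (x ⊖ v) v ≡ false
⊖-self x v rewrite dec-true (v ≟ v) refl = refl

⊖-false : (x : Fin n → Bool) (v w : Fin n) → x w ≡ false → (x ⊖ v) w ≡ false
⊖-false x v w h rewrite h = Boolₚ.∧-zeroʳ _

weigh : (Fin n → ℕ) → (Fin n → Bool) → ℕ
weigh ω x = sum (λ v → if x v then ω v else 0)

weigh-⊕ : (ω : Fin n → ℕ) (x : Fin n → Bool) (v : Fin n) → x v ≡ false → weigh ω (x ⊕ v) ≡ weigh ω x + ω v
weigh-⊕ ω x v h = begin
  weigh ω (x ⊕ v) ≡⟨ sum-cong-≗ term ⟩
  sum (λ w → (if x w then ω w else 0) + (if does (w ≟ v) then ω w else 0))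
    ≡⟨ ∑-distrib-+ (λ w → if x w then ω w else 0) (λ w → if does (w ≟ v) then ω w else 0) ⟩
  weigh ω x + sum (λ w → if does (w ≟ v) then ω w else 0) ≡⟨ cong (weigh ω x +_) (sum-point v ω) ⟩
  weigh ω x + ω v ∎
  where
  open ≡-Reasoning
  term : ∀ w → (if (x ⊕ v) w then ω w else 0) ≡ (if x w then ω w else 0) + (if does (w ≟ v) then ω w else 0)
  term w with w ≟ v
  ... | yes refl rewrite h = refl
  ... | no _ = sym (+-identityʳ _)

module Exchange {n : ℕ} (G : Graph n) where
  open Specification G
  open Cuts G

  D : (Fin n → Bool) → Fin n → ℕ
  D x v = sum (λ w → χ (c v w ∧ x w))

  K : Fin n → ℕ
  K v = sum (λ w → χ (c v w))

  -- The new vertex cuts its `K v - 1 - D x v` neighbours outside `x` and no longer cuts its `D x v`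
  -- neighbours inside. The terms are arranged so that no subtraction of naturals occurs.
  F-⊕ : ∀ x v → x v ≡ false → F (x ⊕ v) + (D x v + D x v + 1) ≡ F x + K v
  F-⊕ x v h = begin
    F (x ⊕ v) + (D x v + D x v + 1)
      ≡⟨ cong (F (x ⊕ v) +_) (cong₂ _+_ (cong₂ _+_ (sym sum-a) (sym sum-b)) (sym sum-e)) ⟩
    F (x ⊕ v) + (∑∑ a + ∑∑ b + ∑∑ e)
      ≡⟨ cong (F (x ⊕ v) +_) (trans (cong (_+ ∑∑ e) (sym (∑∑-+ a b))) (sym (∑∑-+ (λ u w → a u w + b u w) e))) ⟩
    F (x ⊕ v) + ∑∑ (λ u w → a u w + b u w + e u w)
      ≡⟨ ∑∑-+ (cutTerm (x ⊕ v)) (λ u w → a u w + b u w + e u w) ⟨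
    ∑∑ (λ u w → cutTerm (x ⊕ v) u w + (a u w + b u w + e u w))
      ≡⟨ sum-cong-≗ (λ u → sum-cong-≗ (λ w → term u w)) ⟩
    ∑∑ (λ u w → cutTerm x u w + d u w) ≡⟨ ∑∑-+ (cutTerm x) d ⟩
    F x + ∑∑ d ≡⟨ cong (F x +_) sum-d ⟩
    F x + K v ∎
    where
    open ≡-Reasoning
    a b e d : Fin n → Fin n → ℕ
    a u w = if does (u ≟ v) then χ (c v w ∧ x w) else 0
    b u w = if does (w ≟ v) then χ (c v u ∧ x u) else 0
    e u w = if does (u ≟ v) then (if does (w ≟ v) then 1 else 0) else 0
    d u w = if does (u ≟ v) then χ (c v w) else 0
    sum-a : ∑∑ a ≡ D x v
    sum-a = trans (sum-cong-≗ (λ u → sum-if (does (u ≟ v)) (λ w → χ (c v w ∧ x w)))) (sum-point v (λ _ → D x v))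
    sum-b : ∑∑ b ≡ D x v
    sum-b = sum-cong-≗ (λ u → sum-point v (λ _ → χ (c v u ∧ x u)))
    sum-e : ∑∑ e ≡ 1
    sum-e = trans (sum-cong-≗ (λ u → sum-if (does (u ≟ v)) (λ w → if does (w ≟ v) then 1 else 0)))
              (trans (sum-point v (λ _ → sum (λ w → if does (w ≟ v) then 1 else 0))) (sum-point v (λ _ → 1)))
    sum-d : ∑∑ d ≡ K v
    sum-d = trans (sum-cong-≗ (λ u → sum-if (does (u ≟ v)) (λ w → χ (c v w)))) (sum-point v (λ _ → K v))
    term : ∀ u w → cutTerm (x ⊕ v) u w + (a u w + b u w + e u w) ≡ cutTerm x u w + d u w
    term u w with u ≟ v | w ≟ v
    ... | yes refl | yes refl rewrite c-refl u | h = refl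
    ... | yes refl | no _ rewrite h with c u w | x w
    ...   | false | _     = refl
    ...   | true  | false = refl
    ...   | true  | true  = refl
    term u w | no _ | yes refl rewrite h | c-sym w u with c u w | x u
    ...   | false | false = refl
    ...   | false | true  = refl
    ...   | true  | false = refl
    ...   | true  | true  = refl
    term u w | no _ | no _ = refl

  D-⊖ : ∀ x v z → x v ≡ true → c z v ≡ true → D x z ≡ D (x ⊖ v) z + 1
  D-⊖ x v z h zv = begin
    D x z ≡⟨ sum-cong-≗ term ⟩
    sum (λ w → χ (c z w ∧ (x ⊖ v) w) + (if does (w ≟ v) then 1 else 0))
      ≡⟨ ∑-distrib-+ (λ w → χ (c z w ∧ (x ⊖ v) w)) (λ w → if does (w ≟ v) then 1 else 0) ⟩
    D (x ⊖ v) z + sum (λ w → if does (w ≟ v) then 1 else 0) ≡⟨ cong (D (x ⊖ v) z +_) (sum-point v (λ _ → 1)) ⟩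
    D (x ⊖ v) z + 1 ∎
    where
    open ≡-Reasoning
    term : ∀ w → χ (c z w ∧ x w) ≡ χ (c z w ∧ (x ⊖ v) w) + (if does (w ≟ v) then 1 else 0)
    term w with w ≟ v
    ... | yes refl rewrite h | zv = refl
    ... | no _ = sym (+-identityʳ _)

  D-twin : ∀ x {u v} → C u ≡ C v → D x u ≡ D x v
  D-twin x h = sum-cong-≗ λ w → cong (λ S → χ (lookup S w ∧ x w)) h

  K-twin : ∀ {u v} → C u ≡ C v → K u ≡ K v
  K-twin h = sum-cong-≗ λ w → cong (λ S → χ (lookup S w)) h

  swap : (Fin n → Bool) → Fin n → Fin n → Fin n → Bool
  swap x a b = x ⊖ a ⊕ b

  -- Both cuts arise from `x ⊖ a` by adding one vertex, so `F-⊕` applies twice and `F (x ⊖ a)`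
  -- cancels.
  F-swap : ∀ x a b → x a ≡ true → x b ≡ false →
           F x + (D (x ⊖ a) a + D (x ⊖ a) a + K b) ≡ F (swap x a b) + (D (x ⊖ a) b + D (x ⊖ a) b + K a)
  F-swap x a b xa xb = +-cancelʳ-≡ (F y + 1) _ _ (begin
    F x + (p + p + K b) + (F y + 1) ≡⟨ l₁ (F x) p (K b) (F y) ⟩
    (F x + (p + p + 1)) + (F y + K b) ≡⟨ cong₂ _+_ e₁ (sym e₂) ⟩
    (F y + K a) + (F (swap x a b) + (q + q + 1)) ≡⟨ l₂ (F y) (K a) (F (swap x a b)) q ⟩
    F (swap x a b) + (q + q + K a) + (F y + 1) ∎)
    where
    open ≡-Reasoning
    y = x ⊖ a
    p = D y a
    q = D y b
    e₁ : F x + (p + p + 1) ≡ F y + K a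
    e₁ = trans (cong (_+ (p + p + 1)) (F-cong (⊕-⊖ x a xa))) (F-⊕ y a (⊖-self x a))
    e₂ : F (swap x a b) + (q + q + 1) ≡ F y + K b
    e₂ = F-⊕ y b (⊖-false x a b xb)
    l₁ : ∀ f p k g → f + (p + p + k) + (g + 1) ≡ (f + (p + p + 1)) + (g + k)
    l₁ = solve-∀
    l₂ : ∀ g k f q → (g + k) + (f + (q + q + 1)) ≡ f + (q + q + k) + (g + 1)
    l₂ = solve-∀

  IsMax : (Fin n → Bool) → Set
  IsMax x = ∀ y → F y ≤ F x

  -- The weight drops when a vertex of a cut is exchanged for an earlier twin
  -- or for a vertex of a bubble with a smaller code.
  ω : Fin n → ℕ
  ω v = code (C v) * suc n + toℕ v

  -- The strict inequality is essential: it is contradicted by exchanges that leave the cut size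
  -- unchanged, and those are what `prefix` and `swap-tie` produce.
  Stuck : (Fin n → Bool) → Set
  Stuck x = ∀ a b → x a ≡ true → x b ≡ false → ω b < ω a → F (swap x a b) < F x

  max-exists : ∃[ x ] IsMax x
  max-exists = let S , h = maximum (F ∘ lookup) in
    lookup S , λ y → subst (_≤ F (lookup S)) (F-cong (lookup∘tabulate y)) (h (Vec.tabulate y))

  -- A weight-lowering exchange that does not lose leads to another maximum cut, and this cannot be
  -- repeated for ever since the total weight is a natural number.
  stuck-exists : ∃[ x ] IsMax x × Stuck x
  stuck-exists = let x , h = max-exists in go x h (<-wellFounded (weigh ω x))
    where
    go : ∀ x → IsMax x → Acc _<_ (weigh ω x) → ∃[ x ] IsMax x × Stuck x
    go x max (acc rs) with any? (λ a → any? (λ b →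
        (x a Boolₚ.≟ true) ×-dec (x b Boolₚ.≟ false) ×-dec (ω b <? ω a) ×-dec (F x ≤? F (swap x a b))))
    ... | no ¬move = x , max , λ a b xa xb lt → ≰⇒> λ le → ¬move (a , b , xa , xb , lt , le)
    ... | yes (a , b , xa , xb , lt , le) =
      go (swap x a b) (λ y → ≤-trans (max y) le) (rs (begin-strict
        weigh ω (swap x a b)    ≡⟨ weigh-⊕ ω (x ⊖ a) b (⊖-false x a b xb) ⟩
        weigh ω (x ⊖ a) + ω b   <⟨ +-monoʳ-< (weigh ω (x ⊖ a)) lt ⟩
        weigh ω (x ⊖ a) + ω a   ≡⟨ weigh-⊕ ω (x ⊖ a) a (⊖-self x a) ⟨
        weigh ω (x ⊖ a ⊕ a)     ≡⟨ sum-cong-≗ (λ w → cong (λ b → if b then ω w else 0) (⊕-⊖ x a xa w)) ⟨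
        weigh ω x ∎))
      where open ≤-Reasoning

  module Normal {x : Fin n → Bool} (max : IsMax x) (stuck : Stuck x) where

    -- Exchanging twins preserves the cut size, so a selected vertex behind an unselected twin would
    -- allow a forbidden tie.
    prefix : ∀ {u v} → C u ≡ C v → u Fin.< v → x v ≡ true → x u ≡ true
    prefix {u} {v} uv u<v xv with x u in xu
    ... | true  = refl
    ... | false = ⊥-elim (<-irrefl (sym eq) (stuck v u xv xu lt))
      where
      lt : ω u < ω v
      lt = subst (λ S → ω u < code S * suc n + toℕ v) uv (+-monoʳ-< (code (C u) * suc n) u<v)
      eq : F x ≡ F (swap x v u)
      eq = +-cancelʳ-≡ _ _ _ (trans (F-swap x v u xv xu)
             (cong (F (swap x v u) +_) (cong₂ _+_ (cong₂ _+_ (D-twin (x ⊖ v) uv) (D-twin (x ⊖ v) uv)) (sym (K-twin uv)))))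

    private
      -- All four vertices are equal, twins or adjacent across the two bubbles, so removing `a₁` or
      -- `a₂` lowers each of the counts `D` involved by exactly one. Hence the gains of exchanging
      -- `a₁` for `b₂` and `a₂` for `b₁` are opposite numbers. The second is not positive by
      -- maximality, so the first is not negative.
      swap-tie : ∀ {a₁ b₁ a₂ b₂} → C a₁ ≡ C b₁ → C a₂ ≡ C b₂ → x a₁ ≡ true → x b₁ ≡ false →
                 x a₂ ≡ true → x b₂ ≡ false → c a₁ a₂ ≡ true → F x ≤ F (swap x a₁ b₂)
      swap-tie {a₁} {b₁} {a₂} {b₂} e₁ e₂ xa₁ xb₁ xa₂ xb₂ adj =
        +-cancelʳ-≤ (q + q + K a₁) (F x) (F (swap x a₁ b₂))
          (subst (F x + (q + q + K a₁) ≤_) first (+-monoʳ-≤ (F x) le))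
        where
        p = D (x ⊖ a₁) a₁
        q = D (x ⊖ a₁) b₂
        p′ : D (x ⊖ a₂) b₁ ≡ p
        p′ = +-cancelʳ-≡ 1 _ _ (begin
          D (x ⊖ a₂) b₁ + 1 ≡⟨ D-⊖ x a₂ b₁ xa₂ (trans (cong (λ S → lookup S a₂) (sym e₁)) adj) ⟨
          D x b₁            ≡⟨ D-twin x e₁ ⟨
          D x a₁            ≡⟨ D-⊖ x a₁ a₁ xa₁ (c-refl a₁) ⟩
          p + 1             ∎)
          where open ≡-Reasoning
        q′ : D (x ⊖ a₂) a₂ ≡ q
        q′ = +-cancelʳ-≡ 1 _ _ (begin
          D (x ⊖ a₂) a₂ + 1 ≡⟨ D-⊖ x a₂ a₂ xa₂ (c-refl a₂) ⟨
          D x a₂            ≡⟨ D-twin x e₂ ⟩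
          D x b₂            ≡⟨ D-⊖ x a₁ b₂ xa₁ (trans (cong (λ S → lookup S a₁) (sym e₂)) (trans (c-sym a₂ a₁) adj)) ⟩
          q + 1             ∎)
          where open ≡-Reasoning
        first : F x + (p + p + K a₂) ≡ F (swap x a₁ b₂) + (q + q + K a₁)
        first = trans (cong (λ k → F x + (p + p + k)) (K-twin e₂)) (F-swap x a₁ b₂ xa₁ xb₂)
        second : F x + (q + q + K a₁) ≡ F (swap x a₂ b₁) + (p + p + K a₂)
        second = begin
          F x + (q + q + K a₁) ≡⟨ cong₂ (λ q k → F x + (q + q + k)) (sym q′) (K-twin e₁) ⟩
          F x + (D (x ⊖ a₂) a₂ + D (x ⊖ a₂) a₂ + K b₁) ≡⟨ F-swap x a₂ b₁ xa₂ xb₁ ⟩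
          F (swap x a₂ b₁) + (D (x ⊖ a₂) b₁ + D (x ⊖ a₂) b₁ + K a₂)
            ≡⟨ cong (λ p → F (swap x a₂ b₁) + (p + p + K a₂)) p′ ⟩
          F (swap x a₂ b₁) + (p + p + K a₂) ∎
          where open ≡-Reasoning
        le : q + q + K a₁ ≤ p + p + K a₂
        le = +-cancelˡ-≤ (F x) _ _ (subst (_≤ F x + (p + p + K a₂)) (sym second) (+-monoˡ-≤ _ (max (swap x a₂ b₁))))

    -- Indices are below the factor `suc n`, so the code decides before the index does.
    ω-< : ∀ a b {i} → i < code (C a) → code (C b) ≡ i → ω b < ω a
    ω-< a b lt refl = begin-strict
      code (C b) * suc n + toℕ b <⟨ +-monoʳ-< (code (C b) * suc n) (m<n⇒m<1+n (toℕ<n b)) ⟩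
      code (C b) * suc n + suc n ≡⟨ +-comm _ (suc n) ⟩
      suc (code (C b)) * suc n   ≤⟨ *-monoˡ-≤ (suc n) lt ⟩
      code (C a) * suc n         ≤⟨ m≤m+n _ _ ⟩
      ω a ∎
      where open ≤-Reasoning

    -- Moving vertices between two adjacent split bubbles changes the cut
    -- linearly, so for a maximum cut not at all.
    split-nonadjacent : ∀ {a₁ b₁ a₂ b₂} → C a₁ ≡ C b₁ → C a₂ ≡ C b₂ → x a₁ ≡ true → x b₁ ≡ false →
                        x a₂ ≡ true → x b₂ ≡ false → c a₁ a₂ ≡ true → C a₁ ≡ C a₂
    split-nonadjacent {a₁} {b₁} {a₂} {b₂} e₁ e₂ xa₁ xb₁ xa₂ xb₂ adj
      with <-cmp (code (C a₁)) (code (C a₂))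
    ... | tri≈ _ eq _ = code-injective _ _ eq
    ... | tri< lt _ _ = ⊥-elim (<⇒≱ (stuck a₂ b₁ xa₂ xb₁ (ω-< a₂ b₁ lt (cong code (sym e₁))))
                                  (swap-tie e₂ e₁ xa₂ xb₂ xa₁ xb₁ (trans (c-sym a₂ a₁) adj)))
    ... | tri> _ _ gt = ⊥-elim (<⇒≱ (stuck a₁ b₂ xa₁ xb₂ (ω-< a₁ b₂ gt (cong code (sym e₂))))
                                  (swap-tie e₁ e₂ xa₁ xb₁ xa₂ xb₂ adj))

-- Completeness of the candidates

greatest : (p : Fin n → Bool) (v : Fin n) → p v ≡ true →
           ∃[ u ] p u ≡ true × (∀ w → p w ≡ true → w Fin.≤ u)
greatest {suc n} p v h with any? (λ u → p (suc u) Boolₚ.≟ true)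
... | yes (u , pu) = let u′ , pu′ , h′ = greatest (p ∘ suc) u pu in
  suc u′ , pu′ , λ { zero _ → z≤n ; (suc w) pw → s≤s (h′ w pw) }
greatest {suc n} p zero h    | no ¬p = zero , h , λ { zero _ → z≤n ; (suc w) pw → ⊥-elim (¬p (w , pw)) }
greatest {suc n} p (suc v) h | no ¬p = ⊥-elim (¬p (v , h))

smallest : (p : Fin n → Bool) (v : Fin n) → p v ≡ true →
           ∃[ u ] p u ≡ true × (∀ w → p w ≡ true → u Fin.≤ w)
smallest {suc n} p v h with p zero in eq
smallest {suc n} p v h | true = zero , eq , λ _ _ → z≤n
smallest {suc n} p zero h | false = ⊥-elim (true≢false h eq)
smallest {suc n} p (suc v) h | false = let u , pu , h′ = smallest (p ∘ suc) v h in
  suc u , pu , λ { zero pw → ⊥-elim (true≢false pw eq) ; (suc w) pw → s≤s (h′ w pw) }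

module Coverage {n : ℕ} (G : Graph n) where
  open Specification G
  open Cuts G
  open Exchange G

  class-intro : ∀ {u v} → C v ≡ C u → lookup (class-of u) v ≡ true
  class-intro {u} {v} h =
    trans (lookup∘tabulate _ v) (trans (cong (λ S → same S (C u)) h) (same-refl (C u)))

  class-elim : ∀ {u v} → lookup (class-of u) v ≡ true → C v ≡ C u
  class-elim {u} {v} h = same-elim _ _ (trans (sym (lookup∘tabulate _ v)) h)

  initial-intro : ∀ {u v} → C v ≡ C u → v Fin.≤ u → lookup (initial u) v ≡ true
  initial-intro {u} {v} h le =
    trans (lookup-∩ (class-of u) (upTo ⁅ u ⁆) v)
      (∧-intro (class-intro h) (Equivalence.from (lookup-upTo u v) le))

  initial-elim : ∀ {u v} → lookup (initial u) v ≡ true → C v ≡ C u × v Fin.≤ u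
  initial-elim {u} {v} h with ∧-true (trans (sym (lookup-∩ (class-of u) (upTo ⁅ u ⁆) v)) h)
  ... | p , q = class-elim p , Equivalence.to (lookup-upTo u v) q

  ⁅⁆-elim : ∀ {u v : Fin n} → lookup ⁅ u ⁆ v ≡ true → u ≡ v
  ⁅⁆-elim {u} {v} h with u ≟ v | lookup-⁅⁆ u v
  ... | yes eq | _  = eq
  ... | no _   | eq = ⊥-elim (true≢false h eq)

  least-intro : ∀ {u} → (∀ v → C v ≡ C u → u Fin.≤ v) → least u ≡ true
  least-intro {u} h =
    trans (cong (λ S → same S ⁅ u ⁆) (subset-ext {S = initial u} {⁅ u ⁆} λ v → ⇔→≡ (to v) (from v)))
          (same-refl ⁅ u ⁆)
    where
    to : ∀ v → lookup (initial u) v ≡ true → lookup ⁅ u ⁆ v ≡ true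
    to v p with initial-elim p
    ... | q , le = trans (lookup-⁅⁆ u v) (dec-true (u ≟ v) (toℕ-injective (≤-antisym (h v q) le)))
    from : ∀ v → lookup ⁅ u ⁆ v ≡ true → lookup (initial u) v ≡ true
    from v p with ⁅⁆-elim {u} {v} p
    ... | refl = initial-intro refl ≤-refl

  least-elim : ∀ {u v} → least u ≡ true → C v ≡ C u → u Fin.≤ v
  least-elim {u} {v} h eq = ≮⇒≥ λ lt → <-irrefl (cong toℕ (sym (u≡v (<⇒≤ lt)))) lt
    where
    u≡v : v Fin.≤ u → u ≡ v
    u≡v le = ⁅⁆-elim (subst (λ S → lookup S v ≡ true) (same-elim (initial u) ⁅ u ⁆ h) (initial-intro eq le))

  expand-old : ∀ {c D S L} → S ∈ L → S ∈ expand c D L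
  expand-old {c} {L = R ∷ L} (here refl) with c R
  ... | false = here refl
  ... | true  = here refl
  expand-old {c} {L = R ∷ L} (there p) with c R
  ... | false = there (there (expand-old p))
  ... | true  = there (expand-old p)

  expand-new : ∀ {c D S L} → S ∈ L → c S ≡ false → S ∪ D ∈ expand c D L
  expand-new {c} {L = R ∷ L} (here refl) h with c R
  ... | false = there (here refl)
  expand-new {c} {L = R ∷ L} (there p) h with c R
  ... | false = there (there (expand-new p h))
  ... | true  = there (expand-new p h)

  expand-all : {P : Subset n → Set} → ∀ c D L → (∀ S → P S → P (S ∪ D)) → All P L → All P (expand c D L)
  expand-all c D []      h []       = []
  expand-all c D (S ∷ L) h (p ∷ ps) with c S
  ... | false = p ∷ h S p ∷ expand-all c D L h ps
  ... | true  = p ∷ expand-all c D L h ps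

  steps-all : {P : Subset n → Set} → ∀ f → (∀ u L → All P L → All P (f u L)) →
              ∀ us L → All P L → All P (steps f us L)
  steps-all f h []       L p = p
  steps-all f h (u ∷ us) L p = steps-all f h us (f u L) (h u L p)

  ∪-elim : ∀ (S D : Subset n) w → lookup (S ∪ D) w ≡ true → lookup S w ≡ true ⊎ lookup D w ≡ true
  ∪-elim S D w h with lookup S w in eq
  ... | true  = inj₁ refl
  ... | false = inj₂ (∨-true _ (trans (sym (lookup-∪ S D w)) h) eq)

  ∪-left : ∀ (S D : Subset n) w → lookup S w ≡ true → lookup (S ∪ D) w ≡ true
  ∪-left S D w h = trans (lookup-∪ S D w) (cong (_∨ lookup D w) h)

  ∪-right : ∀ (S D : Subset n) w → lookup D w ≡ true → lookup (S ∪ D) w ≡ true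
  ∪-right S D w h = trans (lookup-∪ S D w) (trans (cong (lookup S w ∨_) h) (Boolₚ.∨-zeroʳ _))

  ClosedUnderTwins : Subset n → Set
  ClosedUnderTwins A = ∀ {u v} → C u ≡ C v → lookup A u ≡ true → lookup A v ≡ true

  module _ (A : Subset n) (closed : ClosedUnderTwins A) where

    private
      Within : Subset n → Set
      Within S = ∀ w → lookup S w ≡ true → lookup A w ≡ true

      within-∪ : ∀ {u D} → lookup A u ≡ true → (∀ w → lookup D w ≡ true → C w ≡ C u) →
                 ∀ S → Within S → Within (S ∪ D)
      within-∪ {u} {D} Au h S hS w p with ∪-elim S D w p
      ... | inj₁ q = hS w q
      ... | inj₂ q = closed (sym (h w q)) Au

    candidates-within : ∀ {S} → S ∈ candidates A → ∀ w → lookup S w ≡ true → lookup A w ≡ true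
    candidates-within = All.lookup
      (steps-all (fullStep A) full (allFin n) _ (steps-all (splitStep A) split (allFin n) _
        ((λ w p → ⊥-elim (true≢false p (lookup-∅ w))) ∷ [])))
      where
      split : ∀ u L → All Within L → All Within (splitStep A u L)
      split u L h rewrite meets-⁅⁆ u A with lookup A u in Au
      ... | false = h
      ... | true  = expand-all _ _ L (within-∪ Au (λ w → proj₁ ∘ initial-elim)) h
      full : ∀ u L → All Within L → All Within (fullStep A u L)
      full u L h rewrite meets-⁅⁆ u A with lookup A u in Au
      ... | false = h
      ... | true with least u
      ...   | false = h
      ...   | true  = expand-all _ _ L (within-∪ Au (λ w → class-elim)) h

    module _ {x : Fin n → Bool} (max : IsMax x) (stuck : Stuck x) where
      open Normal max stuck

      private
        -- A threshold determines x on its bubble, which is split by x; a full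
        -- vertex represents a bubble contained in x.
        Threshold Full : Fin n → Set
        Threshold u = x u ≡ true × lookup A u ≡ true × (∀ w → C w ≡ C u → x w ≡ true → w Fin.≤ u) ×
                      ∃[ w ] C w ≡ C u × x w ≡ false
        Full r = lookup A r ≡ true × least r ≡ true × (∀ w → C w ≡ C r → x w ≡ true)

        C? : ∀ u v → Dec (C u ≡ C v)
        C? u v = ≡-dec Boolₚ._≟_ (C u) (C v)

        threshold? : ∀ u → Dec (Threshold u)
        threshold? u = (x u Boolₚ.≟ true) ×-dec (lookup A u Boolₚ.≟ true) ×-dec
          all? (λ w → C? w u →-dec ((x w Boolₚ.≟ true) →-dec (w Finₚ.≤? u))) ×-dec
          any? (λ w → C? w u ×-dec (x w Boolₚ.≟ false))

        full? : ∀ u → Dec (Full u)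
        full? u = (lookup A u Boolₚ.≟ true) ×-dec (least u Boolₚ.≟ true) ×-dec
          all? (λ w → C? w u →-dec (x w Boolₚ.≟ true))

        splitStep-old : ∀ {u S L} → S ∈ L → S ∈ splitStep A u L
        splitStep-old {u} p with meets ⁅ u ⁆ A
        ... | false = p
        ... | true  = expand-old p

        fullStep-old : ∀ {u S L} → S ∈ L → S ∈ fullStep A u L
        fullStep-old {u} p with meets ⁅ u ⁆ A ∧ least u
        ... | false = p
        ... | true  = expand-old p

        Below : Fin n → Fin n → Set
        Below w u = C w ≡ C u × w Fin.≤ u

        -- Two adjacent split bubbles coincide by `split-nonadjacent`, and a bubble has only one
        -- last selected vertex.
        same-threshold : ∀ {u u′} → Threshold u → Threshold u′ → c u′ u ≡ true → u′ ≡ u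
        same-threshold (xu , _ , hu , b , eb , xb) (xu′ , _ , hu′ , b′ , eb′ , xb′) adj =
          let eq = split-nonadjacent (sym eb′) (sym eb) xu′ xb′ xu xb adj
          in toℕ-injective (≤-antisym (hu _ eq xu′) (hu′ _ (sym eq) xu))

        -- Follows the branch that accepts exactly the thresholds of `x`. The hypothesis on `S` says
        -- that it consists of segments below thresholds already passed; recording that these are
        -- not in `us` is what rules out meeting the next one.
        splits-cover : ∀ us → Unique us → ∀ L S → S ∈ L →
          (∀ w → lookup S w ≡ true → ∃[ u ] Threshold u × u ∉ us × Below w u) →
          ∃[ S′ ] S′ ∈ steps (splitStep A) us L × (∀ w → lookup S w ≡ true → lookup S′ w ≡ true) ×
            (∀ {u} → u ∈ us → Threshold u → ∀ w → Below w u → lookup S′ w ≡ true) ×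
            (∀ w → lookup S′ w ≡ true → ∃[ u ] Threshold u × Below w u)
        splits-cover [] _ L S p inv =
          S , p , (λ w h → h) , (λ ()) , λ w h → let u , t , _ , b = inv w h in u , t , b
        splits-cover (u ∷ us) (u∉ ∷ uniq) L S p inv with threshold? u
        ... | no ¬t =
          let S′ , q , old , new , inv′ = splits-cover us uniq (splitStep A u L) S (splitStep-old p)
                (λ w h → let u′ , t , ∉ , b = inv w h in u′ , t , ∉ ∘ there , b)
          in S′ , q , old , (λ { (here refl) t → ⊥-elim (¬t t) ; (there i) → new i }) , inv′
        ... | yes t@(xu , Au , _) =
          let S′ , q , old , new , inv′ = splits-cover us uniq (splitStep A u L) (S ∪ initial u) member inv₁
          in S′ , q , (λ w h → old w (∪-left S (initial u) w h)) ,
             (λ { (here refl) t w (e , le) → old w (∪-right S (initial u) w (initial-intro e le)) ; (there i) → new i }) ,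
             inv′
          where
          -- A vertex of `S` in the closed neighbourhood of `u` is a twin of, or equal to, an
          -- earlier threshold `u′`, which is then adjacent or equal to `u`. By `same-threshold` it
          -- is `u`, whose turn has only come now.
          free : meets (C u) S ≡ false
          free with meets (C u) S in eq
          ... | false = refl
          ... | true =
            let w , uw , Sw = meets-elim (C u) S eq
                u′ , t′ , ∉ , (e , _) = inv w Sw
                adj = subst (λ S → lookup S u ≡ true) e (trans (c-sym w u) uw)
            in ⊥-elim (∉ (here (same-threshold t t′ adj)))
          member : S ∪ initial u ∈ splitStep A u L
          member rewrite trans (meets-⁅⁆ u A) Au = expand-new p free
          inv₁ : ∀ w → lookup (S ∪ initial u) w ≡ true → ∃[ u ] Threshold u × u ∉ us × Below w u
          inv₁ w h with ∪-elim S (initial u) w h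
          ... | inj₁ h = let u′ , t , ∉ , b = inv w h in u′ , t , ∉ ∘ there , b
          ... | inj₂ h = u , t , (λ i → All.lookup u∉ i refl) , initial-elim h

        Inside : Fin n → Set
        Inside w = lookup A w ≡ true × x w ≡ true

        fulls-cover : ∀ us L S → S ∈ L → (∀ w → lookup S w ≡ true → Inside w) →
          ∃[ S′ ] S′ ∈ steps (fullStep A) us L × (∀ w → lookup S w ≡ true → lookup S′ w ≡ true) ×
            (∀ {u} → u ∈ us → Full u → ∀ w → C w ≡ C u → lookup S′ w ≡ true) ×
            (∀ w → lookup S′ w ≡ true → Inside w)
        fulls-cover [] L S p inv = S , p , (λ w h → h) , (λ ()) , inv
        fulls-cover (u ∷ us) L S p inv with full? u
        ... | no ¬t =
          let S′ , q , old , new , inv′ = fulls-cover us (fullStep A u L) S (fullStep-old p) inv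
          in S′ , q , old , (λ { (here refl) t → ⊥-elim (¬t t) ; (there i) → new i }) , inv′
        ... | yes (Au , lu , xs) =
          let S′ , q , old , new , inv′ = fulls-cover us (fullStep A u L) (S ∪ class-of u) member inv₁
          in S′ , q , (λ w h → old w (∪-left S (class-of u) w h)) ,
             (λ { (here refl) t w e → old w (∪-right S (class-of u) w (class-intro e)) ; (there i) → new i }) ,
             inv′
          where
          member : S ∪ class-of u ∈ fullStep A u L
          member rewrite trans (meets-⁅⁆ u A) Au | lu = expand-new p refl
          inv₁ : ∀ w → lookup (S ∪ class-of u) w ≡ true → Inside w
          inv₁ w h with ∪-elim S (class-of u) w h
          ... | inj₁ h = inv w h
          ... | inj₂ h = let e = class-elim h in closed (sym e) Au , xs w e

      -- A bubble that contains a selected vertex is either wholly selected, and enters through its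
      -- least vertex in a full step, or split, and enters through its greatest selected vertex in a
      -- split step.
      candidates-cover : ∃[ S ] S ∈ candidates A × (∀ w → lookup S w ≡ lookup A w ∧ x w)
      candidates-cover with splits-cover (allFin n) (allFin⁺ n) (∅ ∷ []) ∅ (here refl)
                              (λ w h → ⊥-elim (true≢false h (lookup-∅ w)))
      ... | S₁ , p₁ , _ , new₁ , inv₁ with fulls-cover (allFin n) _ S₁ p₁ within
        where
        within : ∀ w → lookup S₁ w ≡ true → Inside w
        within w h with inv₁ w h
        ... | u , (xu , Au , _) , e , le with m≤n⇒m<n∨m≡n le
        ...   | inj₁ lt = closed (sym e) Au , prefix e lt xu
        ...   | inj₂ eq with toℕ-injective eq
        ...     | refl = Au , xu
      ... | S , p , old , new , inv = S , p , λ w → ⇔→≡ (λ h → let a , b = inv w h in ∧-intro a b) (from w)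
        where
        from : ∀ w → lookup A w ∧ x w ≡ true → lookup S w ≡ true
        from w h with ∧-true h
        ... | Aw , xw with any? (λ v → C? v w ×-dec (x v Boolₚ.≟ false))
        ...   | no whole = new (∈-allFin r) (closed (sym er) Aw , least-intro least-r , full-r) w (sym er)
          where
          lo = smallest (λ v → same (C v) (C w)) w (same-refl (C w))
          r = proj₁ lo
          er : C r ≡ C w
          er = same-elim _ _ (proj₁ (proj₂ lo))
          least-r : ∀ v → C v ≡ C r → r Fin.≤ v
          least-r v e = proj₂ (proj₂ lo) v (trans (cong (λ S → same S (C w)) (trans e er)) (same-refl (C w)))
          full-r : ∀ v → C v ≡ C r → x v ≡ true
          full-r v e with x v in xv
          ... | true  = refl
          ... | false = ⊥-elim (whole (v , trans e er , xv))
        ...   | yes (b , eb , xb) =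
          old w (new₁ (∈-allFin u) (xu , closed (sym eu) Aw , maximal , b , trans eb (sym eu) , xb) w
                   (sym eu , proj₂ (proj₂ hi) w (∧-intro xw (same-refl (C w)))))
          where
          hi = greatest (λ v → x v ∧ same (C v) (C w)) w (∧-intro xw (same-refl (C w)))
          u = proj₁ hi
          xu = proj₁ (∧-true (proj₁ (proj₂ hi)))
          eu : C u ≡ C w
          eu = same-elim _ _ (proj₂ (∧-true {x u} (proj₁ (proj₂ hi))))
          maximal : ∀ v → C v ≡ C u → x v ≡ true → v Fin.≤ u
          maximal v e xv = proj₂ (proj₂ hi) v
            (∧-intro xv (trans (cong (λ S → same S (C w)) (trans e eu)) (same-refl (C w))))

-- Counting the candidates

lookup-─ : (p q : Subset n) (w : Fin n) → lookup (p ─ q) w ≡ lookup p w ∧ not (lookup q w)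
lookup-─ (x ∷ p) (true  ∷ q) zero    = sym (Boolₚ.∧-zeroʳ x)
lookup-─ (x ∷ p) (false ∷ q) zero    = sym (Boolₚ.∧-identityʳ x)
lookup-─ (x ∷ p) (true  ∷ q) (suc w) = lookup-─ p q w
lookup-─ (x ∷ p) (false ∷ q) (suc w) = lookup-─ p q w

∈-allSubsets : (S : Subset n) → S ∈ allSubsets n
∈-allSubsets []          = here refl
∈-allSubsets (false ∷ S) = ∈-++⁺ˡ (∈-map⁺ (false ∷_) (∈-allSubsets S))
∈-allSubsets {suc n} (true ∷ S) = ∈-++⁺ʳ (List.map (false ∷_) (allSubsets n)) (∈-map⁺ (true ∷_) (∈-allSubsets S))

≤-max : {xs : List ℕ} {i : ℕ} → i ∈ xs → i ≤ max 0 xs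
≤-max {xs} p = All.lookup (xs≤max 0 xs) p

injection-length : {Y : Set} (f : X → Y) (xs : List X) (ys : List Y) → Unique xs →
           (∀ {x} → x ∈ xs → f x ∈ ys) →
           (∀ {x x′} → x ∈ xs → x′ ∈ xs → f x ≡ f x′ → x ≡ x′) → length xs ≤ length ys
injection-length f xs ys uniq into inj = injective⇒≤ {f = g} g-injective
  where
  g : Fin (length xs) → Fin (length ys)
  g i = Any.index (into (∈-lookup i))
  lookup-injective : ∀ {xs : List X} → Unique xs → ∀ i j → List.lookup xs i ≡ List.lookup xs j → i ≡ j
  lookup-injective (p ∷ u) zero    zero    e = refl
  lookup-injective (p ∷ u) (suc i) (suc j) e = cong suc (lookup-injective u i j e)
  lookup-injective (p ∷ u) zero    (suc j) e = ⊥-elim (All.lookup p (∈-lookup j) e)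
  lookup-injective (p ∷ u) (suc i) zero    e = ⊥-elim (All.lookup p (∈-lookup i) (sym e))
  g-injective : ∀ {i j} → g i ≡ g j → i ≡ j
  g-injective {i} {j} e = lookup-injective uniq i j (inj (∈-lookup i) (∈-lookup j)
    (trans (lookup-index (into (∈-lookup i))) (trans (cong (List.lookup ys) e) (sym (lookup-index (into (∈-lookup j)))))))

module Counting {n : ℕ} (G : Graph n) where
  open Specification G
  open Cuts G
  open Coverage G

  twins⇒C : ∀ {u v} → Twins G u v → C u ≡ C v
  twins⇒C {u} {v} (adj , eq) = subset-ext λ w → term w
    where
    u≢v : u ≢ v
    u≢v refl = Graph.irreflexive G adj
    uv : c u v ≡ true
    uv = trans (c-edge u≢v) (T⇒true adj)
    term : ∀ w → c u w ≡ c v w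
    term w with w ≟ u | w ≟ v
    ... | yes refl | _ = trans (c-refl u) (sym (trans (c-sym v u) uv))
    ... | no _ | yes refl = trans uv (sym (c-refl v))
    ... | no w≢u | no w≢v = begin
      c u w                  ≡⟨ c-edge (w≢u ∘ sym) ⟩
      Graph.edge G u w       ≡⟨ minus u v w w≢v ⟨
      lookup (N G u - v) w   ≡⟨ cong (λ S → lookup S w) eq ⟩
      lookup (N G v - u) w   ≡⟨ minus v u w w≢u ⟩
      Graph.edge G v w       ≡⟨ c-edge (w≢v ∘ sym) ⟨
      c v w                  ∎
      where
      open ≡-Reasoning
      minus : ∀ u v w → w ≢ v → lookup (N G u - v) w ≡ Graph.edge G u w
      minus u v w w≢v
        rewrite lookup-─ (N G u) ⁅ v ⁆ w | lookup-⁅⁆ v w | dec-false (v ≟ w) (w≢v ∘ sym)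
              | lookup∘tabulate (Graph.edge G u) w = Boolₚ.∧-identityʳ _

  C⇒twins : ∀ {u v} → u ≢ v → C u ≡ C v → Twins G u v
  C⇒twins {u} {v} u≢v eq = true⇒T (trans (sym (c-edge u≢v)) uv) , subset-ext term
    where
    uv : c u v ≡ true
    uv = trans (cong (λ S → lookup S v) eq) (c-refl v)
    minus : ∀ u v w → lookup (N G u - v) w ≡ Graph.edge G u w ∧ not (does (v ≟ w))
    minus u v w rewrite lookup-─ (N G u) ⁅ v ⁆ w | lookup-⁅⁆ v w | lookup∘tabulate (Graph.edge G u) w = refl
    loop : ∀ w → Graph.edge G w w ≡ false
    loop w with Graph.edge G w w in e
    ... | false = refl
    ... | true  = ⊥-elim (Graph.irreflexive G (true⇒T e))
    term : ∀ w → lookup (N G u - v) w ≡ lookup (N G v - u) w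
    term w rewrite minus u v w | minus v u w with u ≟ w | v ≟ w
    ... | yes refl | yes refl = refl
    ... | yes refl | no _ rewrite loop w = sym (Boolₚ.∧-zeroʳ _)
    ... | no _ | yes refl rewrite loop w = Boolₚ.∧-zeroʳ _
    ... | no u≢w | no v≢w = cong (_∧ true) (trans (sym (c-edge u≢w)) (trans (cong (λ S → lookup S w) eq) (c-edge v≢w)))

  pairwise-intro : ∀ B u → (∀ w → w ∈ˢ B → C w ≡ C u) → PairwiseTwins G B
  pairwise-intro B u h v v∈ w w∈ v≢w = C⇒twins v≢w (trans (h v v∈) (sym (h w w∈)))

  pairwise-elim : ∀ {B u w} → PairwiseTwins G B → u ∈ˢ B → w ∈ˢ B → C w ≡ C u
  pairwise-elim {B} {u} {w} h u∈ w∈ with w ≟ u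
  ... | yes refl = refl
  ... | no w≢u   = twins⇒C (h w w∈ u u∈ w≢u)

  class-bubble : ∀ u → IsBubble G (class-of u)
  class-bubble u =
    pairwise-intro (class-of u) u (λ w w∈ → class-elim ([]=⇒lookup w∈)) ,
    λ B′ h sub {w} w∈ → lookup⇒[]= w _ (class-intro (pairwise-elim h (sub (lookup⇒[]= u _ (class-intro refl))) w∈))

  -- The class of `u` is itself pairwise twin and contains the bubble, so maximality makes the
  -- bubble absorb it.
  bubble-closed : ∀ {B u v} → IsBubble G B → C u ≡ C v → u ∈ˢ B → v ∈ˢ B
  bubble-closed {B} {u} {v} (h , maximal) eq u∈ =
    maximal (class-of u)
      (pairwise-intro (class-of u) u (λ w w∈ → class-elim ([]=⇒lookup w∈)))
      (λ {w} w∈ → lookup⇒[]= w _ (class-intro (pairwise-elim h u∈ w∈)))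
      (lookup⇒[]= v _ (class-intro (sym eq)))

  union-closed : ∀ {Bs} → All (IsBubble G) Bs → ∀ {u v} → C u ≡ C v → u ∈ˢ ⋃ Bs → v ∈ˢ ⋃ Bs
  union-closed {[]}     []       {u} eq u∈ = ⊥-elim (true≢false ([]=⇒lookup u∈) (lookup-∅ u))
  union-closed {B ∷ Bs} (b ∷ bs) eq u∈ with x∈p∪q⁻ B (⋃ Bs) u∈
  ... | inj₁ p = x∈p∪q⁺ (inj₁ (bubble-closed b eq p))
  ... | inj₂ p = x∈p∪q⁺ (inj₂ (union-closed bs eq p))

  expand-++ : ∀ c D L L′ → expand c D (L ++ L′) ≡ expand c D L ++ expand c D L′
  expand-++ c D []      L′ = refl
  expand-++ c D (S ∷ L) L′ with c S
  ... | false = cong (λ R → S ∷ S ∪ D ∷ R) (expand-++ c D L L′)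
  ... | true  = cong (S ∷_) (expand-++ c D L L′)

  expand-length : ∀ c D L → length L ≤ length (expand c D L)
  expand-length c D []      = z≤n
  expand-length c D (S ∷ L) with c S
  ... | false = s≤s (m≤n⇒m≤1+n (expand-length c D L))
  ... | true  = s≤s (expand-length c D L)

  -- Lists never shrink, so a bound on the final list bounds every intermediate one; the assertions
  -- inside the loops are discharged this way.
  steps-length : ∀ f → (∀ u L → length L ≤ length (f u L)) → ∀ us L → length L ≤ length (steps f us L)
  steps-length f h []       L = ≤-refl
  steps-length f h (u ∷ us) L = ≤-trans (h u L) (steps-length f h us (f u L))

  splitStep-length : ∀ A u L → length L ≤ length (splitStep A u L)
  splitStep-length A u L with meets ⁅ u ⁆ A
  ... | false = ≤-refl
  ... | true  = expand-length _ _ L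

  fullStep-length : ∀ A u L → length L ≤ length (fullStep A u L)
  fullStep-length A u L with meets ⁅ u ⁆ A ∧ least u
  ... | false = ≤-refl
  ... | true  = expand-length _ _ L

  splitStep-++ : ∀ A u L L′ → splitStep A u (L ++ L′) ≡ splitStep A u L ++ splitStep A u L′
  splitStep-++ A u L L′ with meets ⁅ u ⁆ A
  ... | false = refl
  ... | true  = expand-++ _ _ L L′

  -- Each candidate evolves independently of the others, so the descendants of a branching can be
  -- counted branch by branch.
  splits-++ : ∀ A us L L′ → steps (splitStep A) us (L ++ L′) ≡ steps (splitStep A) us L ++ steps (splitStep A) us L′
  splits-++ A []       L L′ = refl
  splits-++ A (u ∷ us) L L′ rewrite splitStep-++ A u L L′ = splits-++ A us (splitStep A u L) (splitStep A u L′)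

  module _ (A : Subset n) where
    independent-≤ : ∀ I → Independent G I → (∀ w → lookup I w ≡ true → lookup A w ≡ true) → ∣ I ∣ ≤ αInduced G A
    independent-≤ I ind sub = ≤-max (∈-map⁺ ∣_∣
      (∈-filter⁺ (λ S → (S ⊆? A) ×-dec independent? G S) (∈-allSubsets I)
        ((λ {w} w∈ → lookup⇒[]= w A (sub w ([]=⇒lookup w∈))) , ind)))

    private
      -- `I` stands for the last vertices chosen so far, and `b` for the number of further choices
      -- that the independence number still allows.
      Budget : Subset n → ℕ → Set
      Budget S b = ∃[ I ] Independent G I × (∀ w → lookup I w ≡ true → lookup A w ≡ true) ×
                   (∀ w → lookup I w ≡ true → lookup S w ≡ true) × αInduced G A ≤ ∣ I ∣ + b

      -- Since `C u` misses `S`, and so `I`, the set `I ∪ ⁅ u ⁆` is independent and strictly larger.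
      -- With no budget left it would exceed the independence number.
      spend : ∀ {S b u} → lookup A u ≡ true → meets (C u) S ≡ false → Budget S b →
              ∃[ b′ ] b ≡ suc b′ × Budget (S ∪ initial u) b′
      spend {S} {b} {u} Au free (I , ind , sub , subS , le) = result le
        where
        outside-I : lookup I u ≡ false
        outside-I with lookup I u in e
        ... | false = refl
        ... | true  = ⊥-elim (true≢false (meets-intro (C u) S u (c-refl u) (subS u e)) free)
        apart : ∀ w → lookup I w ≡ true → ¬ Adj G u w
        apart w Iw adj = true≢false
          (meets-intro (C u) S w (trans (c-edge (λ { refl → Graph.irreflexive G adj })) (T⇒true adj)) (subS w Iw)) free
        ind′ : Independent G (I ∪ ⁅ u ⁆)
        ind′ v v∈ w w∈ adj with ∪-elim I ⁅ u ⁆ v ([]=⇒lookup v∈) | ∪-elim I ⁅ u ⁆ w ([]=⇒lookup w∈)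
        ... | inj₁ p | inj₁ q = ind v (lookup⇒[]= v I p) w (lookup⇒[]= w I q) adj
        ... | inj₁ p | inj₂ q with ⁅⁆-elim {u} {w} q
        ...   | refl = apart v p (Graph.symmetric G adj)
        ind′ v v∈ w w∈ adj | inj₂ p | inj₁ q with ⁅⁆-elim {u} {v} p
        ...   | refl = apart w q adj
        ind′ v v∈ w w∈ adj | inj₂ p | inj₂ q with ⁅⁆-elim {u} {v} p | ⁅⁆-elim {u} {w} q
        ...   | refl | refl = Graph.irreflexive G adj
        sub′ : ∀ w → lookup (I ∪ ⁅ u ⁆) w ≡ true → lookup A w ≡ true
        sub′ w h with ∪-elim I ⁅ u ⁆ w h
        ... | inj₁ p = sub w p
        ... | inj₂ p with ⁅⁆-elim {u} {w} p
        ...   | refl = Au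
        subS′ : ∀ w → lookup (I ∪ ⁅ u ⁆) w ≡ true → lookup (S ∪ initial u) w ≡ true
        subS′ w h with ∪-elim I ⁅ u ⁆ w h
        ... | inj₁ p = ∪-left S (initial u) w (subS w p)
        ... | inj₂ p with ⁅⁆-elim {u} {w} p
        ...   | refl = ∪-right S (initial u) u (initial-intro {u} {u} refl ≤-refl)
        larger : ∣ I ∣ < ∣ I ∪ ⁅ u ⁆ ∣
        larger = p⊂q⇒∣p∣<∣q∣ {p = I} {q = I ∪ ⁅ u ⁆} ((λ p → x∈p∪q⁺ (inj₁ p)) , u ,
          lookup⇒[]= u _ (∪-right I ⁅ u ⁆ u (trans (lookup-⁅⁆ u u) (dec-true (u ≟ u) refl))) ,
          λ p → true≢false ([]=⇒lookup p) outside-I)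
        result : ∀ {b} → αInduced G A ≤ ∣ I ∣ + b → ∃[ b′ ] b ≡ suc b′ × Budget (S ∪ initial u) b′
        result {zero} le = ⊥-elim (<-irrefl refl (≤-trans (≤-trans larger (independent-≤ (I ∪ ⁅ u ⁆) ind′ sub′))
                                                   (subst (αInduced G A ≤_) (+-identityʳ ∣ I ∣) le)))
        result {suc b} le = b , refl , I ∪ ⁅ u ⁆ , ind′ , sub′ , subS′ ,
          ≤-trans le (≤-trans (≤-reflexive (+-suc ∣ I ∣ b)) (+-monoˡ-≤ b larger))

      -- Rejecting `u` keeps the budget and accepting it costs one unit. With `l = suc (length us)`
      -- the two branches give at most `l ^ b + l ^ (b - 1) = suc l * l ^ (b -
      -- 1)`, which is at most `suc l ^ b`.
      splits-count : ∀ us S b → Budget S b → length (steps (splitStep A) us (S ∷ [])) ≤ suc (length us) ^ b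
      splits-count [] S b B = ≤-reflexive (sym (^-zeroˡ b))
      splits-count (u ∷ us) S b B rewrite meets-⁅⁆ u A with lookup A u in Au
      ... | false = ≤-trans (splits-count us S b B) (^-monoˡ-≤ b (n≤1+n _))
      ... | true with meets (C u) S in free
      ...   | true = ≤-trans (splits-count us S b B) (^-monoˡ-≤ b (n≤1+n _))
      ...   | false with spend Au free B
      ...     | b′ , refl , B′ = begin
        length (steps (splitStep A) us (S ∷ S ∪ initial u ∷ []))
          ≡⟨ cong length (splits-++ A us (S ∷ []) (S ∪ initial u ∷ [])) ⟩
        length (steps (splitStep A) us (S ∷ []) ++ steps (splitStep A) us (S ∪ initial u ∷ []))
          ≡⟨ length-++ (steps (splitStep A) us (S ∷ [])) ⟩
        length (steps (splitStep A) us (S ∷ [])) + length (steps (splitStep A) us (S ∪ initial u ∷ []))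
          ≤⟨ +-mono-≤ (splits-count us S b B) (splits-count us (S ∪ initial u) b′ B′) ⟩
        l ^ suc b′ + l ^ b′ ≡⟨ +-comm (l ^ suc b′) (l ^ b′) ⟩
        suc l * l ^ b′      ≤⟨ *-monoʳ-≤ (suc l) (^-monoˡ-≤ b′ (n≤1+n l)) ⟩
        suc l ^ suc b′ ∎
        where
        open ≤-Reasoning
        l = suc (length us)

    splits-length : length (steps (splitStep A) (allFin n) (∅ ∷ [])) ≤ suc n ^ αInduced G A
    splits-length = subst (λ m → length (steps (splitStep A) (allFin n) (∅ ∷ [])) ≤ suc m ^ αInduced G A)
      (length-tabulate {n = n} id)
      (splits-count (allFin n) ∅ (αInduced G A)
        (∅ , (λ u u∈ → ⊥-elim (true≢false ([]=⇒lookup u∈) (lookup-∅ u))) ,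
         (λ w h → ⊥-elim (true≢false h (lookup-∅ w))) , (λ w h → h) , m≤n+m _ ∣ ∅ {n} ∣))

    leasts : List (Fin n) → List (Fin n)
    leasts = filter (λ u → (lookup A u Boolₚ.≟ true) ×-dec (least u Boolₚ.≟ true))

    doubled : ∀ D L → length (expand (const false) D L) ≡ length L * 2
    doubled D []      = refl
    doubled D (S ∷ L) = cong (2 +_) (doubled D L)

    fulls-count : ∀ us L → length (steps (fullStep A) us L) ≡ length L * 2 ^ length (leasts us)
    fulls-count []       L = sym (*-identityʳ (length L))
    fulls-count (u ∷ us) L rewrite meets-⁅⁆ u A with lookup A u
    ... | false = fulls-count us L
    ... | true with least u
    ...   | false = fulls-count us L
    ...   | true  = begin
      length (steps (fullStep A) us (expand (const false) (class-of u) L))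
        ≡⟨ fulls-count us (expand (const false) (class-of u) L) ⟩
      length (expand (const false) (class-of u) L) * 2 ^ r ≡⟨ cong (_* 2 ^ r) (doubled (class-of u) L) ⟩
      length L * 2 * 2 ^ r ≡⟨ *-assoc (length L) 2 (2 ^ r) ⟩
      length L * 2 ^ suc r ∎
      where
      open ≡-Reasoning
      r = length (leasts us)

    -- Sending a least vertex to its class is injective, because a class has only one least vertex;
    -- closure of `A` keeps the class inside `A`.
    leasts-bubbles : ClosedUnderTwins A →
      length (leasts (allFin n)) ≤ length (filter (λ B → isBubble? G B ×-dec (B ⊆? A)) (allSubsets n))
    leasts-bubbles closed = injection-length class-of (leasts (allFin n)) _ (filter⁺ P? (allFin⁺ n))
      (λ {u} p → ∈-filter⁺ (λ B → isBubble? G B ×-dec (B ⊆? A)) (∈-allSubsets (class-of u))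
        (class-bubble u , λ {w} w∈ → lookup⇒[]= w A
          (closed (sym (class-elim ([]=⇒lookup w∈))) (proj₁ (proj₂ (∈-filter⁻ P? {xs = allFin n} p))))))
      (λ {u} {v} p q e → let eq = class-elim {v} {u} (subst (λ S → lookup S u ≡ true) e (class-intro {u} {u} refl)) in
        toℕ-injective (≤-antisym (least-elim (proj₂ (proj₂ (∈-filter⁻ P? {xs = allFin n} p))) (sym eq))
                                 (least-elim (proj₂ (proj₂ (∈-filter⁻ P? {xs = allFin n} q))) eq)))
      where
      P? : ∀ u → Dec (lookup A u ≡ true × least u ≡ true)
      P? u = (lookup A u Boolₚ.≟ true) ×-dec (least u Boolₚ.≟ true)

  module _ {k : ℕ} (𝒱 : BubblePartition G k) where
    part : Fin n → Fin k
    part = BubblePartition.part 𝒱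

    bubble-bound : ℕ
    bubble-bound = suc n ^ α 𝒱 * 2 ^ width 𝒱

    lookup-V : ∀ i v → lookup (V 𝒱 i) v ≡ does (part v ≟ i)
    lookup-V i v = lookup∘tabulate (λ v → does (part v ≟ i)) v

    V-closed : ∀ i → ClosedUnderTwins (V 𝒱 i)
    V-closed i {u} {v} eq h with BubblePartition.bubbleUnion 𝒱 i
    ... | Bs , bubbles , V≡ =
      []=⇒lookup (subst (v ∈ˢ_) (sym V≡) (union-closed bubbles eq (subst (u ∈ˢ_) V≡ (lookup⇒[]= u _ h))))

    αInduced≤α : ∀ i → αInduced G (V 𝒱 i) ≤ α 𝒱
    αInduced≤α i = ≤-max (∈-map⁺ (λ i → αInduced G (V 𝒱 i)) (∈-allFin i))

    V⁻≤width : ∀ i → length (V⁻ 𝒱 i) ≤ width 𝒱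
    V⁻≤width i = ≤-max (∈-map⁺ (λ i → length (V⁻ 𝒱 i)) (∈-allFin i))

    splits-bound : ∀ i → length (steps (splitStep (V 𝒱 i)) (allFin n) (∅ ∷ [])) ≤ suc n ^ α 𝒱
    splits-bound i = ≤-trans (splits-length (V 𝒱 i)) (^-monoʳ-≤ (suc n) (αInduced≤α i))

    candidates-bound : ∀ i → length (candidates (V 𝒱 i)) ≤ bubble-bound
    candidates-bound i = begin
      length (candidates (V 𝒱 i)) ≡⟨ fulls-count (V 𝒱 i) (allFin n) _ ⟩
      length (steps (splitStep (V 𝒱 i)) (allFin n) (∅ ∷ [])) * 2 ^ length (leasts (V 𝒱 i) (allFin n))
        ≤⟨ *-mono-≤ (splits-bound i) (^-monoʳ-≤ 2 (≤-trans (leasts-bubbles (V 𝒱 i) (V-closed i)) (V⁻≤width i))) ⟩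
      bubble-bound ∎
      where open ≤-Reasoning

-- Leaf elimination

-- A walk in which every vertex is left by an edge other than the one it was
-- entered by closes a cycle.
module Acyclic {k : ℕ} (H : Graph k) (acyclic : ¬ Cycle H) (R : Fin k → Set)
  (next : ∀ i j → R i → ∃[ l ] R l × Adj H i l × l ≢ j) where

  private
    previous : ∀ {ℓ} → (Fin (suc ℓ) → Fin k) → Fin k
    -- A walk of one vertex has no predecessor. The vertex itself is a harmless substitute, as no
    -- neighbour equals it.
    previous {zero}  c = c zero
    previous {suc ℓ} c = c (suc zero)

    prefix-cycle : ∀ {ℓ} (c : Fin (suc ℓ) → Fin k) → Injective _≡_ _≡_ c →
                   (∀ (i : Fin ℓ) → Adj H (c (inject₁ i)) (c (suc i))) →
                   (j : Fin (suc ℓ)) → 2 ≤ toℕ j → Adj H (c j) (c zero) → Cycle H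
    prefix-cycle {ℓ} c inj step j 2≤j close = record
      { ℓ = toℕ j ; 2≤ℓ = 2≤j ; c = λ i → c (inject≤ i (toℕ<n j))
      ; distinct = λ {x} {y} eq → toℕ-injective (trans (sym (toℕ-inject≤ x (toℕ<n j)))
          (trans (cong toℕ (inj eq)) (toℕ-inject≤ y (toℕ<n j))))
      ; step = λ i → go i (toℕ<n j)
      ; close = subst (λ i → Adj H (c i) (c zero))
          (toℕ-injective (sym (trans (toℕ-inject≤ (fromℕ (toℕ j)) (toℕ<n j)) (toℕ-fromℕ (toℕ j))))) close }
      where
      go : ∀ {m} (i : Fin m) (le : suc m ≤ suc ℓ) → Adj H (c (inject≤ (inject₁ i) le)) (c (inject≤ (suc i) le))
      go i (s≤s le) = subst (λ i′ → Adj H (c i′) (c (suc (inject≤ i le))))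
        (toℕ-injective (trans (trans (toℕ-inject₁ (inject≤ i le)) (toℕ-inject≤ i le))
           (sym (trans (toℕ-inject≤ (inject₁ i) (s≤s le)) (toℕ-inject₁ i))))) (step (inject≤ i le))

    -- The newest vertex is `c zero`, so the walk grows at the front. The next vertex is fresh, or
    -- equals a vertex at distance at least two and closes a cycle. The fuel runs out only when more
    -- than `k` distinct vertices have been visited.
    go : ∀ fuel {ℓ} (c : Fin (suc ℓ) → Fin k) → Injective _≡_ _≡_ c →
         (∀ (i : Fin ℓ) → Adj H (c (inject₁ i)) (c (suc i))) → R (c zero) → k < fuel + suc ℓ → ⊥
    go zero    c inj step r lt = <⇒≱ lt (injective⇒≤ inj)
    go (suc fuel) {ℓ} c inj step r lt with next (c zero) (previous c) r
    ... | l , rl , adj , l≢ with any? (λ j → c j ≟ l)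
    ...   | no fresh = go fuel c′ inj′ step′ rl (subst (k <_) (sym (+-suc fuel (suc ℓ))) lt)
      where
      c′ : Fin (suc (suc ℓ)) → Fin k
      c′ zero    = l
      c′ (suc i) = c i
      inj′ : Injective _≡_ _≡_ c′
      inj′ {zero}  {zero}  eq = refl
      inj′ {zero}  {suc j} eq = ⊥-elim (fresh (j , sym eq))
      inj′ {suc i} {zero}  eq = ⊥-elim (fresh (i , eq))
      inj′ {suc i} {suc j} eq = cong suc (inj eq)
      step′ : ∀ (i : Fin (suc ℓ)) → Adj H (c′ (inject₁ i)) (c′ (suc i))
      step′ zero    = Graph.symmetric H adj
      step′ (suc i) = step i
    ...   | yes (zero , refl) = Graph.irreflexive H adj
    go (suc fuel) {suc ℓ} c inj step r lt | l , rl , adj , l≢ | yes (suc zero , refl) = l≢ refl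
    go (suc fuel) {suc ℓ} c inj step r lt | l , rl , adj , l≢ | yes (suc (suc j) , refl) =
      acyclic (prefix-cycle c inj step (suc (suc j)) (s≤s (s≤s z≤n)) (Graph.symmetric H adj))

  absurd : ∀ i → R i → ⊥
  absurd i r = go k {zero} (λ _ → i) (λ { {zero} {zero} _ → refl }) (λ ()) r (≤-reflexive (+-comm 1 k))

-- Merging leaves while preserving a maximum cut

module Rounds {n k : ℕ} (G : Graph n) (𝒱 : BubblePartition G k) where
  open Specification G
  open Cuts G
  open Exchange G
  open Coverage G
  open Counting G

  private
    Vᵢ : Fin k → Subset n
    Vᵢ = V 𝒱
    p : Fin n → Fin k
    p = part 𝒱
    H : Graph k
    H = contract G p

  in-V : ∀ {i v} → p v ≡ i → lookup (Vᵢ i) v ≡ true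
  in-V {i} {v} eq = trans (lookup-V 𝒱 i v) (dec-true (p v ≟ i) eq)

  of-V : ∀ {i v} → lookup (Vᵢ i) v ≡ true → p v ≡ i
  of-V {i} {v} h with p v ≟ i | lookup-V 𝒱 i v
  ... | yes eq | _ = eq
  ... | no _   | e = ⊥-elim (true≢false h e)

  meets-same : ∀ i → meets (Vᵢ i) (Vᵢ i) ≡ true
  meets-same i = let v , h = BubblePartition.surjective 𝒱 i in
    meets-intro (Vᵢ i) (Vᵢ i) v (in-V (h refl)) (in-V (h refl))

  meets-distinct : ∀ {i j} → i ≢ j → meets (Vᵢ i) (Vᵢ j) ≡ false
  meets-distinct {i} {j} i≢j with meets (Vᵢ i) (Vᵢ j) in eq
  ... | false = refl
  ... | true  = let v , a , b = meets-elim (Vᵢ i) (Vᵢ j) eq in ⊥-elim (i≢j (trans (sym (of-V a)) (of-V b)))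

  linkedOver-elim : ∀ us A B → linkedOver us A B ≡ true →
                    ∃[ u ] ∃[ v ] lookup A u ≡ true × lookup B v ≡ true × c u v ≡ true
  linkedOver-elim (u ∷ us) A B h with meets ⁅ u ⁆ A ∧ meets (C u) B in eq
  ... | true  = let a , b = ∧-true eq
                    v , uv , Bv = meets-elim (C u) B b
                in u , v , trans (sym (meets-⁅⁆ u A)) a , Bv , uv
  ... | false = linkedOver-elim us A B h

  linkedOver-intro : ∀ {us A B u v} → u ∈ us → lookup A u ≡ true → lookup B v ≡ true → c u v ≡ true →
                     linkedOver us A B ≡ true
  linkedOver-intro {us = _ ∷ us} {A} {B} {u} {v} (here refl) Au Bv uv =
    cong (_∨ linkedOver us A B) (∧-intro (trans (meets-⁅⁆ u A) Au) (meets-intro (C u) B v uv Bv))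
  linkedOver-intro {us = w ∷ us} {A} {B} (there i) Au Bv uv =
    trans (cong ((meets ⁅ w ⁆ A ∧ meets (C w) B) ∨_) (linkedOver-intro i Au Bv uv)) (Boolₚ.∨-zeroʳ _)

  Nodeᵢ : Set
  Nodeᵢ = Node Vᵢ

  near : Fin k → Fin k → Bool
  near = neighbour Vᵢ

  near-adj : ∀ {i j} → near i j ≡ true → Adj H i j
  near-adj {i} {j} h with meets (Vᵢ i) (Vᵢ j) in apart
  ... | false =
    let u , v , a , b , uv = linkedOver-elim (allFin n) (Vᵢ i) (Vᵢ j) h
        i≢j = λ { refl → true≢false (meets-same i) apart }
        u≢v = λ e → i≢j (trans (sym (of-V a)) (trans (cong p e) (of-V b)))
    in fromWitness {a? = contractedAdj? G p i j}
         (i≢j , u , v , lookup⇒[]= u _ a , lookup⇒[]= v _ b , true⇒T (trans (sym (c-edge u≢v)) uv))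

  near-intro : ∀ {u v} → c u v ≡ true → p u ≢ p v → near (p u) (p v) ≡ true
  near-intro {u} {v} uv h rewrite meets-distinct h =
    linkedOver-intro (∈-allFin u) (in-V refl) (in-V refl) uv

  degree-none : ∀ {i} xs → degree Vᵢ i xs ≡ 0 → ∀ {y} → y ∈ xs → near i (proj₁ y) ≡ false
  degree-none {i} (x ∷ xs) d (here refl) with near i (proj₁ x)
  ... | false = refl
  degree-none {i} (x ∷ xs) d (there q) with near i (proj₁ x)
  ... | false = degree-none xs d q

  degree-one : ∀ {i} xs → degree Vᵢ i xs ≤ 1 → ∀ {y z} → y ∈ xs → z ∈ xs →
               near i (proj₁ y) ≡ true → near i (proj₁ z) ≡ true → y ≡ z
  degree-one (x ∷ xs) d (here refl) (here refl) a b = refl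
  degree-one {i} (x ∷ xs) d (here refl) (there s) a b rewrite a =
    ⊥-elim (true≢false b (degree-none xs (n≤0⇒n≡0 (s≤s⁻¹ d)) s))
  degree-one {i} (x ∷ xs) d (there r) (here refl) a b rewrite b =
    ⊥-elim (true≢false a (degree-none xs (n≤0⇒n≡0 (s≤s⁻¹ d)) r))
  degree-one {i} (x ∷ xs) d (there r) (there s) a b =
    degree-one xs (≤-trans (m≤n+m _ (χ (near i (proj₁ x)))) d) r s a b

  degree-some : ∀ {i} xs → 1 ≤ degree Vᵢ i xs → ∃[ y ] y ∈ xs × near i (proj₁ y) ≡ true
  degree-some {i} (x ∷ xs) d with near i (proj₁ x) in eq
  ... | true  = x , here refl , eq
  ... | false = let y , r , h = degree-some xs d in y , there r , h

  -- Nodes have distinct keys, so at most one of two neighbours is `j`. This is the step that lets a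
  -- walk avoid turning back.
  degree-two : ∀ {i} xs → Unique (List.map proj₁ xs) → 2 ≤ degree Vᵢ i xs → ∀ j →
               ∃[ y ] y ∈ xs × near i (proj₁ y) ≡ true × proj₁ y ≢ j
  degree-two {i} (x ∷ xs) (fresh ∷ uniq) d j with near i (proj₁ x) in eq
  ... | false = let y , r , h = degree-two xs uniq d j in y , there r , h
  ... | true with proj₁ x ≟ j
  ...   | no x≢j  = x , here refl , eq , x≢j
  ...   | yes refl = let y , r , h = degree-some xs (s≤s⁻¹ d) in
    y , there r , h , λ e → All.lookup fresh (∈-map⁺ proj₁ r) (sym e)

  leaf-sound : ∀ all xs {x} → leaf Vᵢ all xs ≡ just x → x ∈ xs × degree Vᵢ (proj₁ x) all ≤ 1
  leaf-sound all (y ∷ xs) eq with degree Vᵢ (proj₁ y) all in d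
  leaf-sound all (y ∷ xs) refl | 0 = here refl , ≤-trans (≤-reflexive d) z≤n
  leaf-sound all (y ∷ xs) refl | 1 = here refl , ≤-reflexive d
  leaf-sound all (y ∷ xs) eq | suc (suc _) = let r , h = leaf-sound all xs eq in there r , h

  leaf-complete : ∀ all xs → leaf Vᵢ all xs ≡ nothing → ∀ {x} → x ∈ xs → 2 ≤ degree Vᵢ (proj₁ x) all
  leaf-complete all (y ∷ xs) eq r with degree Vᵢ (proj₁ y) all in d
  leaf-complete all (y ∷ xs) eq (here refl) | suc (suc _) = ≤-trans (s≤s (s≤s z≤n)) (≤-reflexive (sym d))
  leaf-complete all (y ∷ xs) eq (there r)   | suc (suc _) = leaf-complete all xs eq r

  -- Otherwise every remaining class has two remaining neighbours, so a walk among them never has to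
  -- turn back, and the contracted graph would contain a cycle.
  leaf-exists : ∀ x xs → Unique (List.map proj₁ (x ∷ xs)) → ∃[ y ] leaf Vᵢ (x ∷ xs) (x ∷ xs) ≡ just y
  leaf-exists x xs uniq with leaf Vᵢ (x ∷ xs) (x ∷ xs) in eq
  ... | just y  = y , refl
  ... | nothing = ⊥-elim (Acyclic.absurd H (proj₂ (proj₂ (BubblePartition.contractsTree 𝒱)))
      (_∈ List.map proj₁ (x ∷ xs)) next (proj₁ x) (here refl))
    where
    next : ∀ i j → i ∈ List.map proj₁ (x ∷ xs) → ∃[ l ] l ∈ List.map proj₁ (x ∷ xs) × Adj H i l × l ≢ j
    next i j r with ∈-map⁻ proj₁ r
    ... | y , r′ , refl =
      let z , s , h , z≢ = degree-two (x ∷ xs) uniq (leaf-complete (x ∷ xs) (x ∷ xs) eq r′) j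
      in proj₁ z , ∈-map⁺ proj₁ s , near-adj h , z≢

  best-≥ : ∀ L S {T} → T ∈ L → cut (S ∪ T) ≤ cut (best L S)
  best-≥ (R ∷ L) S r with cut (S ∪ R) ∸ cut (best L S) in d
  best-≥ (R ∷ L) S (here refl) | zero  = m∸n≡0⇒m≤n d
  best-≥ (R ∷ L) S (there r)   | zero  = best-≥ L S r
  best-≥ (R ∷ L) S (here refl) | suc _ = ≤-refl
  best-≥ (R ∷ L) S (there r)   | suc _ =
    ≤-trans (best-≥ L S r) (<⇒≤ (m∸n≢0⇒n<m (λ e → 1+n≢0 (trans (sym d) e))))

  best-shape : ∀ L S → best L S ≡ S ⊎ ∃[ T ] T ∈ L × best L S ≡ S ∪ T
  best-shape []      S = inj₁ refl
  best-shape (R ∷ L) S with cut (S ∪ R) ∸ cut (best L S)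
  ... | suc _ = inj₂ (R , here refl , refl)
  ... | zero with best-shape L S
  ...   | inj₁ e = inj₁ e
  ...   | inj₂ (T , r , e) = inj₂ (T , there r , e)

  _≟ᴹ_ : (a b : Maybe (Fin k)) → Dec (a ≡ b)
  _≟ᴹ_ = Maybeₚ.≡-dec _≟_

  Region : Set
  Region = Fin n → Maybe (Fin k)

  -- A region consists of the vertices absorbed by one node, with `nothing` for the finished part.
  -- For correctness it is enough that some entry restricts the reference cut `Z` to the region.
  record Table (q : Region) (Z : Fin n → Bool) (τ : Maybe (Fin k)) (L : List (Subset n)) : Set where
    field
      within : ∀ {S} → S ∈ L → ∀ v → lookup S v ≡ true → q v ≡ τ
      choice : Subset n
      member : choice ∈ L
      agrees : ∀ v → q v ≡ τ → lookup choice v ≡ Z v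

  -- The target `τ` may be the region of a neighbour or the finished part, whose table is the
  -- current answer alone; this treats ordinary leaves and the last node alike.
  module Merge (q : Region) (Z : Fin n → Bool) (maxZ : IsMax Z) (l : Fin k) (τ : Maybe (Fin k)) (τ≢l : τ ≢ just l)
               (separated : ∀ {u v} → c u v ≡ true → q u ≡ just l → q v ≡ just l ⊎ q v ≡ τ)
               {L L′ : List (Subset n)} (tl : Table q Z (just l) L) (tτ : Table q Z τ L′) where
    private
      module Tl = Table tl
      module Tτ = Table tτ
      A B : Subset n
      A = best L Tτ.choice
      B = Tτ.choice ∪ Tl.choice

    q′ : Region
    q′ v = if does (q v ≟ᴹ just l) then τ else q v

    q′-other : ∀ {v} → q v ≢ just l → q′ v ≡ q v
    q′-other {v} h rewrite dec-false (q v ≟ᴹ just l) h = refl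

    -- The program may choose another entry for region `l` than the one given by `Z`, so the
    -- reference cut is altered there to follow it.
    Z′ : Fin n → Bool
    Z′ v = if does (q v ≟ᴹ just l) then lookup A v else Z v

    private
      Z′-l : ∀ {v} → q v ≡ just l → Z′ v ≡ lookup A v
      Z′-l {v} h rewrite dec-true (q v ≟ᴹ just l) h = refl

      Z′-other : ∀ {v} → q v ≢ just l → Z′ v ≡ Z v
      Z′-other {v} h rewrite dec-false (q v ≟ᴹ just l) h = refl

      off-l : ∀ {S} v → S ∈ L → q v ≢ just l → lookup S v ≡ false
      off-l {S} v r h with lookup S v in e
      ... | false = refl
      ... | true  = ⊥-elim (h (Tl.within r v e))

      best-off-l : ∀ S v → q v ≢ just l → lookup (best L S) v ≡ lookup S v
      best-off-l S v h with best-shape L S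
      ... | inj₁ e = cong (λ S → lookup S v) e
      ... | inj₂ (T , r , e) = trans (cong (λ S → lookup S v) e)
        (trans (lookup-∪ S T v) (trans (cong (lookup S v ∨_) (off-l v r h)) (Boolₚ.∨-identityʳ _)))

      B-l : ∀ v → q v ≡ just l → lookup B v ≡ Z v
      B-l v h with lookup Tτ.choice v in e
      ... | true  = ⊥-elim (τ≢l (trans (sym (Tτ.within Tτ.member v e)) h))
      ... | false = trans (lookup-∪ Tτ.choice Tl.choice v)
                      (trans (cong (_∨ lookup Tl.choice v) e) (Tl.agrees v h))

      B-other : ∀ v → q v ≢ just l → lookup B v ≡ lookup Tτ.choice v
      B-other v h = trans (lookup-∪ Tτ.choice Tl.choice v)
                      (trans (cong (lookup Tτ.choice v ∨_) (off-l v Tl.member h)) (Boolₚ.∨-identityʳ _))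

      here-A : ∀ v → q v ≡ just l ⊎ q v ≡ τ → lookup A v ≡ Z′ v
      here-A v (inj₁ h) = sym (Z′-l h)
      here-A v (inj₂ h) = let ≢l = λ e → τ≢l (trans (sym h) e) in
        trans (best-off-l Tτ.choice v ≢l) (trans (Tτ.agrees v h) (sym (Z′-other ≢l)))

      here-B : ∀ v → q v ≡ just l ⊎ q v ≡ τ → lookup B v ≡ Z v
      here-B v (inj₁ h) = B-l v h
      here-B v (inj₂ h) = trans (B-other v (λ e → τ≢l (trans (sym h) e))) (Tτ.agrees v h)

      away : ∀ v → q v ≢ just l → lookup A v ≡ lookup B v
      away v h = trans (best-off-l Tτ.choice v h) (sym (B-other v h))

      cutTerm-cong : ∀ x y {u v} → x u ≡ y u → x v ≡ y v → cutTerm x u v ≡ cutTerm y u v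
      cutTerm-cong x y {u} {v} a b = cong₂ (λ a b → χ (a ∧ (c u v ∧ not b))) a b

      near-l : ∀ u v → q u ≡ just l ⊎ q u ≡ τ → q v ≡ just l ⊎ q v ≡ τ →
                 cutTerm Z u v + cutTerm (lookup A) u v ≡ cutTerm Z′ u v + cutTerm (lookup B) u v
      near-l u v a b = trans (+-comm (cutTerm Z u v) _)
          (cong₂ _+_ (cutTerm-cong (lookup A) Z′ (here-A u a) (here-A v b))
                     (cutTerm-cong Z (lookup B) (sym (here-B u a)) (sym (here-B v b))))

      -- An edge at region `l` stays within `l` and `τ`, where `A` is `Z′` and `B` is `Z`. An edge
      -- off `l` sees no difference between `Z` and `Z′`, nor between `A` and `B`. So the sums agree
      -- term by term, even though `A` and `B` leave out all other regions.
      local : ∀ u v → cutTerm Z u v + cutTerm (lookup A) u v ≡ cutTerm Z′ u v + cutTerm (lookup B) u v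
      local u v = by-cases (c u v Boolₚ.≟ true) (q u ≟ᴹ just l) (q v ≟ᴹ just l)
        where
        none : ¬ c u v ≡ true → ∀ x → cutTerm x u v ≡ 0
        none ¬uv x rewrite Boolₚ.¬-not ¬uv | Boolₚ.∧-zeroʳ (x u) = refl
        by-cases : Dec (c u v ≡ true) → Dec (q u ≡ just l) → Dec (q v ≡ just l) →
                   cutTerm Z u v + cutTerm (lookup A) u v ≡ cutTerm Z′ u v + cutTerm (lookup B) u v
        by-cases (no ¬uv) _ _ =
          trans (cong₂ _+_ (none ¬uv Z) (none ¬uv (lookup A))) (sym (cong₂ _+_ (none ¬uv Z′) (none ¬uv (lookup B))))
        by-cases (yes uv) (yes ul) _ = near-l u v (inj₁ ul) (separated uv ul)
        by-cases (yes uv) (no _) (yes vl) = near-l u v (separated (trans (c-sym v u) uv) vl) (inj₁ vl)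
        by-cases (yes uv) (no u≢) (no v≢) =
          cong₂ _+_ (cutTerm-cong Z Z′ (sym (Z′-other u≢)) (sym (Z′-other v≢)))
                    (cutTerm-cong (lookup A) (lookup B) (away u u≢) (away v v≢))

      balance : F Z + F (lookup A) ≡ F Z′ + F (lookup B)
      balance = trans (sym (∑∑-+ (cutTerm Z) (cutTerm (lookup A))))
        (trans (sum-cong-≗ (λ u → sum-cong-≗ (local u))) (∑∑-+ (cutTerm Z′) (cutTerm (lookup B))))

    -- `B` is one of the unions among which `A` was chosen as best, so by `balance` the new
    -- reference cut is at least as large as the old one.
    maxZ′ : IsMax Z′
    maxZ′ y = ≤-trans (maxZ y) (+-cancelʳ-≤ (F (lookup B)) (F Z) (F Z′) (begin
      F Z + F (lookup B) ≤⟨ +-monoʳ-≤ (F Z) (subst₂ _≤_ (cut≡F B) (cut≡F A) (best-≥ L Tτ.choice Tl.member)) ⟩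
      F Z + F (lookup A) ≡⟨ balance ⟩
      F Z′ + F (lookup B) ∎))
      where open ≤-Reasoning

    merged : Table q′ Z′ τ (List.map (best L) L′)
    merged = record
      { within = within
      ; choice = A
      ; member = ∈-map⁺ (best L) Tτ.member
      ; agrees = agrees
      }
      where
      within : ∀ {S} → S ∈ List.map (best L) L′ → ∀ v → lookup S v ≡ true → q′ v ≡ τ
      within r v h with ∈-map⁻ (best L) r
      ... | S , s , refl with q v ≟ᴹ just l
      ...   | yes vl = refl
      ...   | no v≢  = Tτ.within s v (trans (sym (best-off-l S v v≢)) h)
      agrees : ∀ v → q′ v ≡ τ → lookup A v ≡ Z′ v
      agrees v h with q v ≟ᴹ just l
      ... | yes _ = refl
      ... | no v≢ = trans (best-off-l Tτ.choice v v≢) (Tτ.agrees v h)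

    untouched : ∀ {σ K} → σ ≢ just l → σ ≢ τ → Table q Z σ K → Table q′ Z′ σ K
    untouched {σ} σ≢l σ≢τ t = record
      { within = λ r v h → let e = Table.within t r v h in trans (q′-other (λ e′ → σ≢l (trans (sym e) e′))) e
      ; choice = Table.choice t
      ; member = Table.member t
      ; agrees = agrees
      }
      where
      agrees : ∀ v → q′ v ≡ σ → lookup (Table.choice t) v ≡ Z′ v
      agrees v h with q v ≟ᴹ just l
      ... | yes _ = ⊥-elim (σ≢τ (sym h))
      ... | no v≢ = Table.agrees t v h

  keys : List Nodeᵢ → List (Fin k)
  keys = List.map proj₁

  joined-key : ∀ x y → proj₁ (joined Vᵢ x y) ≡ proj₁ y
  joined-key x y with linked (Vᵢ (proj₁ x)) (Vᵢ (proj₁ y))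
  ... | true  = refl
  ... | false = refl

  joined-length : ∀ x y → length (proj₂ (joined Vᵢ x y)) ≡ length (proj₂ y)
  joined-length x y with linked (Vᵢ (proj₁ x)) (Vᵢ (proj₁ y))
  ... | true  = length-map (best (proj₂ x)) (proj₂ y)
  ... | false = refl

  join-elim : ∀ {x z} ys → z ∈ join Vᵢ x ys → ∃[ y ] y ∈ ys × proj₁ y ≢ proj₁ x × z ≡ joined Vᵢ x y
  join-elim {x} (y ∷ ys) r with meets (Vᵢ (proj₁ x)) (Vᵢ (proj₁ y)) in e
  ... | true = let y , s , h = join-elim ys r in y , there s , h
  join-elim {x} (y ∷ ys) (here refl) | false =
    y , here refl , (λ { refl → true≢false (meets-same (proj₁ y)) e }) , refl
  join-elim {x} (y ∷ ys) (there r) | false = let y , s , h = join-elim ys r in y , there s , h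

  join-intro : ∀ {x y} ys → y ∈ ys → proj₁ y ≢ proj₁ x → joined Vᵢ x y ∈ join Vᵢ x ys
  join-intro {x} (y ∷ ys) (here refl) h rewrite meets-distinct (h ∘ sym) = here refl
  join-intro {x} (y ∷ ys) (there r) h with meets (Vᵢ (proj₁ x)) (Vᵢ (proj₁ y))
  ... | true  = join-intro ys r h
  ... | false = there (join-intro ys r h)

  join-fresh : ∀ {x} {i} ys → All (i ≢_) (keys ys) → All (i ≢_) (keys (join Vᵢ x ys))
  join-fresh []       []       = []
  join-fresh {x} (y ∷ ys) (h ∷ hs) with meets (Vᵢ (proj₁ x)) (Vᵢ (proj₁ y))
  ... | true  = join-fresh ys hs
  ... | false = (λ e → h (trans e (joined-key x y))) ∷ join-fresh ys hs

  join-unique : ∀ {x} ys → Unique (keys ys) → Unique (keys (join Vᵢ x ys))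
  join-unique []       []       = []
  join-unique {x} (y ∷ ys) (h ∷ hs) with meets (Vᵢ (proj₁ x)) (Vᵢ (proj₁ y))
  ... | true  = join-unique ys hs
  ... | false = subst (λ i → All (i ≢_) (keys (join Vᵢ x ys))) (sym (joined-key x y)) (join-fresh ys h)
                ∷ join-unique ys hs

  join-length-fresh : ∀ {x} ys → All (proj₁ x ≢_) (keys ys) → length (join Vᵢ x ys) ≡ length ys
  join-length-fresh []       []       = refl
  join-length-fresh (y ∷ ys) (h ∷ hs) rewrite meets-distinct h = cong suc (join-length-fresh ys hs)

  join-length : ∀ {x} ys → Unique (keys ys) → x ∈ ys → suc (length (join Vᵢ x ys)) ≡ length ys
  join-length {x} (y ∷ ys) (h ∷ hs) (here refl) rewrite meets-same (proj₁ x) = cong suc (join-length-fresh ys h)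
  join-length {x} (y ∷ ys) (h ∷ hs) (there r)
    rewrite meets-distinct (λ e → All.lookup h (∈-map⁺ proj₁ r) (sym e)) = cong suc (join-length ys hs r)

  -- By `crossing`, an edge between two regions has its ends in the classes that own them: vertices
  -- absorbed earlier have all their neighbours in their region. This makes the edges of the tree
  -- decide which regions touch.
  record Invariant (S : Subset n) (xs : List Nodeᵢ) : Set where
    field
      region  : Region
      unique  : Unique (keys xs)
      covered : ∀ v i → region v ≡ just i → i ∈ keys xs
      crossing   : ∀ u v → c u v ≡ true → region u ≢ region v → region u ≡ just (p u)
      best-cut : Fin n → Bool
      maximal : IsMax best-cut
      tables  : ∀ {i L} → (i , L) ∈ xs → Table region best-cut (just i) L
      done    : Table region best-cut nothing (S ∷ [])
      small-tables : ∀ {x} → x ∈ xs → length (proj₂ x) ≤ bubble-bound 𝒱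

  round-invariant : ∀ {S xs x} → Invariant S xs → leaf Vᵢ xs xs ≡ just x →
                    Invariant (collect Vᵢ x xs S) (join Vᵢ x xs)
  round-invariant {S} {xs} {l , L} I is-leaf = by-degree (degree Vᵢ l xs) refl
    where
    open Invariant I
    x∈ : (l , L) ∈ xs
    x∈ = proj₁ (leaf-sound xs xs is-leaf)
    degree≤1 : degree Vᵢ l xs ≤ 1
    degree≤1 = proj₂ (leaf-sound xs xs is-leaf)

    -- Both ends of such an edge still lie in their own classes, so it witnesses an edge of the
    -- contracted graph at the leaf.
    leaving : ∀ {u v} → c u v ≡ true → region u ≡ just l → region v ≢ just l →
              ∃[ y ] y ∈ xs × region v ≡ just (proj₁ y) × near l (proj₁ y) ≡ true
    leaving {u} {v} uv ul vl =
      let u≢v = λ e → vl (trans (sym e) ul)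
          pu = crossing u v uv u≢v
          pv = crossing v u (trans (c-sym v u) uv) (u≢v ∘ sym)
          l≡ = Maybeₚ.just-injective (trans (sym ul) pu)
          y , r , e = ∈-map⁻ proj₁ (covered v (p v) pv)
      in y , r , trans pv (cong just e) ,
         subst₂ (λ i j → near i j ≡ true) (sym l≡) e
           (near-intro uv λ e → u≢v (trans pu (trans (cong just e) (sym pv))))

    module Step (τ : Maybe (Fin k)) (τ≢l : τ ≢ just l)
                (target : ∀ {y} → y ∈ xs → near l (proj₁ y) ≡ true → just (proj₁ y) ≡ τ)
                {L′ : List (Subset n)} (tτ : Table region best-cut τ L′) where
      separated : ∀ {u v} → c u v ≡ true → region u ≡ just l → region v ≡ just l ⊎ region v ≡ τ
      separated {u} {v} uv ul with region v ≟ᴹ just l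
      ... | yes vl = inj₁ vl
      ... | no vl  = let y , r , e , h = leaving uv ul vl in inj₂ (trans e (target r h))

      open Merge region best-cut maximal l τ τ≢l separated (tables x∈) tτ public

      -- The vertices moved to `τ` had neighbours in `l` and `τ` only, so none of their edges
      -- crosses any more.
      crossing′ : ∀ u v → c u v ≡ true → q′ u ≢ q′ v → q′ u ≡ just (p u)
      crossing′ u v uv h with region u ≟ᴹ just l | region v ≟ᴹ just l
      ... | yes ul | yes vl = ⊥-elim (h refl)
      ... | yes ul | no vl with separated uv ul
      ...   | inj₁ e = ⊥-elim (vl e)
      ...   | inj₂ e = ⊥-elim (h (sym e))
      crossing′ u v uv h | no ul | yes vl = crossing u v uv (λ e → ul (trans e vl))
      crossing′ u v uv h | no ul | no vl  = crossing u v uv h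

      covered′ : (∀ i → τ ≡ just i → i ∈ keys xs) → ∀ v i → q′ v ≡ just i → i ∈ keys (join Vᵢ (l , L) xs)
      covered′ ok v i h = into (proj₁ both) (proj₂ both)
        where
        both : i ∈ keys xs × i ≢ l
        both with region v ≟ᴹ just l
        ... | yes _ = ok i h , λ e → τ≢l (trans h (cong just e))
        ... | no vl = covered v i h , λ e → vl (trans h (cong just e))
        into : i ∈ keys xs → i ≢ l → i ∈ keys (join Vᵢ (l , L) xs)
        into r i≢l with ∈-map⁻ proj₁ r
        ... | y , s , refl = subst (_∈ keys (join Vᵢ (l , L) xs)) (joined-key (l , L) y)
                               (∈-map⁺ proj₁ (join-intro xs s i≢l))

    small′ : ∀ {z} → z ∈ join Vᵢ (l , L) xs → length (proj₂ z) ≤ bubble-bound 𝒱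
    small′ r with join-elim xs r
    ... | y , s , _ , refl = subst (_≤ bubble-bound 𝒱) (sym (joined-length (l , L) y)) (small-tables s)

    by-degree : ∀ d → degree Vᵢ l xs ≡ d → Invariant (collect Vᵢ (l , L) xs S) (join Vᵢ (l , L) xs)
    by-degree zero d = record
      { region = q′ ; unique = join-unique xs unique ; covered = covered′ (λ i ())
      ; crossing = crossing′ ; best-cut = Z′ ; maximal = maxZ′ ; tables = tables′
      ; done = subst (λ b → Table q′ Z′ nothing ((if nonzero b then S else best L S) ∷ [])) (sym d) merged
      ; small-tables = small′ }
      where
      apart : ∀ {y} → y ∈ xs → near l (proj₁ y) ≡ false
      apart = degree-none xs d
      nothing≢l : nothing ≢ just l
      nothing≢l ()
      target : ∀ {y} → y ∈ xs → near l (proj₁ y) ≡ true → just (proj₁ y) ≡ nothing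
      target r h = ⊥-elim (true≢false h (apart r))
      open Step nothing nothing≢l target done
      tables′ : ∀ {i K} → (i , K) ∈ join Vᵢ (l , L) xs → Table q′ Z′ (just i) K
      tables′ r with join-elim xs r
      ... | (j , K) , s , j≢l , e with linked (Vᵢ l) (Vᵢ j) in link
      tables′ r | (j , K) , s , j≢l , refl | false = untouched (j≢l ∘ Maybeₚ.just-injective) (λ ()) (tables s)
      tables′ r | (j , K) , s , j≢l , refl | true  =
        ⊥-elim (true≢false (trans (cong (λ b → not b ∧ linked (Vᵢ l) (Vᵢ j)) (meets-distinct (j≢l ∘ sym))) link) (apart s))
    by-degree (suc d′) d with degree-some xs (≤-trans (s≤s z≤n) (≤-reflexive (sym d)))
    ... | (j , K) , j∈ , jl = record
      { region = q′ ; unique = join-unique xs unique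
      ; covered = covered′ (λ { i refl → ∈-map⁺ proj₁ j∈ })
      ; crossing = crossing′ ; best-cut = Z′ ; maximal = maxZ′ ; tables = tables′
      ; done = subst (λ b → Table q′ Z′ nothing ((if nonzero b then S else best L S) ∷ [])) (sym d)
                 (untouched (λ ()) (λ ()) done)
      ; small-tables = small′ }
      where
      only : ∀ {y} → y ∈ xs → near l (proj₁ y) ≡ true → y ≡ (j , K)
      only r h = degree-one xs degree≤1 r j∈ h jl
      j≢l : just j ≢ just l
      j≢l refl = Graph.irreflexive H (near-adj jl)
      target : ∀ {y} → y ∈ xs → near l (proj₁ y) ≡ true → just (proj₁ y) ≡ just j
      target r h = cong (just ∘ proj₁) (only r h)
      open Step (just j) j≢l target (tables j∈)
      tables′ : ∀ {i M} → (i , M) ∈ join Vᵢ (l , L) xs → Table q′ Z′ (just i) M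
      tables′ r with join-elim xs r
      ... | (i , M) , s , i≢l , e with linked (Vᵢ l) (Vᵢ i) in link
      tables′ r | (i , M) , s , i≢l , refl | false =
        untouched (i≢l ∘ Maybeₚ.just-injective) i≢j (tables s)
        where
        i≢j : just i ≢ just j
        i≢j refl = true≢false (proj₂ (∧-true {not (meets (Vᵢ l) (Vᵢ i))} jl)) link
      tables′ r | (i , M) , s , i≢l , refl | true
        with only s (trans (cong (λ b → not b ∧ linked (Vᵢ l) (Vᵢ i)) (meets-distinct (i≢l ∘ sym))) link)
      ... | refl = merged

  startNodes : List Nodeᵢ
  startNodes = List.map (λ i → i , candidates (Vᵢ i)) (allFin k)

  -- The normal form enters here, to guarantee that every initial table contains the restriction of
  -- the reference cut. From now on maximality and agreement are enough.
  start-invariant : Invariant ∅ startNodes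
  start-invariant = record
    { region = just ∘ p
    ; unique = subst Unique (sym keys-start) (allFin⁺ k)
    ; covered = λ v i e → subst (i ∈_) (sym keys-start) (∈-allFin i)
    ; crossing = λ _ _ _ _ → refl
    ; best-cut = x
    ; maximal = max-x
    ; tables = tables
    ; done = record { within = λ { (here refl) v h → ⊥-elim (true≢false h (lookup-∅ v)) }
                    ; choice = ∅ ; member = here refl ; agrees = λ v () }
    ; small-tables = λ r → let i , _ , e = ∈-map⁻ (λ i → i , candidates (Vᵢ i)) r in
        subst (λ x → length (proj₂ x) ≤ bubble-bound 𝒱) (sym e) (candidates-bound 𝒱 i)
    }
    where
    x : Fin n → Bool
    x = proj₁ stuck-exists
    max-x : IsMax x
    max-x = proj₁ (proj₂ stuck-exists)
    keys-start : keys startNodes ≡ allFin k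
    keys-start = trans (sym (map-∘ (allFin k))) (map-id (allFin k))
    tables : ∀ {i L} → (i , L) ∈ startNodes → Table (just ∘ p) x (just i) L
    tables r with ∈-map⁻ (λ i → i , candidates (Vᵢ i)) r
    ... | i , _ , refl =
      let S , s , h = candidates-cover (Vᵢ i) (V-closed 𝒱 i) max-x (proj₂ (proj₂ stuck-exists)) in record
      { within = λ r v h → cong just (of-V (candidates-within (Vᵢ i) (V-closed 𝒱 i) r v h))
      ; choice = S ; member = s
      ; agrees = λ v e → trans (h v) (cong (_∧ x v) (in-V (Maybeₚ.just-injective e)))
      }

  final-maximum : ∀ {S} → Invariant S [] → IsMaximumCut G S
  final-maximum {S} I S′ = begin
    cutSize G S′ ≡⟨ cutSize≡F S′ ⟩
    F (lookup S′) ≤⟨ maximal (lookup S′) ⟩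
    F best-cut ≡⟨ F-cong agree ⟨
    F (lookup S) ≡⟨ cutSize≡F S ⟨
    cutSize G S ∎
    where
    open ≤-Reasoning
    open Invariant I
    nowhere : ∀ v → region v ≡ nothing
    nowhere v with region v in e
    ... | nothing = refl
    ... | just i with covered v i e
    ...   | ()
    agree : ∀ v → lookup S v ≡ best-cut v
    agree v with Table.member done
    ... | r = trans (cong (λ S → lookup S v) (sym (single r))) (Table.agrees done v (nowhere v))
      where
      single : ∀ {R} → R ∈ S ∷ [] → R ≡ S
      single (here e) = e

-- Running time

size-list : (f : X → Tree) (xs : List X) (b : ℕ) → (∀ x → size (f x) ≤ b) →
            size (encodeList f xs) ≤ 1 + length xs * (1 + b)
size-list f []       b h = ≤-refl
size-list f (x ∷ xs) b h = s≤s (≤-trans (+-mono-≤ (h x) (size-list f xs b h)) (≤-reflexive (+-suc b _)))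

size-set : (S : Subset n) → size (set S) ≤ 1 + n * 4
size-set {n} S = subst (λ m → size (set S) ≤ 1 + m * 4) (length-toList S) (size-list bit (Vec.toList S) 3 bit≤3)
  where
  bit≤3 : ∀ b → size (bit b) ≤ 3
  bit≤3 false = s≤s z≤n
  bit≤3 true  = ≤-refl

power-* : ∀ x y a → x ^ a * y ^ a ≡ (x * y) ^ a
power-* x y zero    = refl
power-* x y (suc a) = trans (lemma x (x ^ a) y (y ^ a)) (cong (x * y *_) (power-* x y a))
  where
  lemma : ∀ x p y q → x * p * (y * q) ≡ x * y * (p * q)
  lemma = solve-∀

1≤size : ∀ t → 1 ≤ size t
1≤size nil     = ≤-refl
1≤size (_ ∙ _) = s≤s z≤n

module Analysis {n k : ℕ} (G : Graph n) (𝒱 : BubblePartition G k) where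
  open Specification G
  open Counting G
  open Rounds G 𝒱

  input : Tree
  input = encodeInput G 𝒱

  s M W : ℕ
  s = size input
  -- The precomputed list of vertices with their closed neighbourhoods has size at most 1 + 4n +
  -- 8n², and 13 = 1 + 4 + 8.
  M = 13 * s ^ 2
  W = bubble-bound 𝒱

  open Trust M W

  private
    Vᵢ : Fin k → Subset n
    Vᵢ = V 𝒱

    s≤M : s ≤ M
    s≤M = begin
      s         ≡⟨ *-identityʳ s ⟨
      s * 1     ≤⟨ *-monoʳ-≤ s (1≤size input) ⟩
      s * s     ≡⟨ cong (s *_) (*-identityʳ s) ⟨
      s ^ 2     ≤⟨ m≤m+n _ _ ⟩
      M ∎
      where open ≤-Reasoning

    n≤s : n ≤ s
    n≤s = begin
      n ≡⟨ spine-allFin (λ v → set (N G v)) ⟨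
      spine (encodeGraph G) ≤⟨ spine≤size (encodeGraph G) ⟩
      size (encodeGraph G) ≤⟨ m≤m+n _ _ ⟩
      size (encodeGraph G) + size (encodePartition 𝒱) <⟨ ≤-refl ⟩
      s ∎
      where open ≤-Reasoning

    k≤M : k ≤ M
    k≤M = begin
      k ≡⟨ spine-allFin (λ i → set (Vᵢ i)) ⟨
      spine (encodePartition 𝒱) ≤⟨ spine≤size (encodePartition 𝒱) ⟩
      size (encodePartition 𝒱) ≤⟨ m≤n+m _ (size (encodeGraph G)) ⟩
      size (encodeGraph G) + size (encodePartition 𝒱) <⟨ ≤-refl ⟩
      s ≤⟨ s≤M ⟩
      M ∎
      where open ≤-Reasoning

  1≤M : 1 ≤ M
  1≤M = ≤-trans (1≤size input) s≤M

  input-small : input ⊨ small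
  input-small = s≤M

  open Soundness M W 1≤M

  vertices-small : vertices ⊨ small
  vertices-small = begin
    size vertices ≤⟨ size-list vertex (allFin n) (1 + ((1 + n * 4) + (1 + n * 4)))
                       (λ u → s≤s (+-mono-≤ (size-set _) (size-set (C u)))) ⟩
    1 + length (allFin n) * (2 + ((1 + n * 4) + (1 + n * 4)))
      ≡⟨ cong (λ m → 1 + m * (2 + ((1 + n * 4) + (1 + n * 4)))) (length-tabulate {n = n} id) ⟩
    1 + n * (2 + ((1 + n * 4) + (1 + n * 4))) ≡⟨ expanded n ⟩
    1 * 1 + n * 1 * 4 + n * n * 8
      ≤⟨ +-mono-≤ (+-mono-≤ (*-mono-≤ 1≤s 1≤s) (*-monoˡ-≤ 4 (*-mono-≤ n≤s 1≤s))) (*-monoˡ-≤ 8 (*-mono-≤ n≤s n≤s)) ⟩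
    s * s + s * s * 4 + s * s * 8 ≡⟨ collected s ⟩
    M ∎
    where
    open ≤-Reasoning
    1≤s = 1≤size input
    expanded : ∀ n → 1 + n * (2 + ((1 + n * 4) + (1 + n * 4))) ≡ 1 * 1 + n * 1 * 4 + n * n * 8
    expanded = solve-∀
    collected : ∀ s → s * s + s * s * 4 + s * s * 8 ≡ 13 * (s * (s * 1))
    collected = solve-∀

  private
    table-sets : ∀ {L} → length L ≤ W → sets L ⊨ table
    table-sets {L} h = subst (_≤ W) (sym (spine-list set L)) h

    trusted! : {Γ : Vec Sort m} {τ : Sort} (e : Tm Γ τ) {p : T (trustFree e)} (ρ : Vec Tree m) → Trusted e ρ
    trusted! e {p} = trustFree-trusted e p

    trusted-ite : ∀ t {P Q : Set} → P → Q → caseTree t P (λ _ _ → Q)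
    trusted-ite nil     p q = p
    trusted-ite (_ ∙ _) p q = q

    meets-trusted : ∀ x y → Trusted meetsT (vertices ∷ x ∷ y ∷ [])
    meets-trusted x y = trusted! meetsT (vertices ∷ x ∷ y ∷ [])

    -- The assertion sits in an eagerly evaluated branch, so it is justified without regard to the
    -- outcome of the test.
    splitTerm-trusted : ∀ u t t′ L (B : Subset n) → length L ≤ W →
      Trusted splitTerm (vertex u ∷ t ∷ t′ ∷ sets L ∷ set B ∷ vertices ∷ [])
    splitTerm-trusted u t t′ L B h =
      (((tt , (tt , tt) , tt , tt) , meets-trusted (set ⁅ u ⁆) (set B)) ,
       (((tt , table-sets {L} h) , tt , (tt , tt) , ((tt , tt , tt) , trusted! initialT (vertices ∷ vertex u ∷ [])) , tt) ,
        trusted! expandT (sets L ∷ vertices ∷ set (C u) ∷ ⟦ initialT ⟧ (vertices ∷ vertex u ∷ []) ∷ [])) ,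
       tt , tt) ,
      tt , trusted-ite (⟦ meetsT ⟧ (vertices ∷ set ⁅ u ⁆ ∷ set B ∷ [])) tt tt

    fullTerm-trusted : ∀ u t t′ L (B : Subset n) → length L ≤ W →
      Trusted fullTerm (vertex u ∷ t ∷ t′ ∷ sets L ∷ set B ∷ vertices ∷ [])
    fullTerm-trusted u t t′ L B h =
      (((((tt , (tt , tt) , tt , tt) , meets-trusted (set ⁅ u ⁆) (set B)) ,
         ((tt , tt , tt) , trusted! leastT (vertices ∷ vertex u ∷ [])) , tt , tt) ,
        tt , trusted-ite (⟦ meetsT ⟧ (vertices ∷ set ⁅ u ⁆ ∷ set B ∷ [])) tt tt) ,
       (((tt , table-sets {L} h) , tt , tt ,
         ((tt , (tt , tt) , tt , tt) , trusted! classT (vertices ∷ set (C u) ∷ vertices ∷ [])) , tt) ,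
        trusted! expandT (sets L ∷ vertices ∷ nil ∷ ⟦ classT ⟧ (vertices ∷ set (C u) ∷ vertices ∷ []) ∷ [])) ,
       tt , tt) ,
      tt , trusted-ite (caseTree (⟦ meetsT ⟧ (vertices ∷ set ⁅ u ⁆ ∷ set B ∷ [])) nil
                                 (λ _ _ → ⟦ leastT ⟧ (vertices ∷ vertex u ∷ []))) tt tt

    -- The hypothesis bounds the list after all remaining steps; `steps-length` carries the bound
    -- back to the list at hand.
    splits-trusted : ∀ us L B → length (steps (splitStep B) us L) ≤ W →
      Trusted splitsT (encodeList vertex us ∷ sets L ∷ set B ∷ vertices ∷ [])
    splits-trusted []       L B h = tt , (tt , tt , tt , tt) , tt
    splits-trusted (u ∷ us) L B h =
      tt , (tt , tt , tt , tt) ,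
      (splitTerm-trusted u (encodeList vertex us) (encodeList vertex (u ∷ us)) L B
         (≤-trans (steps-length (splitStep B) (splitStep-length B) (u ∷ us) L) h) , tt , tt , tt) ,
      proj₂ (proj₂ (subst (λ t → Trusted splitsT (encodeList vertex us ∷ t ∷ set B ∷ vertices ∷ []))
        (sym (splitTerm-value u (encodeList vertex us) (encodeList vertex (u ∷ us)) L B))
        (splits-trusted us (splitStep B u L) B h))) , tt

    fulls-trusted : ∀ us L B → length (steps (fullStep B) us L) ≤ W →
      Trusted fullsT (encodeList vertex us ∷ sets L ∷ set B ∷ vertices ∷ [])
    fulls-trusted []       L B h = tt , (tt , tt , tt , tt) , tt
    fulls-trusted (u ∷ us) L B h =
      tt , (tt , tt , tt , tt) ,
      (fullTerm-trusted u (encodeList vertex us) (encodeList vertex (u ∷ us)) L B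
         (≤-trans (steps-length (fullStep B) (fullStep-length B) (u ∷ us) L) h) , tt , tt , tt) ,
      proj₂ (proj₂ (subst (λ t → Trusted fullsT (encodeList vertex us ∷ t ∷ set B ∷ vertices ∷ []))
        (sym (fullTerm-value u (encodeList vertex us) (encodeList vertex (u ∷ us)) L B))
        (fulls-trusted us (fullStep B u L) B h))) , tt

    clock : spine vertices ≡ n
    clock = spine-allFin vertex

    candidates-trusted : ∀ i → Trusted candidatesT (vertices ∷ set (Vᵢ i) ∷ [])
    candidates-trusted i =
      (tt , ((tt , (((tt , tt) , trusted! zerosT (vertices ∷ [])) , tt) , tt , tt , tt) , splits) , tt , tt , tt) , fulls
      where
      B = Vᵢ i
      first : List (Subset n)
      first = steps (splitStep B) (allFin n) (∅ ∷ [])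
      splits : Trusted splitsT (vertices ∷ (⟦ zerosT ⟧ (vertices ∷ []) ∙ nil) ∷ set B ∷ vertices ∷ [])
      splits = subst (λ t → Trusted splitsT (vertices ∷ (t ∙ nil) ∷ set B ∷ vertices ∷ []))
        (sym (zeros-value vertices clock))
        (splits-trusted (allFin n) (∅ ∷ []) B
          (≤-trans (steps-length (fullStep B) (fullStep-length B) (allFin n) first) (candidates-bound 𝒱 i)))
      splits-eq : ⟦ splitsT ⟧ (vertices ∷ (⟦ zerosT ⟧ (vertices ∷ []) ∙ nil) ∷ set B ∷ vertices ∷ []) ≡ sets first
      splits-eq = trans (cong (λ t → ⟦ splitsT ⟧ (vertices ∷ (t ∙ nil) ∷ set B ∷ vertices ∷ []))
                           (zeros-value vertices clock))
                    (splits-value (allFin n) (∅ ∷ []) B)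
      fulls : Trusted fullsT
        (vertices ∷ ⟦ splitsT ⟧ (vertices ∷ (⟦ zerosT ⟧ (vertices ∷ []) ∙ nil) ∷ set B ∷ vertices ∷ []) ∷
         set B ∷ vertices ∷ [])
      fulls = subst (λ t → Trusted fullsT (vertices ∷ t ∷ set B ∷ vertices ∷ [])) (sym splits-eq)
        (fulls-trusted (allFin n) first B (candidates-bound 𝒱 i))

    partTrees : List (Fin k) → Tree
    partTrees = encodeList (λ i → set (Vᵢ i))

    tables-trusted : ∀ is → Trusted tablesT (partTrees is ∷ vertices ∷ [])
    tables-trusted []       = tt , (tt , tt) , tt
    tables-trusted (i ∷ is) = tt , (tt , tt) , (tt , tt) , proj₂ (proj₂ (tables-trusted is)) ,
      (tt , (tt , tt , tt) , candidates-trusted i) , tt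

    nodes-sound : ∀ {S xs} → Invariant S xs → length xs ≤ M → (set S ∙ nodeTrees Vᵢ xs) ⊨ state
    nodes-sound {S} {xs} I le =
      subst (_≤ M) (sym (spine-list (node-tree Vᵢ) xs)) le , go xs (Invariant.small-tables I)
      where
      go : ∀ ys → (∀ {x} → x ∈ ys → length (proj₂ x) ≤ W) → AllNodes (nodeTrees Vᵢ ys)
      go []       h = tt
      go (y ∷ ys) h = table-sets {proj₂ y} (h (here refl)) , go ys (h ∘ there)

    start : Tree
    start = set {n} ∅ ∙ nodeTrees Vᵢ startNodes

    length-start : length startNodes ≡ k
    length-start = trans (length-map (λ i → i , candidates (Vᵢ i)) (allFin k)) (length-tabulate {n = k} id)

    -- Each round deletes one node and uses one entry of the clock. The balance of the two lengths
    -- shows that a node is available in every round and that none is left at the end.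
    RoundsResult : List (Fin k) → Set
    RoundsResult is = ∃[ S ] ∃[ xs ] Invariant S xs × length xs + length is ≡ k ×
      ⟦ roundsT ⟧ (partTrees is ∷ start ∷ vertices ∷ []) ≡ set S ∙ nodeTrees Vᵢ xs ×
      Trusted roundsT (partTrees is ∷ start ∷ vertices ∷ [])

    one-more : ∀ i is → length is < k → RoundsResult is → RoundsResult (i ∷ is)
    one-more i is h (S , [] , I , eq , val , tr) = ⊥-elim (<-irrefl eq h)
    one-more i is h (S , x ∷ xs , I , eq , val , tr) = advance (leaf-exists x xs (Invariant.unique I))
      where
      advance : ∃[ y ] leaf Vᵢ (x ∷ xs) (x ∷ xs) ≡ just y → RoundsResult (i ∷ is)
      advance (y , is-leaf) =
        collect Vᵢ y (x ∷ xs) S , join Vᵢ y (x ∷ xs) , round-invariant I is-leaf ,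
        trans (+-suc _ (length is)) (trans (cong (_+ length is)
          (join-length (x ∷ xs) (Invariant.unique I) (proj₁ (leaf-sound (x ∷ xs) (x ∷ xs) is-leaf)))) eq) ,
        trans (cong (λ t → ⟦ roundT ⟧ (t ∷ vertices ∷ [])) val) (round-value Vᵢ S (x ∷ xs) y is-leaf) ,
        tt , (tt , tt , tt) , (tt , tt , tt) , proj₂ (proj₂ tr) ,
        (((tt , subst (_⊨ state) (sym val)
                  (nodes-sound I (≤-trans (≤-trans (m≤m+n _ (length is)) (≤-reflexive eq)) k≤M))) , tt , tt) ,
         trusted! roundT (⟦ roundsT ⟧ (partTrees is ∷ start ∷ vertices ∷ []) ∷ vertices ∷ []))

    rounds-correct : ∀ is → length is ≤ k → RoundsResult is
    rounds-correct [] h = ∅ , startNodes , start-invariant , trans (+-identityʳ _) length-start , refl ,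
      tt , (tt , tt , tt) , tt
    rounds-correct (i ∷ is) h = one-more i is h (rounds-correct is (<⇒≤ h))

    trees : Tree
    trees = partTrees (allFin k)

    start-value : ⟦ zerosT ⟧ (vertices ∷ []) ∙ ⟦ tablesT ⟧ (trees ∷ vertices ∷ []) ≡ start
    start-value = cong₂ _∙_ (zeros-value vertices clock) (tables-value Vᵢ (allFin k))

    SolveResult : Tree → Set
    SolveResult v = ∃[ S ] IsMaximumCut G S × ⟦ solveT ⟧ (v ∷ input ∷ []) ≡ set S × Trusted solveT (v ∷ input ∷ [])

    last-round : RoundsResult (allFin k) → SolveResult vertices
    last-round (S , x ∷ xs , I , eq , _) = ⊥-elim (<-irrefl
      (sym (trans (cong (λ m → suc (length xs) + m) (sym (length-tabulate {n = k} id))) eq)) (s≤s (m≤n+m k (length xs))))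
    last-round (S , [] , I , eq , val , tr) =
      S , final-maximum I ,
      cong head (trans (cong (λ t → ⟦ roundsT ⟧ (trees ∷ t ∷ vertices ∷ [])) start-value) val) ,
      (((tt , tt) ,
        (((tt , tt) , trusted! zerosT (vertices ∷ [])) , ((tt , tt) , tt , tt) , tables-trusted (allFin k)) ,
        tt , tt) ,
       subst (λ t → Trusted roundsT (trees ∷ t ∷ vertices ∷ [])) (sym start-value) tr) ,
      trusted-ite (⟦ roundsT ⟧ (trees ∷ (⟦ zerosT ⟧ (vertices ∷ []) ∙ ⟦ tablesT ⟧ (trees ∷ vertices ∷ [])) ∷
                                vertices ∷ [])) tt tt
      where
      head : Tree → Tree
      head t = caseTree t nil (λ x _ → x)

    solve-correct : SolveResult (⟦ verticesT ⟧ (encodeGraph G ∷ ((nil ∙ nil) ∙ nil) ∷ encodeGraph G ∷ []))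
    solve-correct = subst SolveResult (sym vertices-value)
      (last-round (rounds-correct (allFin k) (≤-reflexive (length-tabulate {n = k} id))))

  main-correct : ∃[ S ] IsMaximumCut G S × ⟦ mainT ⟧ (input ∷ []) ≡ set S × cost mainT (input ∷ []) ≤ bound mainT M W
  main-correct =
    let S , max , val , tr = solve-correct
        trusted : Trusted mainT (input ∷ [])
        trusted = ((((tt , tt) , ((tt , tt) , tt) , (tt , tt) , tt) ,
                    trusted! verticesT (encodeGraph G ∷ ((nil ∙ nil) ∙ nil) ∷ encodeGraph G ∷ [])) ,
                   subst (_⊨ small) (sym vertices-value) vertices-small) , tr
    in S , max , val , proj₂ (sound mainT {input ∷ []} trusted (input-small ∷ []))

  private
    1≤n : 1 ≤ n
    1≤n with BubblePartition.surjective 𝒱 (Fin.fromℕ< (proj₁ (BubblePartition.contractsTree 𝒱)))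
    ... | v , _ = ≤-trans (s≤s z≤n) (toℕ<n v)

    αInduced≤n : ∀ S → αInduced G S ≤ n
    αInduced≤n S = max≤v⁺ z≤n (map⁺ {f = ∣_∣}
      (universal ∣p∣≤n (filter (λ I → (I ⊆? S) ×-dec independent? G I) (allSubsets n))))

    α≤n : α 𝒱 ≤ n
    α≤n = max≤v⁺ z≤n (map⁺ (universal (αInduced≤n ∘ Vᵢ) (allFin k)))

  1≤W : 1 ≤ W
  1≤W = *-mono-≤ (1≤^ (suc n) (α 𝒱) (s≤s z≤n)) (1≤^ 2 (width 𝒱) (s≤s z≤n))

  W-bound : W ^ 2 ≤ 4 * (n ^ (4 * α 𝒱) * 4 ^ width 𝒱)
  W-bound = begin
    W ^ 2 ≡⟨ squares (suc n ^ α 𝒱) (2 ^ width 𝒱) ⟩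
    (suc n ^ α 𝒱) * (suc n ^ α 𝒱) * (2 ^ width 𝒱 * 2 ^ width 𝒱)
      ≡⟨ cong ((suc n ^ α 𝒱) * (suc n ^ α 𝒱) *_) (power-* 2 2 (width 𝒱)) ⟩
    (suc n ^ α 𝒱) * (suc n ^ α 𝒱) * 4 ^ width 𝒱 ≡⟨ cong (_* 4 ^ width 𝒱) (power-* (suc n) (suc n) (α 𝒱)) ⟩
    (suc n * suc n) ^ α 𝒱 * 4 ^ width 𝒱 ≤⟨ *-monoˡ-≤ (4 ^ width 𝒱) (powers n (α 𝒱) 1≤n α≤n) ⟩
    4 * n ^ (4 * α 𝒱) * 4 ^ width 𝒱 ≡⟨ *-assoc 4 (n ^ (4 * α 𝒱)) (4 ^ width 𝒱) ⟩
    4 * (n ^ (4 * α 𝒱) * 4 ^ width 𝒱) ∎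
    where
    open ≤-Reasoning
    squares : ∀ x y → (x * y) * ((x * y) * 1) ≡ x * x * (y * y)
    squares = solve-∀
    -- For `n ≥ 2` the inequality `n + 1 ≤ n * n` turns the exponent `2a` of `n + 1` into `4a`. For
    -- `n = 1` all powers of `n` are 1, but then `a ≤ 1`, and the factor 4 is the square of `n + 1`.
    powers : ∀ n a → 1 ≤ n → a ≤ n → (suc n * suc n) ^ a ≤ 4 * n ^ (4 * a)
    powers 1 zero          _ _ = s≤s z≤n
    powers 1 (suc zero)    _ _ = ≤-refl
    powers 1 (suc (suc a)) _ (s≤s ())
    powers (suc (suc n)) a _ _ = begin
      (suc b * suc b) ^ a ≤⟨ ^-monoˡ-≤ a (*-mono-≤ step step) ⟩
      (b * b * (b * b)) ^ a ≡⟨ cong (_^ a) (fourth b) ⟩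
      (b ^ 4) ^ a ≡⟨ ^-*-assoc b 4 a ⟩
      b ^ (4 * a) ≤⟨ m≤m+n _ _ ⟩
      4 * b ^ (4 * a) ∎
      where
      b = suc (suc n)
      step : suc b ≤ b * b
      step = begin
        1 + b ≤⟨ +-monoˡ-≤ b (s≤s (z≤n {suc n})) ⟩
        b + b ≡⟨ cong (b +_) (+-identityʳ b) ⟨
        2 * b ≤⟨ *-monoˡ-≤ b (s≤s (s≤s (z≤n {n}))) ⟩
        b * b ∎
      fourth : ∀ b → b * b * (b * b) ≡ b * (b * (b * (b * 1)))
      fourth = solve-∀

abstract
  -- The degree 2 comes from `bestT` inside `mergeT`, the deepest nesting of table loops; that
  -- nothing nests deeper is decided by evaluating `fits`.
  main-poly : Poly 2 (bound mainT)
  main-poly = bound-poly mainT 2 tt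

theorem3 : Σ[ P ∈ Program ] Σ[ c ∈ ℕ ] Σ[ d ∈ ℕ ]
    (∀ {n k : ℕ} (G : Graph n) (𝒱 : BubblePartition G k) →
    Σ[ S ∈ Subset n ] Σ[ t ∈ ℕ ]
    IsMaximumCut G S
    × P ⟨ encodeInput G 𝒱 ⟩⇓ encodeSubset S [ t ]
    × t ≤ c * size (encodeInput G 𝒱) ^ d * (n ^ (4 * α 𝒱) * 4 ^ width 𝒱))
theorem3 = program mainT , K * 13 ^ d * 4 , 2 * d , λ {n} G 𝒱 →
  let open Analysis G 𝒱
      S , max , val , le = main-correct
      X = n ^ (4 * α 𝒱) * 4 ^ width 𝒱
      open ≤-Reasoning
  in S , cost mainT (input ∷ []) , max ,
     subst (λ v → program mainT ⟨ input ⟩⇓ v [ cost mainT (input ∷ []) ]) val (program-correct mainT input) ,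
     (begin
       cost mainT (input ∷ [])             ≤⟨ le ⟩
       bound mainT M W                     ≤⟨ bounded M W 1≤M 1≤W ⟩
       K * (M ^ d * W ^ 2)                 ≤⟨ *-monoʳ-≤ K (*-monoʳ-≤ (M ^ d) W-bound) ⟩
       K * (M ^ d * (4 * X))               ≡⟨ cong (λ p → K * (p * (4 * X))) (powers s) ⟩
       K * (13 ^ d * s ^ (2 * d) * (4 * X)) ≡⟨ rearrange K (13 ^ d) (s ^ (2 * d)) X ⟩
       K * 13 ^ d * 4 * s ^ (2 * d) * X ∎)
  where
  K d : ℕ
  K = proj₁ main-poly
  d = proj₁ (proj₂ main-poly)
  bounded : ∀ M W → 1 ≤ M → 1 ≤ W → bound mainT M W ≤ K * (M ^ d * W ^ 2)
  bounded = proj₂ (proj₂ main-poly)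
  powers : ∀ s → (13 * s ^ 2) ^ d ≡ 13 ^ d * s ^ (2 * d)
  powers s = trans (sym (power-* 13 (s ^ 2) d)) (cong (13 ^ d *_) (^-*-assoc s 2 d))
  rearrange : ∀ K a b X → K * (a * b * (4 * X)) ≡ K * a * 4 * b * X
  rearrange = solve-∀
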